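{- Let $q$ be an odd prime power, let $\gamma$ be a nonzero element of $\mathbf{F}_{q^4}$ whose multiplicative order is $2(q^2-1)$, and let $\rho$ be an element of $\mathbf{F}_{q^2}\setminus\mathbf{F}_q$ with $\rho^2\in\mathbf{F}_q$. Let $S_4$ be the union of the two sets \[\{(\gamma^i-1)/(\gamma^i+1) \mid i \text{ odd},\ 1\le i\le (q+1)/2\}\] and \[\{\rho(\gamma^i-1)/(\gamma^i+1) \mid i \text{ odd},\ 1\le i\le (q-1)/2\}.\] Then the homogenized minimal polynomials (over $\mathbf{F}_q$) of the elements of $S_4$ form a complete set of unique representatives for the action of $\mathrm{PGL}_2(\mathbf{F}_q)$ on the monic irreducible homogeneous bivariate quartics over $\mathbf{F}_q$; that is, each orbit contains exactly one of them.
   Context: For a finite field $k$, a homogeneous polynomial $f\in k[x,y]$ is called monic if $f(x,1)$ is monic as a univariate polynomial. $\mathrm{PGL}_2(k)$ acts on monic homogeneous polynomials as follows: if $\Gamma\in\mathrm{PGL}_2(k)$ is represented by the matrix $\begin{bmatrix}a&b\\c&d\end{bmatrix}$, then $\Gamma(f)$ is the unique monic polynomial that is a nonzero scalar multiple of $f(dx-by,-cx+ay)$. The homogenized minimal polynomial of an algebraic element $\alpha$ of degree $m$ over $k$ with minimal polynomial $h(x)$ is $y^m h(x/y)$. -}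

module Defs where

open import Level using (Level; _⊔_)
open import Algebra.Bundles using (CommutativeRing)
open import Data.Nat as ℕ using (ℕ; zero; suc; _∸_; _≤_; _<_)
open import Data.Nat.DivMod using (_/_)
open import Data.Nat.Primality using (Prime)
open import Data.Fin using (Fin)
open import Data.List using (List; []; _∷_; length; map; zipWith; foldr; upTo; replicate)
open import Data.List.Relation.Unary.All using (All)
open import Data.List.Relation.Binary.Pointwise using (Pointwise)
open import Data.Product using (Σ; ∃; ∃-syntax; _×_; _,_)
open import Data.Sum using (_⊎_)
open import Data.Empty using (⊥)
open import Relation.Nullary using (¬_)
open import Relation.Binary.PropositionalEquality using (_≡_; _≢_)

OddPrimePower : ℕ → Set
OddPrimePower q = ∃[ p ] ∃[ k ] (Prime p × p ≢ 2 × q ≡ p ℕ.^ suc k)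

OddNat : ℕ → Set
OddNat i = ∃[ k ] (i ≡ 2 ℕ.* k ℕ.+ 1)

module FieldDefs {c ℓ : Level} (R : CommutativeRing c ℓ) where
  open CommutativeRing R

  IsField : Set (c ⊔ ℓ)
  IsField = (¬ (1# ≈ 0#)) × (∀ x → ¬ (x ≈ 0#) → ∃[ y ] (x * y ≈ 1#))

  HasCard : ℕ → Set (c ⊔ ℓ)
  HasCard N = Σ (Fin N → Carrier) λ e →
    (∀ i j → e i ≈ e j → i ≡ j) × (∀ x → ∃[ i ] (e i ≈ x))

  pow : Carrier → ℕ → Carrier
  pow x zero = 1#
  pow x (suc n) = x * pow x n

  _-ᴷ_ : Carrier → Carrier → Carrier
  x -ᴷ y = x + (- y)

  -- membership in the subfield F_m = { x | x^m = x } (m = q, q^2, ...)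
  InF : ℕ → Carrier → Set ℓ
  InF m x = pow x m ≈ x

  HasOrder : Carrier → ℕ → Set ℓ
  HasOrder γ n = (0 < n) × (pow γ n ≈ 1#) × (∀ m → 0 < m → m < n → ¬ (pow γ m ≈ 1#))

  -- Polynomials: coefficient lists [a₀, a₁, …, a_n].
  -- Univariate: a₀ + a₁ x + … + a_n xⁿ.
  -- Homogeneous of degree n (list of length n+1): Σ aᵢ xⁱ y^(n-i).
  Poly : Set c
  Poly = List Carrier

  eval : Poly → Carrier → Carrier
  eval [] x = 0#
  eval (a ∷ p) x = a + x * eval p x

  Monic : Poly → Set ℓ
  Monic [] = Lift′
    where Lift′ = Level.Lift ℓ ⊥
  Monic (a ∷ []) = a ≈ 1#
  Monic (a ∷ b ∷ p) = Monic (b ∷ p)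

  CoeffsIn : ℕ → Poly → Set (c ⊔ ℓ)
  CoeffsIn q p = All (InF q) p

  _≋_ : Poly → Poly → Set (c ⊔ ℓ)
  f ≋ g = Pointwise _≈_ f g

  addP : Poly → Poly → Poly
  addP [] g = g
  addP (a ∷ f) [] = a ∷ f
  addP (a ∷ f) (b ∷ g) = (a + b) ∷ addP f g

  scale : Carrier → Poly → Poly
  scale a = map (a *_)

  -- product (of homogeneous polynomials: degrees add; lengths m+1, n+1 ↦ m+n+1)
  mulP : Poly → Poly → Poly
  mulP [] g = []
  mulP (a ∷ f) g = addP (scale a g) (0# ∷ mulP f g)

  powP : Poly → ℕ → Poly
  powP L zero = 1# ∷ []
  powP L (suc k) = mulP L (powP L k)

  IsMinPoly : ℕ → Carrier → Poly → Set (c ⊔ ℓ)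
  IsMinPoly q α h = CoeffsIn q h × Monic h × (eval h α ≈ 0#) ×
    (∀ g → CoeffsIn q g → Monic g → eval g α ≈ 0# → length h ≤ length g)

  -- homogenization y^m h(x/y): in our coefficient-list representation of
  -- homogeneous polynomials of degree m = length h - 1 it has the same coefficients
  homogenize : Poly → Poly
  homogenize h = h

  IrreducibleHom : ℕ → Poly → Set (c ⊔ ℓ)
  IrreducibleHom q f = ∀ g h → CoeffsIn q g → CoeffsIn q h →
    2 ≤ length g → 2 ≤ length h → length g ℕ.+ length h ≡ suc (length f) →
    ¬ (mulP g h ≋ f)

  MonicIrredQuartic : ℕ → Poly → Set (c ⊔ ℓ)
  MonicIrredQuartic q f = CoeffsIn q f × length f ≡ 5 × Monic f × IrreducibleHom q f

  substP : Carrier → Carrier → Carrier → Carrier → Poly → Poly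
  substP a b c' d f =
    foldr addP [] (zipWith (λ i fi → scale fi (mulP (powP L₁ i) (powP L₂ (n ∸ i))))
                           (upTo (length f)) f)
    where
      n = length f ∸ 1
      L₁ = (- b) ∷ d ∷ []
      L₂ = a ∷ (- c') ∷ []

  -- g = Γ(f) for some Γ = [a b; c d] ∈ PGL₂(F_q): g is a nonzero scalar
  -- multiple of f(dx - by, -cx + ay) (and g is monic)
  SameOrbit : ℕ → Poly → Poly → Set (c ⊔ ℓ)
  SameOrbit q f g = ∃[ a ] ∃[ b ] ∃[ c' ] ∃[ d ] ∃[ λ' ]
    (InF q a × InF q b × InF q c' × InF q d × InF q λ' ×
     ¬ ((a * d) -ᴷ (b * c') ≈ 0#) × ¬ (λ' ≈ 0#) × Monic g ×
     (g ≋ scale λ' (substP a b c' d f)))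

  -- membership in S₄ (division written multiplicatively: s = num/den ⇔ s·den = num,
  -- the denominators γ^i + 1 being nonzero)
  InS4 : ℕ → Carrier → Carrier → Carrier → Set ℓ
  InS4 q γ ρ s =
    (∃[ i ] (OddNat i × 1 ≤ i × i ≤ (q ℕ.+ 1) / 2 ×
            s * (pow γ i + 1#) ≈ pow γ i -ᴷ 1#))
    ⊎ (∃[ i ] (OddNat i × 1 ≤ i × i ≤ (q ∸ 1) / 2 ×
            s * (pow γ i + 1#) ≈ ρ * (pow γ i -ᴷ 1#)))

  HomMinPolyOfS4 : ℕ → Carrier → Carrier → Poly → Set (c ⊔ ℓ)
  HomMinPolyOfS4 q γ ρ f = ∃[ s ] ∃[ h ] (InS4 q γ ρ s × IsMinPoly q s h × f ≋ homogenize h)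

  CompleteUniqueReps : ℕ → (Poly → Set (c ⊔ ℓ)) → Set (c ⊔ ℓ)
  CompleteUniqueReps q P =
    (∀ f → P f → MonicIrredQuartic q f) ×
    (∀ f → MonicIrredQuartic q f → ∃[ g ] (P g × SameOrbit q f g)) ×
    (∀ f g → P f → P g → SameOrbit q f g → f ≋ g)

{-# OPTIONS --safe #-}
-- Let φ be the map x ↦ x^q. An irreducible quartic f over F_q has a root α in F_{q⁴}: the field
-- F_q[x]/(f) has q⁴ elements, so f divides x^(q⁴) - x. The roots of f are the conjugates φ^j(α), and
-- Γ(f) has the root Γ(α), so the orbits of quartics correspond to the orbits of F_{q⁴} \ F_{q²} under
-- PGL₂(F_q) and φ.
--
-- Some involution in PGL₂(F_q) maps α to φ²(α). Conjugating it to x ↦ η²/x with η = 1 or η = ρ, we may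
-- assume α φ²(α) = η². The Cayley parameter β, given by α = η (β - 1)/(β + 1), then satisfies
-- φ²(β) = - β, which means β = γ^i with i odd. The centraliser of the involution acts by β ↦ u β^(±1),
-- where u^(q-1) = 1 if η = 1 and u^(q+1) = 1 if η = ρ, while φ acts by β ↦ β^q or β ↦ β^(-q). Hence i
-- only matters modulo q + 1 (if η = 1) or q - 1 (if η = ρ) and up to sign.
--
-- Conversely, α has degree 4 over F_q, so an element of PGL₂(F_q) relating two normalised elements
-- commutes with the involution, and β^(2(q-1)) (if η = 1) or β^(2(q+1)) (if η = ρ) is determined up
-- to inversion by the orbit.
module Submission where

open import Defs
open import Algebra.Bundles using (AbelianGroup; CommutativeRing; RawRing)
open import Algebra.Construct.DirectProduct using (abelianGroup)
import Algebra.Morphism.RingMonomorphism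
open import Algebra.Morphism.Structures using (IsRingMonomorphism)
import Algebra.Properties.AbelianGroup
import Algebra.Properties.CommutativeMonoid.Sum
import Algebra.Properties.CommutativeSemiring.Binomial
import Algebra.Properties.CommutativeSemiring.Exp
import Algebra.Properties.Monoid.Sum
import Algebra.Properties.Ring
import Algebra.Properties.Semiring.Mult
import Algebra.Properties.Semiring.Mult.TCOptimised
import Algebra.Solver.Ring
open import Algebra.Solver.Ring.AlmostCommutativeRing using (_-Raw-AlmostCommutative⟶_; fromCommutativeRing)
open import Data.Fin as Fin using (Fin)
open import Data.Fin.Permutation using (Permutation′; _⟨$⟩ʳ_; permutation)
import Data.Fin.Properties as Finₚ
open import Data.Integer as ℤ using (ℤ)
import Data.Integer.Properties as ℤₚ
open import Data.List using (List; []; _++_; _∷_; length; replicate; tabulate)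
import Data.List.Properties as Listₚ
open import Data.List.Relation.Binary.Pointwise as Pointwise using (Pointwise; []; _∷_)
open import Data.List.Relation.Unary.All as All using (All; []; _∷_)
import Data.List.Relation.Unary.All.Properties as Allₚ
open import Data.List.Relation.Unary.AllPairs using (AllPairs; []; _∷_)
import Data.List.Relation.Unary.AllPairs.Properties as AllPairsₚ
open import Data.Maybe using (Maybe; just; nothing)
open import Data.Nat as ℕ using (_!; _<_; _∸_; _≤_; suc; s≤s; zero; z≤n; ℕ)
open import Data.Nat.Combinatorics using (_C_; k![n∸k]!∣n!; nCn≡1)
open import Data.Nat.Combinatorics.Specification using (nCk≡n!/k![n-k]!)
open import Data.Nat.DivMod using (_%_; _/_; m%n<n; m*n/n≡m; m/n*n≡m; m≡m%n+[m/n]*n)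
open import Data.Nat.Divisibility using (*-cancelˡ-∣; _∣_; divides; ∣-refl; ∣1⇒≡1; ∣m⇒∣m*n; ∣⇒≤)
open import Data.Nat.Primality using (Prime; euclidsLemma; prime⇒irreducible; ¬prime[0]; ¬prime[1])
import Data.Nat.Properties as ℕₚ
open import Data.Nat.Solver using (module +-*-Solver)
open import Data.Product as Product using (_,_; _×_; proj₁; proj₂; Σ; ∃-syntax)
open import Data.Product.Relation.Binary.Pointwise.NonDependent using (×-setoid)
open import Data.Sum as Sum using ([_,_]′; _⊎_; inj₁; inj₂)
open import Data.Vec.Functional using (removeAt)
open import Function using (_∘_)
open import Level using (Level; _⊔_)
open import Relation.Binary.Bundles using (Setoid)
open import Relation.Binary.PropositionalEquality as ≡ using (_≡_; _≢_)
import Relation.Binary.Reasoning.Setoid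
open import Relation.Nullary using (Dec; contradiction; no; yes; ¬_)
open import Relation.Nullary.Decidable using (map′)

-- The ambient field is known only through its q⁴ elements, and F_q is just the fixed set of φ, so
-- even its cardinality has to be derived: the nonzero elements of F_q are the powers of γ^(2(q+1)),
-- which has order q - 1. Only then can the elements of F_q[x]/(f) be counted.
--
-- An involution over F_q taking α to φ²(α) exists because 1, α + φ²(α) and α φ²(α) lie in F_(q²),
-- which is two-dimensional over F_q, and so are linearly dependent. When its centre b is finite, (α
-- - b)(φ²(α) - b) lies in F_q and has a square root in F_(q²); η is 1 or ρ according to whether φ
-- fixes or negates that root.
--
-- The multipliers u alone shift the exponent i by multiples of 2(q+1) for η = 1 and of 2(q-1) for η
-- = ρ. Combining φ with an inversion halves this period, and inversion then folds the exponents
-- into i ≤ (q ± 1)/2. On the side of invariants, φ turns β^(q-1), respectively β^(q+1), into the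
-- negative of its inverse, because β^(q²-1) = -1; the factor 2 in the exponents 2(q-1) and 2(q+1)
-- removes this sign.

private module Nat = +-*-Solver

-- Ring identities with integer coefficients.

module IntegerSolver {c ℓ : Level} (R : CommutativeRing c ℓ) where
  open CommutativeRing R
  open Algebra.Properties.Ring ring
    using (-0#≈0#; -‿involutive; -‿distribˡ-*; -‿distribʳ-*)
  open Algebra.Properties.AbelianGroup +-abelianGroup using (⁻¹-∙-comm)
  open Algebra.Properties.Semiring.Mult.TCOptimised semiring
    using (1+×; ×-homo-+; ×1-homo-*) renaming (_×_ to _·_)
  open Relation.Binary.Reasoning.Setoid setoid

  -- The canonical homomorphism from ℤ. With the optimised multiples the images of 0 and 1 reduce to
  -- `0#` and `1#`, so goals keep their literal constants.
  ⟦_⟧ℤ : ℤ → Carrier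
  ⟦ ℤ.+ n ⟧ℤ = n · 1#
  ⟦ ℤ.-[1+ n ] ⟧ℤ = - (suc n · 1#)

  neg-homo : ∀ i → ⟦ ℤ.- i ⟧ℤ ≈ - ⟦ i ⟧ℤ
  neg-homo (ℤ.+ zero) = sym -0#≈0#
  neg-homo (ℤ.+ (suc n)) = refl
  neg-homo ℤ.-[1+ n ] = sym (-‿involutive _)

  ⊖-homo : ∀ m n → ⟦ m ℤ.⊖ n ⟧ℤ ≈ m · 1# + - (n · 1#)
  ⊖-homo zero zero = sym (-‿inverseʳ _)
  ⊖-homo zero (suc n) = sym (+-identityˡ _)
  ⊖-homo (suc m) zero = sym (trans (+-congˡ -0#≈0#) (+-identityʳ _))
  ⊖-homo (suc m) (suc n) = begin
    ⟦ suc m ℤ.⊖ suc n ⟧ℤ ≡⟨ ≡.cong ⟦_⟧ℤ (ℤₚ.[1+m]⊖[1+n]≡m⊖n m n) ⟩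
    ⟦ m ℤ.⊖ n ⟧ℤ ≈⟨ ⊖-homo m n ⟩
    M + - N ≈⟨ +-congʳ (trans (+-congʳ (-‿inverseʳ 1#)) (+-identityˡ M)) ⟨
    ((1# + - 1#) + M) + - N ≈⟨ +-congʳ (trans (+-assoc _ _ _) (trans (+-congˡ (+-comm _ _)) (sym (+-assoc _ _ _)))) ⟩
    ((1# + M) + - 1#) + - N ≈⟨ +-assoc _ _ _ ⟩
    (1# + M) + (- 1# + - N) ≈⟨ +-cong (sym (1+× m 1#)) (trans (⁻¹-∙-comm 1# N) (-‿cong (sym (1+× n 1#)))) ⟩
    suc m · 1# + - (suc n · 1#) ∎
    where M = m · 1#
          N = n · 1#

  add-homo : ∀ i j → ⟦ i ℤ.+ j ⟧ℤ ≈ ⟦ i ⟧ℤ + ⟦ j ⟧ℤ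
  add-homo (ℤ.+ m) (ℤ.+ n) = ×-homo-+ 1# m n
  add-homo (ℤ.+ m) ℤ.-[1+ n ] = ⊖-homo m (suc n)
  add-homo ℤ.-[1+ m ] (ℤ.+ n) = trans (⊖-homo n (suc m)) (+-comm _ _)
  add-homo ℤ.-[1+ m ] ℤ.-[1+ n ] = begin
    - (suc (suc (m ℕ.+ n)) · 1#) ≡⟨ ≡.cong (λ k → - (k · 1#)) (≡.cong suc (ℕₚ.+-suc m n)) ⟨
    - ((suc m ℕ.+ suc n) · 1#) ≈⟨ -‿cong (×-homo-+ 1# (suc m) (suc n)) ⟩
    - (suc m · 1# + suc n · 1#) ≈⟨ ⁻¹-∙-comm _ _ ⟨
    - (suc m · 1#) + - (suc n · 1#) ∎

  mul-homo⁺ : ∀ m j → ⟦ ℤ.+ m ℤ.* j ⟧ℤ ≈ m · 1# * ⟦ j ⟧ℤ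
  mul-homo⁺ m (ℤ.+ n) = trans (reflexive (≡.cong ⟦_⟧ℤ (≡.sym (ℤₚ.pos-* m n)))) (×1-homo-* m n)
  mul-homo⁺ m ℤ.-[1+ n ] = begin
    ⟦ ℤ.+ m ℤ.* ℤ.-[1+ n ] ⟧ℤ ≡⟨ ≡.cong ⟦_⟧ℤ (ℤₚ.neg-distribʳ-* (ℤ.+ m) (ℤ.+ suc n)) ⟨
    ⟦ ℤ.- (ℤ.+ m ℤ.* ℤ.+ suc n) ⟧ℤ ≈⟨ neg-homo (ℤ.+ m ℤ.* ℤ.+ suc n) ⟩
    - ⟦ ℤ.+ m ℤ.* ℤ.+ suc n ⟧ℤ ≈⟨ -‿cong (mul-homo⁺ m (ℤ.+ suc n)) ⟩
    - (m · 1# * (suc n · 1#)) ≈⟨ -‿distribʳ-* _ _ ⟩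
    m · 1# * - (suc n · 1#) ∎

  mul-homo : ∀ i j → ⟦ i ℤ.* j ⟧ℤ ≈ ⟦ i ⟧ℤ * ⟦ j ⟧ℤ
  mul-homo (ℤ.+ m) j = mul-homo⁺ m j
  mul-homo ℤ.-[1+ m ] j = begin
    ⟦ ℤ.-[1+ m ] ℤ.* j ⟧ℤ ≡⟨ ≡.cong ⟦_⟧ℤ (ℤₚ.neg-distribˡ-* (ℤ.+ suc m) j) ⟨
    ⟦ ℤ.- (ℤ.+ suc m ℤ.* j) ⟧ℤ ≈⟨ neg-homo (ℤ.+ suc m ℤ.* j) ⟩
    - ⟦ ℤ.+ suc m ℤ.* j ⟧ℤ ≈⟨ -‿cong (mul-homo⁺ (suc m) j) ⟩
    - (suc m · 1# * ⟦ j ⟧ℤ) ≈⟨ -‿distribˡ-* _ _ ⟩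
    - (suc m · 1#) * ⟦ j ⟧ℤ ∎

  morphism : ℤ.+-*-rawRing -Raw-AlmostCommutative⟶ fromCommutativeRing R
  morphism = record
    { ⟦_⟧ = ⟦_⟧ℤ ; +-homo = add-homo ; *-homo = mul-homo ; -‿homo = neg-homo
    ; 0-homo = refl ; 1-homo = refl }

  -- Only coefficients equal in ℤ are identified. In positive characteristic this is incomplete, but
  -- every identity handed to the solver already holds over ℤ.
  coefficient-≟ : ∀ i j → Maybe (⟦ i ⟧ℤ ≈ ⟦ j ⟧ℤ)
  coefficient-≟ i j with i ℤ.≟ j
  ... | yes i≡j = just (reflexive (≡.cong ⟦_⟧ℤ i≡j))
  ... | no _ = nothing

  open Algebra.Solver.Ring ℤ.+-*-rawRing (fromCommutativeRing R) morphism coefficient-≟ public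
    using (Polynomial; solve; _:=_; con; _:+_; _:*_; _:-_; :-_)

  :0 :1 : ∀ {n} → Polynomial n
  :0 = con (ℤ.+ 0)
  :1 = con (ℤ.+ 1)

-- Powers and polynomials over a commutative ring.

module RingLemmas {c ℓ : Level} (R : CommutativeRing c ℓ) where
  open CommutativeRing R
  open FieldDefs R
  open IntegerSolver R
  open Algebra.Properties.CommutativeSemiring.Exp commutativeSemiring using (_^_; ^-congˡ; ^-homo-*; ^-assocʳ; ^-distrib-*)
  open Algebra.Properties.Ring ring using (x∙y⁻¹≈ε⇒x≈y)

  x-y≈0⇒x≈y : ∀ {x y} → x + - y ≈ 0# → x ≈ y
  x-y≈0⇒x≈y = x∙y⁻¹≈ε⇒x≈y _ _

  x≈y⇒x-y≈0 : ∀ {x y} → x ≈ y → x + - y ≈ 0#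
  x≈y⇒x-y≈0 {x} {y} x≈y = trans (+-congʳ x≈y) (-‿inverseʳ y)

  -- A certificate of ideal membership: once x - y is an explicit combination of differences l - r
  -- of known equations, a single identity checked by the solver replaces a chain of rewriting. The
  -- cofactors are supplied at each use.
  combine₁ : ∀ {x y l r} a → l ≈ r → x + - y ≈ a * (l + - r) → x ≈ y
  combine₁ a l≈r e = x-y≈0⇒x≈y (trans e (trans (*-congˡ (x≈y⇒x-y≈0 l≈r)) (zeroʳ a)))

  combine₂ : ∀ {x y l r l′ r′} a b → l ≈ r → l′ ≈ r′ →
             x + - y ≈ a * (l + - r) + b * (l′ + - r′) → x ≈ y
  combine₂ a b p p′ e = x-y≈0⇒x≈y (trans e (trans (+-cong
    (trans (*-congˡ (x≈y⇒x-y≈0 p)) (zeroʳ a)) (trans (*-congˡ (x≈y⇒x-y≈0 p′)) (zeroʳ b))) (+-identityʳ 0#)))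

  combine₃ : ∀ {x y l r l′ r′ l″ r″} a b c → l ≈ r → l′ ≈ r′ → l″ ≈ r″ →
             x + - y ≈ a * (l + - r) + (b * (l′ + - r′) + c * (l″ + - r″)) → x ≈ y
  combine₃ a b c p p′ p″ e = x-y≈0⇒x≈y (trans e (trans (+-cong
    (trans (*-congˡ (x≈y⇒x-y≈0 p)) (zeroʳ a)) (trans (+-cong (trans (*-congˡ (x≈y⇒x-y≈0 p′)) (zeroʳ b))
      (trans (*-congˡ (x≈y⇒x-y≈0 p″)) (zeroʳ c))) (+-identityʳ 0#))) (+-identityʳ 0#)))

  pow≡^ : ∀ x n → pow x n ≡ x ^ n
  pow≡^ x zero = ≡.refl
  pow≡^ x (suc n) = ≡.cong (x *_) (pow≡^ x n)

  pow-cong : ∀ {x y} n → x ≈ y → pow x n ≈ pow y n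
  pow-cong {x} {y} n e rewrite pow≡^ x n | pow≡^ y n = ^-congˡ n e

  pow-+ : ∀ x m n → pow x (m ℕ.+ n) ≈ pow x m * pow x n
  pow-+ x m n rewrite pow≡^ x (m ℕ.+ n) | pow≡^ x m | pow≡^ x n = ^-homo-* x m n

  pow-pow : ∀ x m n → pow (pow x m) n ≈ pow x (m ℕ.* n)
  pow-pow x m n rewrite pow≡^ (pow x m) n | pow≡^ x m | pow≡^ x (m ℕ.* n) = ^-assocʳ x m n

  pow-distrib-* : ∀ x y n → pow (x * y) n ≈ pow x n * pow y n
  pow-distrib-* x y n rewrite pow≡^ (x * y) n | pow≡^ x n | pow≡^ y n = ^-distrib-* x y n

  pow-comm : ∀ x m n → pow (pow x m) n ≈ pow (pow x n) m
  pow-comm x m n = trans (pow-pow x m n) (trans (reflexive (≡.cong (pow x) (ℕₚ.*-comm m n))) (sym (pow-pow x n m)))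

  pow-one : ∀ n → pow 1# n ≈ 1#
  pow-one zero = refl
  pow-one (suc n) = trans (*-identityˡ _) (pow-one n)

  pow-inverse : ∀ {x y} n → x * y ≈ 1# → pow x n * pow y n ≈ 1#
  pow-inverse {x} {y} n e = trans (sym (pow-distrib-* x y n)) (trans (pow-cong n e) (pow-one n))

  eval-cong : ∀ {p r} x → p ≋ r → eval p x ≈ eval r x
  eval-cong x [] = refl
  eval-cong x (e ∷ es) = +-cong e (*-congˡ (eval-cong x es))

  eval-scale : ∀ a p x → eval (scale a p) x ≈ a * eval p x
  eval-scale a [] x = sym (zeroʳ a)
  eval-scale a (b ∷ p) x = trans (+-congˡ (*-congˡ (eval-scale a p x))) (solve 4 (λ a b x e →
    a :* b :+ x :* (a :* e)
      := a :* (b :+ x :* e)) refl a b x (eval p x))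

  eval-addP : ∀ p r x → eval (addP p r) x ≈ eval p x + eval r x
  eval-addP [] r x = sym (+-identityˡ _)
  eval-addP (a ∷ p) [] x = sym (+-identityʳ _)
  eval-addP (a ∷ p) (b ∷ r) x = trans (+-congˡ (*-congˡ (eval-addP p r x))) (solve 5 (λ a b x e f →
    a :+ b :+ x :* (e :+ f)
      := (a :+ x :* e) :+ (b :+ x :* f)) refl a b x (eval p x) (eval r x))

  eval-mulP : ∀ p r x → eval (mulP p r) x ≈ eval p x * eval r x
  eval-mulP [] r x = sym (zeroˡ _)
  eval-mulP (a ∷ p) r x = trans (eval-addP (scale a r) (0# ∷ mulP p r) x)
    (trans (+-cong (eval-scale a r x) (+-congˡ (*-congˡ (eval-mulP p r x)))) (solve 4 (λ a x e f →
      a :* f :+ (:0 :+ x :* (e :* f))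
        := (a :+ x :* e) :* f) refl a x (eval p x) (eval r x)))

  eval-powP : ∀ p n x → eval (powP p n) x ≈ pow (eval p x) n
  eval-powP p zero x = trans (+-congˡ (zeroʳ x)) (+-identityʳ 1#)
  eval-powP p (suc n) x = trans (eval-mulP p (powP p n) x) (*-congˡ (eval-powP p n x))

  eval-zero : ∀ {p} x → All (_≈ 0#) p → eval p x ≈ 0#
  eval-zero x [] = refl
  eval-zero x (e ∷ es) = trans (+-cong e (trans (*-congˡ (eval-zero x es)) (zeroʳ x))) (+-identityʳ 0#)

  -- Synthetic division: the coefficients of (p(x) - p(r)) / (x - r) are the partial Horner values
  -- of p at r.
  quotient : Carrier → Poly → Poly
  quotient r [] = []
  quotient r (a ∷ []) = []
  quotient r (a ∷ b ∷ p) = eval (b ∷ p) r ∷ quotient r (b ∷ p)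

  length-quotient : ∀ r a p → length (quotient r (a ∷ p)) ≡ length p
  length-quotient r a [] = ≡.refl
  length-quotient r a (b ∷ p) = ≡.cong suc (length-quotient r b p)

  eval-quotient : ∀ r p x → eval p x + - eval p r ≈ (x + - r) * eval (quotient r p) x
  eval-quotient r [] x = trans (-‿inverseʳ 0#) (sym (zeroʳ _))
  eval-quotient r (a ∷ []) x = solve 3 (λ a x r → (a :+ x :* :0) :- (a :+ r :* :0) := (x :- r) :* :0) refl a x r
  eval-quotient r (a ∷ b ∷ p) x =
    combine₁ x (eval-quotient r (b ∷ p) x) (lemma (eval (b ∷ p) x) (eval (b ∷ p) r) (eval (quotient r (b ∷ p)) x))
    where
    lemma : ∀ e f u → ((a + x * e) + - (a + r * f)) + - ((x + - r) * (f + x * u)) ≈ x * ((e + - f) + - ((x + - r) * u))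
    lemma e f u = solve 6 (λ a x r e f u →
      ((a :+ x :* e) :- (a :+ r :* f)) :- ((x :- r) :* (f :+ x :* u))
        := x :* ((e :- f) :- ((x :- r) :* u))) refl a x r e f u

  quotient-zero : ∀ r p → eval p r ≈ 0# → All (_≈ 0#) (quotient r p) → All (_≈ 0#) p
  quotient-zero r [] e zs = []
  quotient-zero r (a ∷ []) e zs = trans (sym (trans (+-congˡ (zeroʳ r)) (+-identityʳ a))) e ∷ []
  quotient-zero r (a ∷ b ∷ p) e (z ∷ zs) =
    trans (sym (trans (+-congˡ (trans (*-congˡ z) (zeroʳ r))) (+-identityʳ a))) e
      ∷ quotient-zero r (b ∷ p) z zs

  ≋-refl : ∀ {p} → p ≋ p
  ≋-refl = Pointwise.refl refl

  ≋-sym : ∀ {p r} → p ≋ r → r ≋ p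
  ≋-sym = Pointwise.symmetric sym

  ≋-trans : ∀ {p r s} → p ≋ r → r ≋ s → p ≋ s
  ≋-trans = Pointwise.transitive trans

  Monic-resp-≋ : ∀ {p r} → p ≋ r → Monic p → Monic r
  Monic-resp-≋ (e ∷ []) m = trans (sym e) m
  Monic-resp-≋ (_ ∷ e ∷ es) m = Monic-resp-≋ (e ∷ es) m

-- Cancellation and the number of roots in a field.

module FieldLemmas {c ℓ : Level} (R : CommutativeRing c ℓ) (isField : FieldDefs.IsField R) where
  open CommutativeRing R
  open FieldDefs R
  open IntegerSolver R
  open RingLemmas R

  1≉0 : ¬ 1# ≈ 0#
  1≉0 = proj₁ isField

  inverse : ∀ x → ¬ x ≈ 0# → ∃[ y ] x * y ≈ 1#
  inverse = proj₂ isField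

  zero-factor : ∀ {x y} → ¬ x ≈ 0# → x * y ≈ 0# → y ≈ 0#
  zero-factor {x} {y} x≉0 xy≈0 with inverse x x≉0
  ... | u , xu≈1 = combine₂ u (- y) xy≈0 xu≈1
        (solve 3 (λ x y u → y :- :0 := u :* (x :* y :- :0) :+ (:- y) :* (x :* u :- :1)) refl x y u)

  *-cancelˡ : ∀ {x y z} → ¬ x ≈ 0# → x * y ≈ x * z → y ≈ z
  *-cancelˡ {x} {y} {z} x≉0 e = x-y≈0⇒x≈y (zero-factor x≉0
    (combine₁ 1# e (solve 3 (λ x y z → x :* (y :- z) :- :0 := :1 :* (x :* y :- x :* z)) refl x y z)))

  *-nonzero : ∀ {x y} → ¬ x ≈ 0# → ¬ y ≈ 0# → ¬ x * y ≈ 0#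
  *-nonzero x≉0 y≉0 xy≈0 = y≉0 (zero-factor x≉0 xy≈0)

  pow-nonzero : ∀ {x} n → ¬ x ≈ 0# → ¬ pow x n ≈ 0#
  pow-nonzero zero x≉0 = 1≉0
  pow-nonzero (suc n) x≉0 = *-nonzero x≉0 (pow-nonzero n x≉0)

  unit⇒nonzero : ∀ {x y} → x * y ≈ 1# → ¬ x ≈ 0#
  unit⇒nonzero xy≈1 x≈0 = 1≉0 (trans (sym xy≈1) (trans (*-congʳ x≈0) (zeroˡ _)))

  pow-cancel : ∀ {x} m n → ¬ x ≈ 0# → pow x (m ℕ.+ n) ≈ pow x m → pow x n ≈ 1#
  pow-cancel {x} m n x≉0 e = *-cancelˡ (pow-nonzero m x≉0)
    (trans (sym (pow-+ x m n)) (trans e (sym (*-identityʳ _))))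

  -- Dividing out the root `r` shortens the list by one, and the other roots survive since x - r is
  -- nonzero there. Counting coefficients instead of degrees makes it unnecessary to locate the
  -- leading nonzero coefficient.
  zero-poly : ∀ p rs → AllPairs (λ x y → ¬ x ≈ y) rs → All (λ r → eval p r ≈ 0#) rs →
              length p ≤ length rs → All (_≈ 0#) p
  zero-poly [] rs _ _ _ = []
  zero-poly (a ∷ p) (r ∷ rs) (r≉rs ∷ distinct) (pr≈0 ∷ roots) (s≤s len) =
    quotient-zero r (a ∷ p) pr≈0 (zero-poly (quotient r (a ∷ p)) rs distinct
      (All.zipWith root′ (r≉rs , roots)) (≡.subst (_≤ length rs) (≡.sym (length-quotient r a p)) len))
    where
    root′ : ∀ {x} → ¬ r ≈ x × eval (a ∷ p) x ≈ 0# → eval (quotient r (a ∷ p)) x ≈ 0#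
    root′ {x} (r≉x , px≈0) = zero-factor (r≉x ∘ sym ∘ x-y≈0⇒x≈y)
      (trans (sym (eval-quotient r (a ∷ p) x)) (x≈y⇒x-y≈0 (trans px≈0 (sym pr≈0))))

  monic-nonzero : ∀ p → Monic p → ¬ All (_≈ 0#) p
  monic-nonzero (a ∷ []) m (z ∷ []) = 1≉0 (trans (sym m) z)
  monic-nonzero (a ∷ b ∷ p) m (_ ∷ zs) = monic-nonzero (b ∷ p) m zs

-- Finite fields: decidable equality, the characteristic, Fermat's theorem.

module FiniteField {c ℓ : Level} (R : CommutativeRing c ℓ)
  (isField : FieldDefs.IsField R) {N : ℕ} (card : FieldDefs.HasCard R N) where
  open CommutativeRing R
  open FieldDefs R
  open IntegerSolver R
  open RingLemmas R
  open FieldLemmas R isField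
  open Relation.Binary.Reasoning.Setoid setoid
  module Π = Algebra.Properties.CommutativeMonoid.Sum *-commutativeMonoid
  module Σ⁺ = Algebra.Properties.CommutativeMonoid.Sum +-commutativeMonoid
  open Algebra.Properties.Semiring.Mult semiring using () renaming (_×_ to _·_)

  element : Fin N → Carrier
  element = proj₁ card

  element-injective : ∀ i j → element i ≈ element j → i ≡ j
  element-injective = proj₁ (proj₂ card)

  index : Carrier → Fin N
  index x = proj₁ (proj₂ (proj₂ card) x)

  element-index : ∀ x → element (index x) ≈ x
  element-index x = proj₂ (proj₂ (proj₂ card) x)

  infix 4 _≟_
  _≟_ : ∀ x y → Dec (x ≈ y)
  x ≟ y = map′ (λ i≡j → trans (sym (element-index x)) (trans (reflexive (≡.cong element i≡j)) (element-index y)))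
               (λ x≈y → element-injective _ _ (trans (element-index x) (trans x≈y (sym (element-index y)))))
               (index x Finₚ.≟ index y)

  *-zero-product : ∀ {x y} → x * y ≈ 0# → x ≈ 0# ⊎ y ≈ 0#
  *-zero-product {x} xy≈0 with x ≟ 0#
  ... | yes x≈0 = inj₁ x≈0
  ... | no x≉0 = inj₂ (zero-factor x≉0 xy≈0)

  square-equal : ∀ {x y} → x * x ≈ y * y → x ≈ y ⊎ x ≈ - y
  square-equal {x} {y} e with *-zero-product {x + - y} {x + y}
    (combine₁ 1# e (solve 2 (λ x y → (x :- y) :* (x :+ y) :- :0 := :1 :* (x :* x :- y :* y)) refl x y))
  ... | inj₁ z = inj₁ (x-y≈0⇒x≈y z)
  ... | inj₂ z = inj₂ (combine₁ 1# z (solve 2 (λ x y → x :- (:- y) := :1 :* ((x :+ y) :- :0)) refl x y))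

  conjugation : (f g : Carrier → Carrier) → (∀ {x y} → x ≈ y → f x ≈ f y) → (∀ {x y} → x ≈ y → g x ≈ g y) →
                (∀ x → f (g x) ≈ x) → (∀ x → g (f x) ≈ x) → Permutation′ N
  conjugation f g f-cong g-cong fg gf = permutation
    (λ i → index (f (element i))) (λ i → index (g (element i)))
    (λ i → element-injective _ _ (trans (element-index _) (trans (f-cong (element-index _)) (fg _))))
    (λ i → element-injective _ _ (trans (element-index _) (trans (g-cong (element-index _)) (gf _))))

  -- Translation by 1 permutes the elements and so preserves their sum, yet it adds N · 1 to it.
  N·1≈0 : N · 1# ≈ 0#
  N·1≈0 = sym (cancel (begin
    Σ⁺.sum element + 0# ≈⟨ +-identityʳ _ ⟩
    Σ⁺.sum element ≈⟨ Σ⁺.sum-permute element shift ⟩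
    Σ⁺.sum (λ i → element (shift ⟨$⟩ʳ i)) ≈⟨ Σ⁺.sum-cong-≋ (λ i → element-index (element i + 1#)) ⟩
    Σ⁺.sum (λ i → element i + 1#) ≈⟨ Σ⁺.∑-distrib-+ element (λ _ → 1#) ⟩
    Σ⁺.sum element + Σ⁺.sum {N} (λ _ → 1#) ≈⟨ +-congˡ (Σ⁺.sum-replicate N) ⟩
    Σ⁺.sum element + N · 1# ∎))
    where
    shift : Permutation′ N
    shift = conjugation (_+ 1#) (_+ - 1#) +-congʳ +-congʳ
      (λ x → (solve 1 (λ x → (x :- :1) :+ :1 := x) refl x)) (λ x → (solve 1 (λ x → (x :+ :1) :- :1 := x) refl x))
    cancel : ∀ {s x y} → s + x ≈ s + y → x ≈ y
    cancel {s} {x} {y} e = combine₁ 1# e (solve 3 (λ s x y → x :- y := :1 :* ((s :+ x) :- (s :+ y))) refl s x y)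

  -- Replacing 0 by 1, the product of all elements becomes a unit; multiplying every element by a ≉ 0
  -- permutes the factors.
  unital : Carrier → Carrier
  unital x with x ≟ 0#
  ... | yes _ = 1#
  ... | no _ = x

  unital-nonzero : ∀ x → ¬ unital x ≈ 0#
  unital-nonzero x with x ≟ 0#
  ... | yes _ = 1≉0
  ... | no x≉0 = x≉0

  unital-cong : ∀ {x y} → x ≈ y → unital x ≈ unital y
  unital-cong {x} {y} e with x ≟ 0# | y ≟ 0#
  ... | yes _ | yes _ = refl
  ... | yes x≈0 | no y≉0 = contradiction (trans (sym e) x≈0) y≉0
  ... | no x≉0 | yes y≈0 = contradiction (trans e y≈0) x≉0
  ... | no _ | no _ = e

  -- Two complementary pieces of the constant `a`: multiplication by `a` changes `unital` by the
  -- factor `atNonzero`, and `atZero` supplies the single factor that this misses. Their products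
  -- over all elements give x^N = 1 · x without the exponent N - 1.
  atNonzero atZero : Carrier → Carrier → Carrier
  atNonzero a x with x ≟ 0#
  ... | yes _ = 1#
  ... | no _ = a
  atZero a x with x ≟ 0#
  ... | yes _ = a
  ... | no _ = 1#

  unital-* : ∀ {a} x → ¬ a ≈ 0# → unital (a * x) ≈ atNonzero a x * unital x
  unital-* {a} x a≉0 with x ≟ 0# | a * x ≟ 0#
  ... | yes _ | yes _ = sym (*-identityˡ 1#)
  ... | yes x≈0 | no ax≉0 = contradiction (trans (*-congˡ x≈0) (zeroʳ a)) ax≉0
  ... | no x≉0 | yes ax≈0 = contradiction ax≈0 (*-nonzero a≉0 x≉0)
  ... | no _ | no _ = refl

  atNonzero*atZero : ∀ a x → atNonzero a x * atZero a x ≈ a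
  atNonzero*atZero a x with x ≟ 0#
  ... | yes _ = *-identityˡ a
  ... | no _ = *-identityʳ a

  prod-nonzero : ∀ {n} (t : Fin n → Carrier) → (∀ i → ¬ t i ≈ 0#) → ¬ Π.sum t ≈ 0#
  prod-nonzero {zero} t h = 1≉0
  prod-nonzero {suc n} t h = *-nonzero (h Fin.zero) (prod-nonzero (t ∘ Fin.suc) (h ∘ Fin.suc))

  prod-ones : ∀ {n} (t : Fin n → Carrier) → (∀ i → t i ≈ 1#) → Π.sum t ≈ 1#
  prod-ones {zero} t h = refl
  prod-ones {suc n} t h = trans (*-cong (h Fin.zero) (prod-ones (t ∘ Fin.suc) (h ∘ Fin.suc))) (*-identityˡ 1#)

  prod-single : ∀ {n} (t : Fin n → Carrier) i → (∀ j → j ≢ i → t j ≈ 1#) → Π.sum t ≈ t i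
  prod-single {suc n} t i h = trans (Π.sum-remove {i = i} t)
    (trans (*-congˡ (prod-ones (removeAt t i) (λ j → h _ (Finₚ.punchInᵢ≢i i j)))) (*-identityʳ _))

  prod-replicate : ∀ n x → Π.sum {n} (λ _ → x) ≈ pow x n
  prod-replicate zero x = refl
  prod-replicate (suc n) x = *-congˡ (prod-replicate n x)

  prod-atNonzero : ∀ {a} → ¬ a ≈ 0# → Π.sum (λ i → atNonzero a (element i)) ≈ 1#
  prod-atNonzero {a} a≉0 with inverse a a≉0
  ... | b , ab≈1 = *-cancelˡ (prod-nonzero (unital ∘ element) (unital-nonzero ∘ element)) (begin
    P * Π.sum (λ i → atNonzero a (element i)) ≈⟨ *-comm _ _ ⟩
    Π.sum (λ i → atNonzero a (element i)) * P ≈⟨ Π.∑-distrib-+ (λ i → atNonzero a (element i)) (unital ∘ element) ⟨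
    Π.sum (λ i → atNonzero a (element i) * unital (element i)) ≈⟨ Π.sum-cong-≋ (λ i → unital-* (element i) a≉0) ⟨
    Π.sum (λ i → unital (a * element i)) ≈⟨ Π.sum-cong-≋ (λ i → unital-cong (element-index (a * element i))) ⟨
    Π.sum (λ i → unital (element (mul ⟨$⟩ʳ i))) ≈⟨ Π.sum-permute (unital ∘ element) mul ⟨
    P ≈⟨ *-identityʳ P ⟨
    P * 1# ∎)
    where
    P = Π.sum (unital ∘ element)
    mul : Permutation′ N
    mul = conjugation (a *_) (b *_) *-congˡ *-congˡ
      (λ x → combine₁ x ab≈1 (solve 3 (λ a b x → a :* (b :* x) :- x := x :* (a :* b :- :1)) refl a b x))
      (λ x → combine₁ x ab≈1 (solve 3 (λ a b x → b :* (a :* x) :- x := x :* (a :* b :- :1)) refl a b x))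

  prod-atZero : ∀ a → Π.sum (λ i → atZero a (element i)) ≈ a
  prod-atZero a = trans (prod-single _ (index 0#) other) here
    where
    other : ∀ j → j ≢ index 0# → atZero a (element j) ≈ 1#
    other j j≢ with element j ≟ 0#
    ... | yes e = contradiction (element-injective _ _ (trans e (sym (element-index 0#)))) j≢
    ... | no _ = refl
    here : atZero a (element (index 0#)) ≈ a
    here with element (index 0#) ≟ 0#
    ... | yes _ = refl
    ... | no ne = contradiction (element-index 0#) ne

  fermat : ∀ x → pow x N ≈ x
  fermat x with x ≟ 0#
  ... | no x≉0 = begin
    pow x N ≈⟨ prod-replicate N x ⟨
    Π.sum {N} (λ _ → x) ≈⟨ Π.sum-cong-≋ (λ i → atNonzero*atZero x (element i)) ⟨
    Π.sum (λ i → atNonzero x (element i) * atZero x (element i))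
      ≈⟨ Π.∑-distrib-+ (λ i → atNonzero x (element i)) (λ i → atZero x (element i)) ⟩
    Π.sum (λ i → atNonzero x (element i)) * Π.sum (λ i → atZero x (element i))
      ≈⟨ *-cong (prod-atNonzero x≉0) (prod-atZero x) ⟩
    1# * x ≈⟨ *-identityˡ x ⟩
    x ∎
  -- `index 0#` shows that N is positive; the power x^0 would be 1.
  ... | yes x≈0 = zero-case N (index 0#)
    where
    zero-case : ∀ n → Fin n → pow x n ≈ x
    zero-case (suc n) _ = trans (*-congʳ x≈0) (trans (zeroˡ _) (sym x≈0))

-- The quartic extension of a field and its cardinality.

Enumeration : ∀ {a ℓ} → Setoid a ℓ → ℕ → Set (a ⊔ ℓ)
Enumeration S n = Σ (Fin n → Carrier) λ e → (∀ i j → e i ≈ e j → i ≡ j) × (∀ x → ∃[ i ] e i ≈ x)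
  where open Setoid S

×-enumeration : ∀ {a a′ ℓ ℓ′} (S : Setoid a ℓ) (T : Setoid a′ ℓ′) {m n} →
                Enumeration S m → Enumeration T n → Enumeration (×-setoid S T) (m ℕ.* n)
×-enumeration S T {m} {n} (e , e-inj , e-surj) (f , f-inj , f-surj) = pair ∘ Fin.remQuot {m} n , injective , surjective
  where
  module S×T = Setoid (×-setoid S T)
  pair : Fin m × Fin n → S×T.Carrier
  pair (i , j) = e i , f j
  injective : ∀ i j → pair (Fin.remQuot {m} n i) S×T.≈ pair (Fin.remQuot {m} n j) → i ≡ j
  injective i j (p , p′) = ≡.trans (≡.sym (Finₚ.combine-remQuot {m} n i))
    (≡.trans (≡.cong₂ Fin.combine (e-inj _ _ p) (f-inj _ _ p′)) (Finₚ.combine-remQuot {m} n j))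
  surjective : ∀ x → ∃[ i ] pair (Fin.remQuot {m} n i) S×T.≈ x
  surjective (x , y) with e-surj x | f-surj y
  ... | i , p | j , p′ = Fin.combine i j ,
    S×T.trans (S×T.reflexive (≡.cong pair (Finₚ.remQuot-combine i j))) (p , p′)

-- K is k[x]/(x⁴ + a₃ x³ + a₂ x² + a₁ x + a₀) in the basis 1, x, x², x³; shift is multiplication by x.
module QuarticExtension {c ℓ : Level} (k : CommutativeRing c ℓ)
  (a₀ a₁ a₂ a₃ : CommutativeRing.Carrier k) where
  open CommutativeRing k
  open IntegerSolver k

  private
    A² = abelianGroup +-abelianGroup +-abelianGroup
    A³ = abelianGroup +-abelianGroup A²

  V-group : AbelianGroup c ℓ
  V-group = abelianGroup +-abelianGroup A³

  module V = AbelianGroup V-group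
  open V using () renaming (Carrier to V; _≈_ to _≃_; _∙_ to _⊕_; ∙-cong to ⊕-cong)
  open Relation.Binary.Reasoning.Setoid V.setoid

  infixr 7.5 _•_
  _•_ : Carrier → V → V
  s • (v₀ , v₁ , v₂ , v₃) = s * v₀ , s * v₁ , s * v₂ , s * v₃

  shift : V → V
  shift (v₀ , v₁ , v₂ , v₃) = - (a₀ * v₃) , v₀ + - (a₁ * v₃) , v₁ + - (a₂ * v₃) , v₂ + - (a₃ * v₃)

  infixl 7.2 _⊛_
  -- Horner's scheme u₀ v + x (u₁ v + x (u₂ v + x (u₃ v))). Each `shift` reduces at once, so no
  -- degree above three ever appears.
  _⊛_ : V → V → V
  (u₀ , u₁ , u₂ , u₃) ⊛ v = u₀ • v ⊕ shift (u₁ • v ⊕ shift (u₂ • v ⊕ shift (u₃ • v)))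

  1V : V
  1V = 1# , 0# , 0# , 0#

  X : V
  X = 0# , 1# , 0# , 0#

  •-cong : ∀ {s t v w} → s ≈ t → v ≃ w → s • v ≃ t • w
  •-cong e (e₀ , e₁ , e₂ , e₃) = *-cong e e₀ , *-cong e e₁ , *-cong e e₂ , *-cong e e₃

  shift-cong : ∀ {v w} → v ≃ w → shift v ≃ shift w
  shift-cong (e₀ , e₁ , e₂ , e₃) =
    -‿cong (*-congˡ e₃) , +-cong e₀ (-‿cong (*-congˡ e₃)) ,
    +-cong e₁ (-‿cong (*-congˡ e₃)) , +-cong e₂ (-‿cong (*-congˡ e₃))

  ⊛-cong : ∀ {u u′ v v′} → u ≃ u′ → v ≃ v′ → u ⊛ v ≃ u′ ⊛ v′
  ⊛-cong (e₀ , e₁ , e₂ , e₃) e = ⊕-cong (•-cong e₀ e) (shift-cong (⊕-cong (•-cong e₁ e)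
    (shift-cong (⊕-cong (•-cong e₂ e) (shift-cong (•-cong e₃ e))))))

  •-distrib-⊕ : ∀ s v w → s • (v ⊕ w) ≃ s • v ⊕ s • w
  •-distrib-⊕ s _ _ = distribˡ s _ _ , distribˡ s _ _ , distribˡ s _ _ , distribˡ s _ _

  •-comm : ∀ s t v → s • t • v ≃ t • s • v
  •-comm s t (v₀ , v₁ , v₂ , v₃) = lemma v₀ , lemma v₁ , lemma v₂ , lemma v₃
    where lemma : ∀ v → s * (t * v) ≈ t * (s * v)
          lemma v = solve 3 (λ s t v → s :* (t :* v) := t :* (s :* v)) refl s t v

  shift-⊕ : ∀ v w → shift (v ⊕ w) ≃ shift v ⊕ shift w
  shift-⊕ (v₀ , v₁ , v₂ , v₃) (w₀ , w₁ , w₂ , w₃) =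
    (solve 3 (λ a₀ v₃ w₃ → :- (a₀ :* (v₃ :+ w₃)) := :- (a₀ :* v₃) :- a₀ :* w₃) refl a₀ v₃ w₃) , lemma a₁ v₀ w₀ , lemma a₂ v₁ w₁ , lemma a₃ v₂ w₂
    where lemma : ∀ a v w → (v + w) + - (a * (v₃ + w₃)) ≈ (v + - (a * v₃)) + (w + - (a * w₃))
          lemma a v w = solve 5 (λ a v w v₃ w₃ →
            (v :+ w) :+ (:- (a :* (v₃ :+ w₃)))
              := (v :- a :* v₃) :+ (w :- a :* w₃)) refl a v w v₃ w₃

  shift-• : ∀ s v → shift (s • v) ≃ s • shift v
  shift-• s (v₀ , v₁ , v₂ , v₃) =
    (solve 3 (λ a₀ s v₃ → :- (a₀ :* (s :* v₃)) := s :* (:- (a₀ :* v₃))) refl a₀ s v₃) , lemma a₁ v₀ , lemma a₂ v₁ , lemma a₃ v₂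
    where lemma : ∀ a v → s * v + - (a * (s * v₃)) ≈ s * (v + - (a * v₃))
          lemma a v = solve 4 (λ a s v v₃ → s :* v :+ (:- (a :* (s :* v₃))) := s :* (v :- a :* v₃)) refl a s v v₃

  -- Horner's rule: a linear map commuting with multiplication by x commutes with
  -- multiplication by any polynomial.
  commute : (L : V → V) → (∀ v w → L (v ⊕ w) ≃ L v ⊕ L w) →
            (∀ s v → L (s • v) ≃ s • L v) → (∀ v → L (shift v) ≃ shift (L v)) →
            ∀ u v → L (u ⊛ v) ≃ u ⊛ L v
  commute L L-⊕ L-• L-shift (u₀ , u₁ , u₂ , u₃) v =
    step u₀ (step u₁ (step u₂ (L-• u₃ v)))
    where
    step : ∀ s {w w′} → L w ≃ w′ → L (s • v ⊕ shift w) ≃ s • L v ⊕ shift w′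
    step s {w} {w′} e = begin
      L (s • v ⊕ shift w) ≈⟨ L-⊕ _ _ ⟩
      L (s • v) ⊕ L (shift w) ≈⟨ ⊕-cong (L-• s v) (V.trans (L-shift w) (shift-cong e)) ⟩
      s • L v ⊕ shift w′ ∎

  ⊛-shift : ∀ u v → u ⊛ shift v ≃ shift (u ⊛ v)
  ⊛-shift u v = V.sym (commute shift shift-⊕ shift-• (λ _ → V.refl) u v)

  ⊛-• : ∀ u s v → u ⊛ (s • v) ≃ s • (u ⊛ v)
  ⊛-• u s v = V.sym (commute (s •_) (•-distrib-⊕ s) (•-comm s) (V.sym ∘ shift-• s) u v)

  ⊛-distribˡ : ∀ u v w → u ⊛ (v ⊕ w) ≃ u ⊛ v ⊕ u ⊛ w
  ⊛-distribˡ (u₀ , u₁ , u₂ , u₃) v w = step u₀ (step u₁ (step u₂ (•-distrib-⊕ u₃ v w)))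
    where
    step : ∀ s {x y z} → x ≃ y ⊕ z → s • (v ⊕ w) ⊕ shift x ≃ (s • v ⊕ shift y) ⊕ (s • w ⊕ shift z)
    step s {x} {y} {z} e = begin
      s • (v ⊕ w) ⊕ shift x ≈⟨ ⊕-cong (•-distrib-⊕ s v w) (V.trans (shift-cong e) (shift-⊕ y z)) ⟩
      (s • v ⊕ s • w) ⊕ (shift y ⊕ shift z) ≈⟨ interchange (s • v) (s • w) (shift y) (shift z) ⟩
      (s • v ⊕ shift y) ⊕ (s • w ⊕ shift z) ∎
      where open import Algebra.Properties.CommutativeSemigroup V.commutativeSemigroup using (interchange)

  -- Left multiplication by `u` is linear and commutes with `shift`, hence with every left
  -- multiplication. Together with the right unit this yields commutativity and then associativity,
  -- with no expansion of products in coordinates.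
  ⊛-exchange : ∀ u v w → u ⊛ (v ⊛ w) ≃ v ⊛ (u ⊛ w)
  ⊛-exchange u = commute (u ⊛_) (⊛-distribˡ u) (⊛-• u) (⊛-shift u)

  0V : V
  0V = V.ε

  0•≃0 : ∀ v → 0# • v ≃ 0V
  0•≃0 _ = zeroˡ _ , zeroˡ _ , zeroˡ _ , zeroˡ _

  1•≃ : ∀ v → 1# • v ≃ v
  1•≃ _ = *-identityˡ _ , *-identityˡ _ , *-identityˡ _ , *-identityˡ _

  shift-low : ∀ p q r → shift (p , q , r , 0#) ≃ (0# , p , q , r)
  shift-low p q r = (solve 1 (λ a₀ → :- (a₀ :* :0) := :0) refl a₀) , lemma a₁ p , lemma a₂ q , lemma a₃ r
    where lemma : ∀ a x → x + - (a * 0#) ≈ x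
          lemma a x = solve 2 (λ a x → x :- a :* :0 := x) refl a x

  ⊛-constant : ∀ s v → (s , 0# , 0# , 0#) ⊛ v ≃ s • v
  ⊛-constant s v = V.trans (V.∙-congˡ (zero-step (zero-step (V.trans (shift-cong (0•≃0 v)) (shift-low 0# 0# 0#)))))
                         (V.identityʳ _)
    where
    zero-step : ∀ {w} → w ≃ 0V → shift (0# • v ⊕ w) ≃ 0V
    zero-step e = V.trans (shift-cong (V.trans (⊕-cong (0•≃0 v) e) (V.identityʳ 0V))) (shift-low 0# 0# 0#)

  ⊛-suc : ∀ s p q r v → (s , p , q , r) ⊛ v ≃ s • v ⊕ shift ((p , q , r , 0#) ⊛ v)
  ⊛-suc s p q r v = V.∙-congˡ (shift-cong (V.∙-congˡ (shift-cong (V.∙-congˡ (shift-cong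
    (V.sym (V.trans (V.∙-congˡ (V.trans (shift-cong (0•≃0 v)) (shift-low 0# 0# 0#))) (V.identityʳ _))))))))

  ⊛-linear : ∀ s v → (s , 1# , 0# , 0#) ⊛ v ≃ s • v ⊕ shift v
  ⊛-linear s v = V.trans (⊛-suc s 1# 0# 0# v) (V.∙-congˡ (shift-cong (V.trans (⊛-constant 1# v) (1•≃ v))))

  ⊛-identityʳ : ∀ v → v ⊛ 1V ≃ v
  ⊛-identityʳ (v₀ , v₁ , v₂ , v₃) = step v₀ (step v₁ (step v₂ (•-top v₃)))
    where
    •-top : ∀ s → s • 1V ≃ (s , 0# , 0# , 0#)
    •-top s = *-identityʳ s , zeroʳ s , zeroʳ s , zeroʳ s
    step : ∀ s {w p q r} → w ≃ (p , q , r , 0#) → s • 1V ⊕ shift w ≃ (s , p , q , r)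
    step s {w} {p} {q} {r} e = V.trans (⊕-cong (•-top s) (V.trans (shift-cong e) (shift-low p q r)))
      (+-identityʳ s , +-identityˡ p , +-identityˡ q , +-identityˡ r)

  ⊛-comm : ∀ u v → u ⊛ v ≃ v ⊛ u
  ⊛-comm u v = begin
    u ⊛ v ≈⟨ ⊛-cong (V.refl {u}) (⊛-identityʳ v) ⟨
    u ⊛ (v ⊛ 1V) ≈⟨ ⊛-exchange u v 1V ⟩
    v ⊛ (u ⊛ 1V) ≈⟨ ⊛-cong (V.refl {v}) (⊛-identityʳ u) ⟩
    v ⊛ u ∎

  ⊛-assoc : ∀ u v w → (u ⊛ v) ⊛ w ≃ u ⊛ (v ⊛ w)
  ⊛-assoc u v w = begin
    (u ⊛ v) ⊛ w ≈⟨ ⊛-comm (u ⊛ v) w ⟩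
    w ⊛ (u ⊛ v) ≈⟨ ⊛-exchange w u v ⟩
    u ⊛ (w ⊛ v) ≈⟨ ⊛-cong (V.refl {u}) (⊛-comm w v) ⟩
    u ⊛ (v ⊛ w) ∎

  ⊛-distribʳ : ∀ u v w → (v ⊕ w) ⊛ u ≃ v ⊛ u ⊕ w ⊛ u
  ⊛-distribʳ u v w = V.trans (⊛-comm (v ⊕ w) u) (V.trans (⊛-distribˡ u v w) (⊕-cong (⊛-comm u v) (⊛-comm u w)))

  K : CommutativeRing c ℓ
  K = record
    { Carrier = V ; _≈_ = _≃_ ; _+_ = _⊕_ ; _*_ = _⊛_ ; -_ = V._⁻¹ ; 0# = V.ε ; 1# = 1V
    ; isCommutativeRing = record
      { isRing = record
        { +-isAbelianGroup = V.isAbelianGroup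
        ; *-cong = ⊛-cong
        ; *-assoc = ⊛-assoc
        ; *-identity = (λ v → V.trans (⊛-comm 1V v) (⊛-identityʳ v)) , ⊛-identityʳ
        ; distrib = ⊛-distribˡ , ⊛-distribʳ
        }
      ; *-comm = ⊛-comm
      }
    }

  X⊛ : ∀ v → X ⊛ v ≃ shift v
  X⊛ v = V.trans (⊛-linear 0# v) (V.trans (V.∙-congʳ (0•≃0 v)) (V.identityˡ _))

  X³ : X ⊛ (X ⊛ (X ⊛ 1V)) ≃ (0# , 0# , 0# , 1#)
  X³ = V.trans (X⊛ (X ⊛ (X ⊛ 1V))) (V.trans (shift-cong X²) (shift-low 0# 0# 1#))
    where
    X² : X ⊛ (X ⊛ 1V) ≃ (0# , 0# , 1# , 0#)
    X² = V.trans (X⊛ (X ⊛ 1V)) (V.trans (shift-cong (⊛-identityʳ X)) (shift-low 0# 1# 0#))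

  -- The right-hand sides are the coefficients of the product minus those of the defining polynomial.
  linear-times-cubic : ∀ b g₀ g₁ g₂ → (b , 1# , 0# , 0#) ⊛ (g₀ , g₁ , g₂ , 1#) ≃
    (b * g₀ + - a₀ , (b * g₁ + g₀) + - a₁ , (b * g₂ + g₁) + - a₂ , (b + g₂) + - a₃)
  linear-times-cubic b g₀ g₁ g₂ = V.trans (⊛-linear b (g₀ , g₁ , g₂ , 1#))
    ( (solve 3 (λ b g₀ a₀ → b :* g₀ :- a₀ :* :1 := b :* g₀ :- a₀) refl b g₀ a₀)
    , (solve 4 (λ b g₁ g₀ a₁ → b :* g₁ :+ (g₀ :- a₁ :* :1) := (b :* g₁ :+ g₀) :- a₁) refl b g₁ g₀ a₁)
    , (solve 4 (λ b g₂ g₁ a₂ → b :* g₂ :+ (g₁ :- a₂ :* :1) := (b :* g₂ :+ g₁) :- a₂) refl b g₂ g₁ a₂)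
    , (solve 3 (λ b g₂ a₃ → b :* :1 :+ (g₂ :- a₃ :* :1) := (b :+ g₂) :- a₃) refl b g₂ a₃) )

  quadratic-times-quadratic : ∀ b₀ b₁ g₀ g₁ → (b₀ , b₁ , 1# , 0#) ⊛ (g₀ , g₁ , 1# , 0#) ≃
    (b₀ * g₀ + - a₀ , (b₀ * g₁ + b₁ * g₀) + - a₁ , ((b₀ + b₁ * g₁) + g₀) + - a₂ , (b₁ + g₁) + - a₃)
  quadratic-times-quadratic b₀ b₁ g₀ g₁ = V.trans (⊛-suc b₀ b₁ 1# 0# (g₀ , g₁ , 1# , 0#))
    (V.trans (V.∙-congˡ (V.trans (shift-cong (V.trans (⊛-linear b₁ (g₀ , g₁ , 1# , 0#)) (V.∙-congˡ (shift-low g₀ g₁ 1#))))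
      V.refl))
    ( (solve 4 (λ a₀ b₀ b₁ g₀ → b₀ :* g₀ :+ (:- (a₀ :* (b₁ :* :0 :+ :1))) := b₀ :* g₀ :- a₀) refl a₀ b₀ b₁ g₀)
    , (solve 5 (λ a₁ b₀ b₁ g₁ g₀ →
      b₀ :* g₁ :+ ((b₁ :* g₀ :+ :0) :+ (:- (a₁ :* (b₁ :* :0 :+ :1))))
        := (b₀ :* g₁ :+ b₁ :* g₀) :- a₁) refl a₁ b₀ b₁ g₁ g₀)
    , (solve 5 (λ a₂ b₀ b₁ g₁ g₀ →
      b₀ :* :1 :+ ((b₁ :* g₁ :+ g₀) :+ (:- (a₂ :* (b₁ :* :0 :+ :1))))
        := ((b₀ :+ b₁ :* g₁) :+ g₀) :- a₂) refl a₂ b₀ b₁ g₁ g₀)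
    , (solve 4 (λ a₃ b₀ b₁ g₁ →
      b₀ :* :0 :+ ((b₁ :* :1 :+ g₁) :+ (:- (a₃ :* (b₁ :* :0 :+ :1))))
        := (b₁ :+ g₁) :- a₃) refl a₃ b₀ b₁ g₁) ))

  -- The coefficients of (x + b)(x³ + g₂ x² + g₁ x + g₀) compared with those of the defining
  -- polynomial. Monic factors suffice, because elements are divided by their leading coefficient
  -- before being inverted.
  Factors₁₃ : Set (c ⊔ ℓ)
  Factors₁₃ = ∃[ b ] ∃[ g₀ ] ∃[ g₁ ] ∃[ g₂ ]
    (b * g₀ ≈ a₀ × b * g₁ + g₀ ≈ a₁ × b * g₂ + g₁ ≈ a₂ × b + g₂ ≈ a₃)

  Factors₂₂ : Set (c ⊔ ℓ)
  Factors₂₂ = ∃[ b₀ ] ∃[ b₁ ] ∃[ g₀ ] ∃[ g₁ ]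
    (b₀ * g₀ ≈ a₀ × b₀ * g₁ + b₁ * g₀ ≈ a₁ × (b₀ + b₁ * g₁) + g₀ ≈ a₂ × b₁ + g₁ ≈ a₃)

  module Irreducible (isField : FieldDefs.IsField k) (_≟_ : ∀ x y → Dec (x ≈ y))
    (¬factors₁₃ : ¬ Factors₁₃) (¬factors₂₂ : ¬ Factors₂₂) where
    open RingLemmas k
    open FieldLemmas k isField

    Invertible : V → Set (c ⊔ ℓ)
    Invertible v = ∃[ w ] v ⊛ w ≃ 1V

    invertible-resp : ∀ {v w} → v ≃ w → Invertible w → Invertible v
    invertible-resp e (u , eq) = u , V.trans (⊛-cong e V.refl) eq

    invertible-factor : ∀ v g → Invertible (v ⊛ g) → Invertible v
    invertible-factor v g (w , e) = g ⊛ w , V.trans (V.sym (⊛-assoc v g w)) e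

    invertible-multiple : ∀ v g {r} → v ⊛ g ≃ r → Invertible r → Invertible v
    invertible-multiple v g e = invertible-factor v g ∘ invertible-resp e

    invertible-scaled : ∀ {s} v (r : Carrier → V) → ¬ s ≈ 0# → (∀ i → s * i ≈ 1# → i • v ≃ r i) → (∀ i → Invertible (r i)) → Invertible v
    invertible-scaled {s} v r s≉0 e inv with inverse s s≉0
    ... | i , si≈1 = invertible-multiple v (i , 0# , 0# , 0#)
      (V.trans (⊛-comm v _) (V.trans (⊛-constant i v) (e i si≈1))) (inv i)

    private
      one : ∀ {s i} → s * i ≈ 1# → i * s ≈ 1#
      one {s} {i} e = trans (*-comm i s) e

    invertible₀ : ∀ v₀ → ¬ v₀ ≈ 0# → Invertible (v₀ , 0# , 0# , 0#)
    invertible₀ v₀ v₀≉0 = invertible-scaled _ (λ i → 1V) v₀≉0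
      (λ i e → one e , zeroʳ i , zeroʳ i , zeroʳ i) (λ i → 1V , ⊛-identityʳ 1V)

    -- Dividing the defining polynomial by a monic v leaves a remainder of smaller degree, which is a
    -- multiple of v in K and is nonzero by irreducibility.
    invertible₁ : ∀ v₀ v₁ → ¬ (v₀ ≈ 0# × v₁ ≈ 0#) → Invertible (v₀ , v₁ , 0# , 0#)
    invertible₁ v₀ v₁ nz with v₁ ≟ 0#
    ... | yes v₁≈0 = invertible-resp (refl , v₁≈0 , refl , refl) (invertible₀ v₀ (λ v₀≈0 → nz (v₀≈0 , v₁≈0)))
    ... | no v₁≉0 = invertible-scaled _ (λ i → i * v₀ , 1# , 0# , 0#) v₁≉0
      (λ i e → refl , one e , zeroʳ i , zeroʳ i) (λ i → monic (i * v₀))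
      where
      monic : ∀ b → Invertible (b , 1# , 0# , 0#)
      monic b = invertible-multiple _ (g₀ , g₁ , g₂ , 1#)
        (V.trans (linear-times-cubic b g₀ g₁ g₂)
          (refl , (solve 3 (λ b g₁ a₁ → (b :* g₁ :+ (a₁ :- b :* g₁)) :- a₁ := :0) refl b g₁ a₁) , (solve 3 (λ b g₂ a₂ →
            (b :* g₂ :+ (a₂ :- b :* g₂)) :- a₂
              := :0) refl b g₂ a₂) , (solve 2 (λ b a₃ → (b :+ (a₃ :- b)) :- a₃ := :0) refl b a₃)))
        (invertible₀ _ (λ r≈0 → ¬factors₁₃ (b , g₀ , g₁ , g₂ , x-y≈0⇒x≈y r≈0 ,
          (solve 3 (λ b g₁ a₁ → b :* g₁ :+ (a₁ :- b :* g₁) := a₁) refl b g₁ a₁) , (solve 3 (λ b g₂ a₂ →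
            b :* g₂ :+ (a₂ :- b :* g₂)
              := a₂) refl b g₂ a₂) , (solve 2 (λ b a₃ → b :+ (a₃ :- b) := a₃) refl b a₃))))
        where g₂ = a₃ + - b
              g₁ = a₂ + - (b * g₂)
              g₀ = a₁ + - (b * g₁)

    invertible₂ : ∀ v₀ v₁ v₂ → ¬ (v₀ ≈ 0# × v₁ ≈ 0# × v₂ ≈ 0#) → Invertible (v₀ , v₁ , v₂ , 0#)
    invertible₂ v₀ v₁ v₂ nz with v₂ ≟ 0#
    ... | yes v₂≈0 = invertible-resp (refl , refl , v₂≈0 , refl)
      (invertible₁ v₀ v₁ (λ (v₀≈0 , v₁≈0) → nz (v₀≈0 , v₁≈0 , v₂≈0)))
    ... | no v₂≉0 = invertible-scaled _ (λ i → i * v₀ , i * v₁ , 1# , 0#) v₂≉0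
      (λ i e → refl , refl , one e , zeroʳ i) (λ i → monic (i * v₀) (i * v₁))
      where
      monic : ∀ b₀ b₁ → Invertible (b₀ , b₁ , 1# , 0#)
      monic b₀ b₁ = invertible-multiple _ (g₀ , g₁ , 1# , 0#)
        (V.trans (quadratic-times-quadratic b₀ b₁ g₀ g₁)
          (refl , refl , x≈y⇒x-y≈0 e₂ , x≈y⇒x-y≈0 e₃))
        (invertible₁ _ _ (λ (r₀≈0 , r₁≈0) → ¬factors₂₂ (b₀ , b₁ , g₀ , g₁ ,
          x-y≈0⇒x≈y r₀≈0 , x-y≈0⇒x≈y r₁≈0 , e₂ , e₃)))
        where g₁ = a₃ + - b₁
              g₀ = a₂ + - (b₀ + b₁ * g₁)
              e₂ : (b₀ + b₁ * g₁) + g₀ ≈ a₂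
              e₂ = solve 4 (λ b₀ b₁ g₁ a₂ → (b₀ :+ b₁ :* g₁) :+ (a₂ :- (b₀ :+ b₁ :* g₁)) := a₂) refl b₀ b₁ g₁ a₂
              e₃ : b₁ + g₁ ≈ a₃
              e₃ = solve 2 (λ b₁ a₃ → b₁ :+ (a₃ :- b₁) := a₃) refl b₁ a₃

    invertible₃ : ∀ v₀ v₁ v₂ v₃ → ¬ (v₀ ≈ 0# × v₁ ≈ 0# × v₂ ≈ 0# × v₃ ≈ 0#) → Invertible (v₀ , v₁ , v₂ , v₃)
    invertible₃ v₀ v₁ v₂ v₃ nz with v₃ ≟ 0#
    ... | yes v₃≈0 = invertible-resp (refl , refl , refl , v₃≈0)
      (invertible₂ v₀ v₁ v₂ (λ (v₀≈0 , v₁≈0 , v₂≈0) → nz (v₀≈0 , v₁≈0 , v₂≈0 , v₃≈0)))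
    ... | no v₃≉0 = invertible-scaled _ (λ i → i * v₀ , i * v₁ , i * v₂ , 1#) v₃≉0
      (λ i e → refl , refl , refl , one e) (λ i → monic (i * v₀) (i * v₁) (i * v₂))
      where
      monic : ∀ b₀ b₁ b₂ → Invertible (b₀ , b₁ , b₂ , 1#)
      monic b₀ b₁ b₂ = invertible-multiple _ (g , 1# , 0# , 0#)
        (V.trans (⊛-comm _ (g , 1# , 0# , 0#)) (V.trans (linear-times-cubic g b₀ b₁ b₂)
          (refl , refl , refl , x≈y⇒x-y≈0 e₃)))
        (invertible₂ _ _ _ (λ (r₀≈0 , r₁≈0 , r₂≈0) → ¬factors₁₃ (g , b₀ , b₁ , b₂ ,
          x-y≈0⇒x≈y r₀≈0 , x-y≈0⇒x≈y r₁≈0 , x-y≈0⇒x≈y r₂≈0 , e₃)))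
        where g = a₃ + - b₂
              e₃ : g + b₂ ≈ a₃
              e₃ = solve 2 (λ b₂ a₃ → (a₃ :- b₂) :+ b₂ := a₃) refl b₂ a₃

    K-isField : FieldDefs.IsField K
    K-isField = (λ (e , _) → 1≉0 e) , (λ (v₀ , v₁ , v₂ , v₃) → invertible₃ v₀ v₁ v₂ v₃)

  K-card : ∀ {n} → FieldDefs.HasCard k n → FieldDefs.HasCard K (n ℕ.^ 4)
  K-card {n} card = ≡.subst (FieldDefs.HasCard K)
    (≡.cong (λ m → n ℕ.* (n ℕ.* (n ℕ.* m))) (≡.sym (ℕₚ.*-identityʳ n)))
    (×-enumeration setoid (×-setoid setoid (×-setoid setoid setoid)) card (×-enumeration setoid (×-setoid setoid setoid) card (×-enumeration setoid setoid card card)))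

-- Binomial coefficients modulo a prime, and parity.

prime∤factorial : ∀ {p} → Prime p → ∀ k → k < p → ¬ p ∣ k !
prime∤factorial p-prime zero k<p p∣1 = ¬prime[1] (≡.subst Prime (∣1⇒≡1 p∣1) p-prime)
prime∤factorial p-prime (suc k) k<p p∣k! with euclidsLemma (suc k) (k !) p-prime p∣k!
... | inj₁ p∣1+k = ℕₚ.<⇒≱ k<p (∣⇒≤ p∣1+k)
... | inj₂ p∣k!′ = prime∤factorial p-prime k (ℕₚ.<-trans (ℕₚ.n<1+n k) k<p) p∣k!′

-- p divides p! = C(p,k) k! (p - k)! but neither of the two factorials, whose factors are all below
-- p.
prime∣binomial : ∀ {p} → Prime p → ∀ k → 0 < k → k < p → p ∣ (p C k)
prime∣binomial {zero} p-prime = contradiction p-prime ¬prime[0]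
prime∣binomial {p@(suc p′)} p-prime k 0<k k<p with euclidsLemma (p C k) (k ! ℕ.* (p ∸ k) !) p-prime p∣product
  where
  instance _ = k ℕₚ.!* (p ∸ k) !≢0
  product : (p C k) ℕ.* (k ! ℕ.* (p ∸ k) !) ≡ p !
  product = ≡.trans (≡.cong (ℕ._* (k ! ℕ.* (p ∸ k) !)) (nCk≡n!/k![n-k]! (ℕₚ.<⇒≤ k<p)))
                  (m/n*n≡m (k![n∸k]!∣n! (ℕₚ.<⇒≤ k<p)))
  p∣product : p ∣ (p C k) ℕ.* (k ! ℕ.* (p ∸ k) !)
  p∣product = ≡.subst (p ∣_) (≡.sym product) (∣m⇒∣m*n (p′ !) ∣-refl)
... | inj₁ p∣C = p∣C
... | inj₂ p∣d with euclidsLemma (k !) ((p ∸ k) !) p-prime p∣d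
...   | inj₁ p∣k! = contradiction p∣k! (prime∤factorial p-prime k k<p)
...   | inj₂ p∣r! = contradiction p∣r! (prime∤factorial p-prime (p ∸ k) (ℕₚ.∸-monoʳ-< 0<k (ℕₚ.<⇒≤ k<p)))

even-or-odd : ∀ n → (∃[ k ] n ≡ 2 ℕ.* k) ⊎ OddNat n
even-or-odd zero = inj₁ (0 , ≡.refl)
even-or-odd (suc n) with even-or-odd n
... | inj₁ (k , e) = inj₂ (k , ≡.trans (≡.cong suc e) (ℕₚ.+-comm 1 _))
... | inj₂ (k , e) = inj₁ (suc k , ≡.trans (≡.cong suc e) (≡.trans (≡.cong suc (ℕₚ.+-comm _ 1)) (≡.sym (ℕₚ.*-suc 2 k))))

odd-prime : ∀ {p} → Prime p → p ≢ 2 → OddNat p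
odd-prime {p} p-prime p≢2 with even-or-odd p
... | inj₂ odd = odd
... | inj₁ (k , e) with prime⇒irreducible p-prime (divides {2} k (≡.trans e (ℕₚ.*-comm 2 k)))
...   | inj₂ 2≡p = contradiction (≡.sym 2≡p) p≢2

odd-* : ∀ {m n} → OddNat m → OddNat n → OddNat (m ℕ.* n)
odd-* {n = n} (k , ≡.refl) (j , ≡.refl) = k ℕ.* n ℕ.+ j ,
  (Nat.solve 2 (λ k j →
    (Nat.con 2 Nat.:* k Nat.:+ Nat.con 1) Nat.:* (Nat.con 2 Nat.:* j Nat.:+ Nat.con 1)
      Nat.:= Nat.con 2 Nat.:* (k Nat.:* (Nat.con 2 Nat.:* j Nat.:+ Nat.con 1) Nat.:+ j) Nat.:+ Nat.con 1) ≡.refl k j)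

odd-^ : ∀ {m} → OddNat m → ∀ n → OddNat (m ℕ.^ n)
odd-^ odd zero = 0 , ≡.refl
odd-^ odd (suc n) = odd-* odd (odd-^ odd n)

-- Roots of unity as powers of γ.

module RootsOfUnity {c ℓ : Level} (R : CommutativeRing c ℓ) (isField : FieldDefs.IsField R)
  (_≟_ : ∀ x y → Dec (CommutativeRing._≈_ R x y))
  (γ : CommutativeRing.Carrier R) (n : ℕ) (order : FieldDefs.HasOrder R γ n) where
  open CommutativeRing R
  open FieldDefs R
  open IntegerSolver R
  open RingLemmas R
  open FieldLemmas R isField
  open Relation.Binary.Reasoning.Setoid setoid

  private
    0<n = proj₁ order
    γⁿ≈1 = proj₁ (proj₂ order)
    instance n≢0 = ℕ.>-nonZero 0<n

  γ-nonzero : ¬ γ ≈ 0#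
  γ-nonzero = go n 0<n γⁿ≈1
    where
    go : ∀ m → 0 < m → pow γ m ≈ 1# → ¬ γ ≈ 0#
    go (suc m) _ e = unit⇒nonzero e

  pow-γ-reduce : ∀ k m → pow γ (k ℕ.* n ℕ.+ m) ≈ pow γ m
  pow-γ-reduce k m = begin
    pow γ (k ℕ.* n ℕ.+ m) ≈⟨ pow-+ γ (k ℕ.* n) m ⟩
    pow γ (k ℕ.* n) * pow γ m ≡⟨ ≡.cong (λ j → pow γ j * pow γ m) (ℕₚ.*-comm k n) ⟩
    pow γ (n ℕ.* k) * pow γ m ≈⟨ *-congʳ (trans (sym (pow-pow γ n k)) (trans (pow-cong k γⁿ≈1) (pow-one k))) ⟩
    1# * pow γ m ≈⟨ *-identityˡ _ ⟩
    pow γ m ∎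

  small-exponent : ∀ m → m < n → pow γ m ≈ 1# → m ≡ 0
  small-exponent zero _ _ = ≡.refl
  small-exponent (suc m) m<n e = contradiction e (proj₂ (proj₂ order) (suc m) (s≤s z≤n) m<n)

  order-divides : ∀ m → pow γ m ≈ 1# → n ∣ m
  order-divides m e = divides (m / n) (≡.trans (m≡m%n+[m/n]*n m n) (≡.cong (ℕ._+ m / n ℕ.* n)
    (small-exponent (m % n) (m%n<n m n) (begin
      pow γ (m % n) ≈⟨ pow-γ-reduce (m / n) (m % n) ⟨
      pow γ (m / n ℕ.* n ℕ.+ m % n) ≡⟨ ≡.cong (pow γ) (≡.trans (m≡m%n+[m/n]*n m n) (ℕₚ.+-comm (m % n) _)) ⟨
      pow γ m ≈⟨ e ⟩
      1# ∎))))

  pow-γ-injective-≤ : ∀ {i j} → i ≤ j → j < n → pow γ i ≈ pow γ j → i ≡ j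
  pow-γ-injective-≤ {i} {j} i≤j j<n e =
    ≡.trans (≡.sym (ℕₚ.+-identityʳ i)) (≡.trans (≡.cong (i ℕ.+_) (≡.sym j∸i≡0)) (ℕₚ.m+[n∸m]≡n i≤j))
    where
    j∸i≡0 : j ∸ i ≡ 0
    j∸i≡0 = small-exponent (j ∸ i) (ℕₚ.≤-<-trans (ℕₚ.m∸n≤m j i) j<n) (pow-cancel i (j ∸ i) γ-nonzero
      (trans (reflexive (≡.cong (pow γ) (ℕₚ.m+[n∸m]≡n i≤j))) (sym e)))

  pow-γ-injective : ∀ {i j} → i < n → j < n → pow γ i ≈ pow γ j → i ≡ j
  pow-γ-injective {i} {j} i<n j<n e with ℕₚ.≤-total i j
  ... | inj₁ i≤j = pow-γ-injective-≤ i≤j j<n e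
  ... | inj₂ j≤i = ≡.sym (pow-γ-injective-≤ j≤i i<n (sym e))

  monomial : ℕ → Poly
  monomial m = replicate m 0# ++ 1# ∷ []

  eval-monomial : ∀ m x → eval (monomial m) x ≈ pow x m
  eval-monomial zero x = trans (+-congˡ (zeroʳ x)) (+-identityʳ 1#)
  eval-monomial (suc m) x = trans (+-identityˡ _) (*-congˡ (eval-monomial m x))

  length-monomial : ∀ m → length (monomial m) ≡ suc m
  length-monomial zero = ≡.refl
  length-monomial (suc m) = ≡.cong suc (length-monomial m)

  -- Otherwise `x` and the n powers of γ would be n + 1 distinct roots of x^n - 1.
  root-of-unity : ∀ x → pow x n ≈ 1# → ∃[ i ] (i < n × x ≈ pow γ i)
  root-of-unity x xⁿ≈1 with Finₚ.any? {n = n} (λ i → x ≟ pow γ (Fin.toℕ i))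
  ... | yes (i , e) = Fin.toℕ i , Finₚ.toℕ<n i , e
  ... | no none = contradiction x xⁿ-1-overdetermined
    where
    powers = tabulate {n = n} (pow γ ∘ Fin.toℕ)
    distinct : AllPairs (λ y z → ¬ y ≈ z) (x ∷ powers)
    distinct = Allₚ.tabulate⁺ (λ i e → none (i , e)) ∷ AllPairsₚ.tabulate⁺
      (λ i≢j e → i≢j (Finₚ.toℕ-injective (pow-γ-injective (Finₚ.toℕ<n _) (Finₚ.toℕ<n _) e)))
    -- The exponent is split so that -1 can stand as the constant coefficient; `monomial m` then
    -- provides the other n = suc m coefficients.
    xⁿ-1 : ∀ m → m ≡ n → ∃[ f ] (length f ≡ suc n × ¬ All (_≈ 0#) f × (∀ y → pow y n ≈ 1# → eval f y ≈ 0#))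
    xⁿ-1 zero m≡n = contradiction (≡.sym m≡n) (ℕₚ.>⇒≢ 0<n)
    xⁿ-1 (suc m) ≡.refl = - 1# ∷ monomial m , ≡.cong suc (length-monomial m) ,
      (λ { (z ∷ _) → 1≉0 (combine₁ (- 1#) z ((solve 0 (:1 :- :0 := :- :1 :* (:- :1 :- :0)) refl))) }) ,
      (λ y e → trans (+-congˡ (trans (*-congˡ (eval-monomial m y)) e)) (-‿inverseˡ 1#))
    xⁿ-1-overdetermined : ¬ Carrier
    xⁿ-1-overdetermined _ with xⁿ-1 n ≡.refl
    ... | f , len , nonzero , roots = nonzero (zero-poly f (x ∷ powers) distinct
      (roots x xⁿ≈1 ∷ Allₚ.tabulate⁺ (λ i → roots _ (trans (pow-comm γ (Fin.toℕ i) n)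
        (trans (pow-cong (Fin.toℕ i) γⁿ≈1) (pow-one (Fin.toℕ i))))))
      (ℕₚ.≤-reflexive (≡.trans len (≡.cong suc (≡.sym (Listₚ.length-tabulate (pow γ ∘ Fin.toℕ)))))))

-- Additivity of p-power maps in characteristic p.

module PrimeCharacteristic {c ℓ : Level} (R : CommutativeRing c ℓ) {p : ℕ} (p-prime : Prime p)
  (p·1≈0 : CommutativeRing._≈_ R
     (Algebra.Properties.Semiring.Mult._×_ (CommutativeRing.semiring R) p (CommutativeRing.1# R)) (CommutativeRing.0# R)) where
  open CommutativeRing R
  open FieldDefs R
  open RingLemmas R
  open Algebra.Properties.Semiring.Mult semiring using (×-assoc-*; ×-assocˡ; ×-congʳ; ×-homo-1) renaming (_×_ to _·_)
  open Algebra.Properties.Monoid.Sum +-monoid using (sum; sum-init-last; sum-cong-≋; sum-replicate-zero)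
  open Algebra.Properties.CommutativeSemiring.Binomial commutativeSemiring using (theorem; binomialTerm)
  open Relation.Binary.Reasoning.Setoid setoid

  multiple-vanishes : ∀ {n} x → p ∣ n → n · x ≈ 0#
  multiple-vanishes x (divides m ≡.refl) = begin
    (m ℕ.* p) · x ≈⟨ ×-assocˡ x m p ⟨
    m · (p · x) ≈⟨ ×-congʳ m (×-congʳ p (*-identityˡ x)) ⟨
    m · (p · (1# * x)) ≈⟨ ×-congʳ m (×-assoc-* p 1# x) ⟨
    m · (p · 1# * x) ≈⟨ ×-congʳ m (trans (*-congʳ p·1≈0) (zeroˡ x)) ⟩
    m · 0# ≈⟨ ×-congʳ m (zeroˡ 1#) ⟨
    m · (0# * 1#) ≈⟨ ×-assoc-* m 0# 1# ⟨
    m · 0# * 1# ≈⟨ trans (*-congʳ (zeros m)) (zeroˡ 1#) ⟩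
    0# ∎
    where
    zeros : ∀ m → m · 0# ≈ 0#
    zeros zero = refl
    zeros (suc m) = trans (+-identityˡ _) (zeros m)

  sum-ends : ∀ {n} (t : Fin (suc (suc n)) → Carrier) →
             (∀ i → t (Fin.suc (Fin.inject₁ i)) ≈ 0#) → sum t ≈ t Fin.zero + t (Fin.fromℕ (suc n))
  sum-ends {n} t h = +-congˡ (trans (sum-init-last (t ∘ Fin.suc))
    (trans (+-congʳ (trans (sum-cong-≋ h) (sum-replicate-zero n))) (+-identityˡ _)))

  -- All inner binomial coefficients are multiples of p and vanish. The separate exponent `m` can be
  -- split into the form 2 + n, which makes the two ends of the sum distinct.
  pow-prime-+ : ∀ m → p ≡ m → ∀ x y → pow (x + y) m ≈ pow x m + pow y m
  pow-prime-+ zero p≡ x y = contradiction (≡.subst Prime p≡ p-prime) ¬prime[0]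
  pow-prime-+ (suc zero) p≡ x y = contradiction (≡.subst Prime p≡ p-prime) ¬prime[1]
  pow-prime-+ m@(suc (suc n)) p≡ x y = begin
    pow (x + y) m ≡⟨ pow≡^ (x + y) m ⟩
    _ ≈⟨ theorem m x y ⟩
    sum (binomialTerm x y m) ≈⟨ sum-ends (binomialTerm x y m) (λ i → multiple-vanishes _ (divisible i)) ⟩
    binomialTerm x y m Fin.zero + binomialTerm x y m (Fin.fromℕ m)
      ≈⟨ +-cong (trans (×-homo-1 _) (trans (*-identityˡ _) (reflexive (≡.sym (pow≡^ y m))))) top ⟩
    pow y m + pow x m ≈⟨ +-comm _ _ ⟩
    pow x m + pow y m ∎
    where
    divisible : ∀ i → p ∣ (m C Fin.toℕ (Fin.suc (Fin.inject₁ i)))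
    divisible i = ≡.subst (λ r → p ∣ (r C k)) p≡ (prime∣binomial p-prime k (s≤s z≤n)
      (≡.subst (k <_) (≡.sym p≡) (s≤s (≡.subst (_< suc n) (≡.sym (Finₚ.toℕ-inject₁ i)) (Finₚ.toℕ<n i)))))
      where k = Fin.toℕ (Fin.suc (Fin.inject₁ i))
    top : binomialTerm x y m (Fin.fromℕ m) ≈ pow x m
    top rewrite Finₚ.toℕ-fromℕ n | nCn≡1 m | ℕₚ.n∸n≡0 n =
      trans (×-homo-1 _) (trans (*-identityʳ _) (reflexive (≡.sym (pow≡^ x m))))

  pow-+-distrib : ∀ n x y → pow (x + y) (p ℕ.^ n) ≈ pow x (p ℕ.^ n) + pow y (p ℕ.^ n)
  pow-+-distrib zero x y = trans (*-identityʳ _) (sym (+-cong (*-identityʳ x) (*-identityʳ y)))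
  pow-+-distrib (suc n) x y = begin
    pow (x + y) (p ℕ.* p ℕ.^ n) ≈⟨ pow-pow (x + y) p (p ℕ.^ n) ⟨
    pow (pow (x + y) p) (p ℕ.^ n) ≈⟨ pow-cong (p ℕ.^ n) (pow-prime-+ p ≡.refl x y) ⟩
    pow (pow x p + pow y p) (p ℕ.^ n) ≈⟨ pow-+-distrib n (pow x p) (pow y p) ⟩
    pow (pow x p) (p ℕ.^ n) + pow (pow y p) (p ℕ.^ n) ≈⟨ +-cong (pow-pow x p (p ℕ.^ n)) (pow-pow y p (p ℕ.^ n)) ⟩
    pow x (p ℕ.* p ℕ.^ n) + pow y (p ℕ.* p ℕ.^ n) ∎

module CharacteristicOfFinite {c ℓ : Level} (R : CommutativeRing c ℓ) (isField : FieldDefs.IsField R)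
  {p m : ℕ} (card : FieldDefs.HasCard R (p ℕ.^ m)) where
  open CommutativeRing R
  open FieldDefs R
  open RingLemmas R
  open FieldLemmas R isField
  open FiniteField R isField card using (_≟_; N·1≈0)
  open Algebra.Properties.Semiring.Mult semiring using (×1-homo-*; ×-homo-+; ×-congˡ) renaming (_×_ to _·_)

  power·1 : ∀ n → (p ℕ.^ n) · 1# ≈ pow (p · 1#) n
  power·1 zero = +-identityʳ 1#
  power·1 (suc n) = trans (×1-homo-* p (p ℕ.^ n)) (*-congˡ (power·1 n))

  -- The number of elements gives (p · 1)^m = p^m · 1 = 0, and a field has no nilpotents.
  p·1≈0 : p · 1# ≈ 0#
  p·1≈0 with p · 1# ≟ 0#
  ... | yes e = e
  ... | no ne = contradiction (trans (sym (power·1 m)) N·1≈0) (pow-nonzero m ne)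

  -- If 2 were 0, the multiple p · 1 with p odd would be 1 rather than 0.
  odd⇒2≉0 : OddNat p → ¬ 1# + 1# ≈ 0#
  odd⇒2≉0 (k , p≡) 2≈0 = 1≉0 (trans (sym (trans (×-congˡ p≡) odd·1)) p·1≈0)
    where
    odd·1 : (2 ℕ.* k ℕ.+ 1) · 1# ≈ 1#
    odd·1 = trans (×-homo-+ 1# (2 ℕ.* k) 1) (trans (+-cong (trans (×1-homo-* 2 k)
      (trans (*-congʳ (trans (+-congˡ (+-identityʳ 1#)) 2≈0)) (zeroˡ _))) (+-identityʳ 1#)) (+-identityˡ 1#))

-- The Frobenius map, its fixed field F_q, and minimal polynomials of degree four.

module Frobenius {c ℓ : Level} (R : CommutativeRing c ℓ) (q : ℕ) (q-odd : OddPrimePower q)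
  (isField : FieldDefs.IsField R) (card : FieldDefs.HasCard R (q ℕ.^ 4)) where
  open CommutativeRing R
  open FieldDefs R
  open IntegerSolver R
  open RingLemmas R
  open FieldLemmas R isField
  open FiniteField R isField card using (_≟_; fermat; *-zero-product)
  open Relation.Binary.Reasoning.Setoid setoid

  private
    p = proj₁ q-odd
    e = suc (proj₁ (proj₂ q-odd))
    p-prime = proj₁ (proj₂ (proj₂ q-odd))
    p≢2 = proj₁ (proj₂ (proj₂ (proj₂ q-odd)))
    q≡pᵉ : q ≡ p ℕ.^ e
    q≡pᵉ = proj₂ (proj₂ (proj₂ (proj₂ q-odd)))
    module Char = CharacteristicOfFinite R isField {p} {e ℕ.* 4} (≡.subst HasCard
      (≡.trans (≡.cong (ℕ._^ 4) q≡pᵉ) (ℕₚ.^-*-assoc p e 4)) card)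
    open PrimeCharacteristic R p-prime Char.p·1≈0 using (pow-+-distrib)

  abstract
    OddNat-q : OddNat q
    OddNat-q = ≡.subst OddNat (≡.sym q≡pᵉ) (odd-^ (odd-prime p-prime p≢2) e)

  2≉0 : ¬ 1# + 1# ≈ 0#
  2≉0 = Char.odd⇒2≉0 (odd-prime p-prime p≢2)

  x+x≈0⇒x≈0 : ∀ {x} → x + x ≈ 0# → x ≈ 0#
  x+x≈0⇒x≈0 {x} e = zero-factor 2≉0 (trans (solve 1 (λ x → (:1 :+ :1) :* x := x :+ x) refl x) e)

  φ : Carrier → Carrier
  φ x = pow x q

  φ-cong : ∀ {x y} → x ≈ y → φ x ≈ φ y
  φ-cong = pow-cong q

  φ-+ : ∀ x y → φ (x + y) ≈ φ x + φ y
  φ-+ x y = ≡.subst (λ n → pow (x + y) n ≈ pow x n + pow y n) (≡.sym q≡pᵉ) (pow-+-distrib e x y)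

  φ-* : ∀ x y → φ (x * y) ≈ φ x * φ y
  φ-* x y = pow-distrib-* x y q

  φ-1 : φ 1# ≈ 1#
  φ-1 = pow-one q

  φ-0 : φ 0# ≈ 0#
  φ-0 = combine₁ 1# (trans (sym (φ-+ 0# 0#)) (φ-cong (+-identityʳ 0#)))
    (solve 1 (λ x → x :- :0 := :1 :* ((x :+ x) :- x)) refl (φ 0#))

  φ-neg : ∀ x → φ (- x) ≈ - φ x
  φ-neg x = combine₁ 1# (trans (sym (φ-+ (- x) x)) (trans (φ-cong (-‿inverseˡ x)) φ-0))
    (solve 2 (λ a b → a :- (:- b) := :1 :* ((a :+ b) :- :0)) refl (φ (- x)) (φ x))

  φ⁴ : ∀ x → φ (φ (φ (φ x))) ≈ x
  φ⁴ x = begin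
    φ (φ (φ (φ x))) ≈⟨ φ-cong (φ-cong (pow-pow x q q)) ⟩
    φ (φ (pow x (q ℕ.* q))) ≈⟨ φ-cong (pow-pow x (q ℕ.* q) q) ⟩
    φ (pow x (q ℕ.* q ℕ.* q)) ≈⟨ pow-pow x (q ℕ.* q ℕ.* q) q ⟩
    pow x (q ℕ.* q ℕ.* q ℕ.* q) ≡⟨ ≡.cong (pow x) fourth ⟩
    pow x (q ℕ.^ 4) ≈⟨ fermat x ⟩
    x ∎
    where
    fourth : q ℕ.* q ℕ.* q ℕ.* q ≡ q ℕ.^ 4
    fourth = ≡.trans (≡.trans (ℕₚ.*-assoc (q ℕ.* q) q q) (ℕₚ.*-assoc q q (q ℕ.* q)))
      (≡.cong (λ m → q ℕ.* (q ℕ.* (q ℕ.* m))) (≡.sym (ℕₚ.*-identityʳ q)))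

  φ-injective : ∀ {x y} → φ x ≈ φ y → x ≈ y
  φ-injective e = trans (sym (φ⁴ _)) (trans (φ-cong (φ-cong (φ-cong e))) (φ⁴ _))

  φ² : ∀ x → φ (φ x) ≈ pow x (q ℕ.* q)
  φ² x = pow-pow x q q

  In : Carrier → Set ℓ
  In = InF q

  In-resp : ∀ {x y} → x ≈ y → In x → In y
  In-resp e i = trans (φ-cong (sym e)) (trans i e)

  In-0 : In 0#
  In-0 = φ-0

  In-1 : In 1#
  In-1 = φ-1

  In-+ : ∀ {x y} → In x → In y → In (x + y)
  In-+ i j = trans (φ-+ _ _) (+-cong i j)

  In-* : ∀ {x y} → In x → In y → In (x * y)
  In-* i j = trans (φ-* _ _) (*-cong i j)

  In-neg : ∀ {x} → In x → In (- x)
  In-neg i = trans (φ-neg _) (-‿cong i)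

  φ-inverse : ∀ {x y} → x * y ≈ 1# → φ x * φ y ≈ 1#
  φ-inverse e = trans (sym (φ-* _ _)) (trans (φ-cong e) φ-1)

  inverse-unique : ∀ {x y z} → x * y ≈ 1# → x * z ≈ 1# → y ≈ z
  inverse-unique p r = *-cancelˡ (unit⇒nonzero p) (trans p (sym r))

  In-inverse : ∀ {x y} → In x → x * y ≈ 1# → In y
  In-inverse i e = inverse-unique (trans (*-congʳ (sym i)) (φ-inverse e)) e

  In-addP : ∀ {f g} → CoeffsIn q f → CoeffsIn q g → CoeffsIn q (addP f g)
  In-addP [] is = is
  In-addP (i ∷ is) [] = i ∷ is
  In-addP (i ∷ is) (j ∷ js) = In-+ i j ∷ In-addP is js

  In-scale : ∀ {a f} → In a → CoeffsIn q f → CoeffsIn q (scale a f)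
  In-scale i [] = []
  In-scale i (j ∷ js) = In-* i j ∷ In-scale i js

  In-mulP : ∀ {f g} → CoeffsIn q f → CoeffsIn q g → CoeffsIn q (mulP f g)
  In-mulP [] js = []
  In-mulP (i ∷ is) js = In-addP (In-scale i js) (In-0 ∷ In-mulP is js)

  In-powP : ∀ {f} n → CoeffsIn q f → CoeffsIn q (powP f n)
  In-powP zero is = In-1 ∷ []
  In-powP (suc n) is = In-mulP is (In-powP n is)

  CoeffsIn-resp : ∀ {f g} → f ≋ g → CoeffsIn q f → CoeffsIn q g
  CoeffsIn-resp [] [] = []
  CoeffsIn-resp (e ∷ es) (i ∷ is) = In-resp e i ∷ CoeffsIn-resp es is

  φ-eval : ∀ {f} x → CoeffsIn q f → φ (eval f x) ≈ eval f (φ x)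
  φ-eval x [] = φ-0
  φ-eval x (i ∷ is) = trans (φ-+ _ _) (+-cong i (trans (φ-* _ _) (*-congˡ (φ-eval x is))))

  φ-root : ∀ {f x} → CoeffsIn q f → eval f x ≈ 0# → eval f (φ x) ≈ 0#
  φ-root is e = trans (sym (φ-eval _ is)) (trans (φ-cong e) φ-0)

  -- The fields between F_q and F_(q⁴) form the chain F_q, F_(q²), F_(q⁴), so having degree four
  -- over F_q amounts to not being fixed by φ².
  Degree4 : Carrier → Set ℓ
  Degree4 s = ¬ φ (φ s) ≈ s

  degree4⇒∉F : ∀ {s} → Degree4 s → ¬ In s
  degree4⇒∉F d i = d (trans (φ-cong i) i)

  degree4-φ : ∀ {s} → Degree4 s → Degree4 (φ s)
  degree4-φ d e = d (φ-injective e)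

  degree4-nonzero : ∀ {s} → Degree4 s → ¬ s ≈ 0#
  degree4-nonzero d e = degree4⇒∉F d (In-resp (sym e) In-0)

  conjugates : Carrier → List Carrier
  conjugates s = s ∷ φ s ∷ φ (φ s) ∷ φ (φ (φ s)) ∷ []

  conjugates-distinct : ∀ {s} → Degree4 s → AllPairs (λ x y → ¬ x ≈ y) (conjugates s)
  conjugates-distinct {s} d =
    (s≉φs ∷ d ∘ sym ∷ s≉φ³s ∷ []) ∷ (s≉φs ∘ φ-injective ∷ d ∘ sym ∘ φ-injective ∷ []) ∷
    (s≉φs ∘ φ-injective ∘ φ-injective ∷ []) ∷ [] ∷ []
    where
    s≉φs : ¬ s ≈ φ s
    s≉φs e = degree4⇒∉F d (sym e)
    s≉φ³s : ¬ s ≈ φ (φ (φ s))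
    s≉φ³s e = s≉φs (sym (trans (φ-cong e) (φ⁴ s)))

  -- The four distinct conjugates of `s` are all roots of `g`. In other words, 1, s, s², s³ are
  -- linearly independent over F_q.
  zero-poly₄ : ∀ {s} g → Degree4 s → CoeffsIn q g → eval g s ≈ 0# → length g ≤ 4 → All (_≈ 0#) g
  zero-poly₄ {s} g d is e = zero-poly g (conjugates s) (conjugates-distinct d)
    (e ∷ φ-root is e ∷ φ-root is (φ-root is e) ∷ φ-root is (φ-root is (φ-root is e)) ∷ [])

  fromRoots : Carrier → Carrier → Carrier → Carrier → Poly
  fromRoots a b c d =
    a * b * c * d ∷ - (a * b * c + a * b * d + a * c * d + b * c * d) ∷
    a * b + a * c + a * d + b * c + b * d + c * d ∷ - (a + b + c + d) ∷ 1# ∷ []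

  eval-fromRoots : ∀ a b c d x → eval (fromRoots a b c d) x ≈ (x + - a) * (x + - b) * (x + - c) * (x + - d)
  eval-fromRoots a b c d x = solve 5 (λ a b c d x →
    a :* b :* c :* d :+ x :* (:- (a :* b :* c :+ a :* b :* d :+ a :* c :* d :+ b :* c :* d) :+ x :* (a :* b :+ a
      :* c :+ a :* d :+ b :* c :+ b :* d :+ c :* d :+ x :* (:- (a :+ b :+ c :+ d) :+ x :* (:1 :+ x :* :0))))
      := (x :- a) :* (x :- b) :* (x :- c) :* (x :- d)) refl a b c d x

  minPoly : Carrier → Poly
  minPoly s = fromRoots s (φ s) (φ (φ s)) (φ (φ (φ s)))

  φ-+₄ : ∀ a b c d → φ (a + b + c + d) ≈ φ a + φ b + φ c + φ d
  φ-+₄ a b c d = trans (φ-+ _ d) (+-congʳ (trans (φ-+ _ c) (+-congʳ (φ-+ a b))))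

  φ-*₃ : ∀ a b c → φ (a * b * c) ≈ φ a * φ b * φ c
  φ-*₃ a b c = trans (φ-* _ c) (*-congʳ (φ-* a b))

  map-φ-fromRoots : ∀ a b c d → Pointwise (λ x y → φ x ≈ y) (fromRoots a b c d) (fromRoots (φ a) (φ b) (φ c) (φ d))
  map-φ-fromRoots a b c d =
    trans (φ-* _ d) (*-congʳ (φ-*₃ a b c)) ∷
    trans (φ-neg _) (-‿cong (trans (φ-+₄ _ _ _ _)
      (+-cong (+-cong (+-cong (φ-*₃ a b c) (φ-*₃ a b d)) (φ-*₃ a c d)) (φ-*₃ b c d)))) ∷
    trans (φ-+ _ _) (+-cong (trans (φ-+ _ _) (+-cong (trans (φ-+₄ _ _ _ _)
      (+-cong (+-cong (+-cong (φ-* a b) (φ-* a c)) (φ-* a d)) (φ-* b c))) (φ-* b d))) (φ-* c d)) ∷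
    trans (φ-neg _) (-‿cong (φ-+₄ a b c d)) ∷ φ-1 ∷ []

  fromRoots-cong : ∀ {a a′ b b′ c c′ d d′} → a ≈ a′ → b ≈ b′ → c ≈ c′ → d ≈ d′ →
                   fromRoots a b c d ≋ fromRoots a′ b′ c′ d′
  fromRoots-cong a b c d =
    *-cong (*-cong (*-cong a b) c) d ∷
    -‿cong (+-cong (+-cong (+-cong (*-cong (*-cong a b) c) (*-cong (*-cong a b) d)) (*-cong (*-cong a c) d)) (*-cong (*-cong b c) d)) ∷
    +-cong (+-cong (+-cong (+-cong (+-cong (*-cong a b) (*-cong a c)) (*-cong a d)) (*-cong b c)) (*-cong b d)) (*-cong c d) ∷
    -‿cong (+-cong (+-cong (+-cong a b) c) d) ∷ refl ∷ []

  fromRoots-rotate : ∀ a b c d → fromRoots b c d a ≋ fromRoots a b c d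
  fromRoots-rotate a b c d =
    (solve 4 (λ a b c d → b :* c :* d :* a := a :* b :* c :* d) refl a b c d) ∷
    (solve 4 (λ a b c d →
      :- (b :* c :* d :+ b :* c :* a :+ b :* d :* a :+ c :* d :* a)
        := :- (a :* b :* c :+ a :* b :* d :+ a :* c :* d :+ b :* c :* d)) refl a b c d) ∷
    (solve 4 (λ a b c d →
      b :* c :+ b :* d :+ b :* a :+ c :* d :+ c :* a :+ d :* a
        := a :* b :+ a :* c :+ a :* d :+ b :* c :+ b :* d :+ c :* d) refl a b c d) ∷
    (solve 4 (λ a b c d → :- (b :+ c :+ d :+ a) := :- (a :+ b :+ c :+ d)) refl a b c d) ∷ refl ∷ []

  minPoly-cong : ∀ {s t} → s ≈ t → minPoly s ≋ minPoly t
  minPoly-cong e = fromRoots-cong e (φ-cong e) (φ-cong (φ-cong e)) (φ-cong (φ-cong (φ-cong e)))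

  -- φ rotates the four roots cyclically, and the elementary symmetric functions are invariant under
  -- this rotation.
  minPoly-In : ∀ s → CoeffsIn q (minPoly s)
  minPoly-In s = fixed (map-φ-fromRoots s (φ s) (φ (φ s)) (φ (φ (φ s))))
    (≋-trans (fromRoots-cong refl refl refl (φ⁴ s)) (fromRoots-rotate s (φ s) (φ (φ s)) (φ (φ (φ s)))))
    where
    fixed : ∀ {f g} → Pointwise (λ x y → φ x ≈ y) f g → g ≋ f → CoeffsIn q f
    fixed [] [] = []
    fixed (e ∷ es) (r ∷ rs) = trans e r ∷ fixed es rs

  *-zero-product₄ : ∀ {a b c d} → a * b * c * d ≈ 0# → a ≈ 0# ⊎ b ≈ 0# ⊎ c ≈ 0# ⊎ d ≈ 0#
  *-zero-product₄ e =
    [ [ [ inj₁ , inj₂ ∘ inj₁ ]′ ∘ *-zero-product , inj₂ ∘ inj₂ ∘ inj₁ ]′ ∘ *-zero-product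
    , inj₂ ∘ inj₂ ∘ inj₂ ]′ (*-zero-product e)

  conjugate-factors : ∀ {x s} → eval (minPoly s) x ≈ 0# →
    x ≈ s ⊎ x ≈ φ s ⊎ x ≈ φ (φ s) ⊎ x ≈ φ (φ (φ s))
  conjugate-factors {x} {s} e =
    Sum.map x-y≈0⇒x≈y (Sum.map x-y≈0⇒x≈y (Sum.map x-y≈0⇒x≈y x-y≈0⇒x≈y))
      (*-zero-product₄ (trans (sym (eval-fromRoots s (φ s) (φ (φ s)) (φ (φ (φ s))) x)) e))

  minPoly-root : ∀ s → eval (minPoly s) s ≈ 0#
  minPoly-root s = trans (eval-fromRoots s (φ s) (φ (φ s)) (φ (φ (φ s))) s) (solve 4 (λ a b c d →
    (a :- a) :* (a :- b) :* (a :- c) :* (a :- d)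
      := :0) refl s (φ s) (φ (φ s)) (φ (φ (φ s))))

  minPoly-isMinPoly : ∀ {s} → Degree4 s → IsMinPoly q s (minPoly s)
  minPoly-isMinPoly {s} d = minPoly-In s , refl , minPoly-root s , minimal
    where
    minimal : ∀ g → CoeffsIn q g → Monic g → eval g s ≈ 0# → 5 ≤ length g
    minimal g is m e with 5 ℕ.≤? length g
    ... | yes 5≤ = 5≤
    ... | no 5≰ = contradiction (zero-poly₄ g d is e (ℕₚ.≤-pred (ℕₚ.≰⇒> 5≰))) (monic-nonzero g m)

  -- The difference f - f₄ m has no leading term, so `zero-poly₄` applies to its four remaining
  -- coefficients. `f₄` may be zero, which leaves room for the result of a substitution before its
  -- degree is known.
  proportional : ∀ {s f₀ f₁ f₂ f₃ f₄ m₀ m₁ m₂ m₃ m₄} → Degree4 s →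
    let f = f₀ ∷ f₁ ∷ f₂ ∷ f₃ ∷ f₄ ∷ []
        m = m₀ ∷ m₁ ∷ m₂ ∷ m₃ ∷ m₄ ∷ []
    in CoeffsIn q f → eval f s ≈ 0# → CoeffsIn q m → eval m s ≈ 0# → m₄ ≈ 1# → f ≋ scale f₄ m
  proportional {s} {f₀} {f₁} {f₂} {f₃} {f₄} {m₀} {m₁} {m₂} {m₃} {m₄} d
    (i₀ ∷ i₁ ∷ i₂ ∷ i₃ ∷ i₄ ∷ []) e (j₀ ∷ j₁ ∷ j₂ ∷ j₃ ∷ _ ∷ []) r m₄≈1 =
    go (zero-poly₄ ((f₀ + - f₄ * m₀) ∷ (f₁ + - f₄ * m₁) ∷ (f₂ + - f₄ * m₂) ∷ (f₃ + - f₄ * m₃) ∷ []) d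
      (difference i₀ j₀ ∷ difference i₁ j₁ ∷ difference i₂ j₂ ∷ difference i₃ j₃ ∷ []) vanishes ℕₚ.≤-refl)
    where
    f = f₀ ∷ f₁ ∷ f₂ ∷ f₃ ∷ f₄ ∷ []
    m = m₀ ∷ m₁ ∷ m₂ ∷ m₃ ∷ m₄ ∷ []
    difference : ∀ {f m} → In f → In m → In (f + - f₄ * m)
    difference i j = In-+ i (In-* (In-neg i₄) j)
    cleared : ∀ {f m} → f + - f₄ * m ≈ 0# → f ≈ f₄ * m
    cleared {f} {m} z = combine₁ 1# z (solve 3 (λ f f₄ m →
      f :- f₄ :* m
        := :1 :* ((f :+ (:- f₄ :* m)) :- :0)) refl f f₄ m)
    leading : (f₄ + - f₄ * m₄) + s * 0# ≈ 0#
    leading = combine₁ (- f₄) m₄≈1 (solve 3 (λ f₄ m₄ s →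
      ((f₄ :+ (:- f₄ :* m₄)) :+ s :* :0) :- :0
        := :- f₄ :* (m₄ :- :1)) refl f₄ m₄ s)
    vanishes : eval ((f₀ + - f₄ * m₀) ∷ (f₁ + - f₄ * m₁) ∷ (f₂ + - f₄ * m₂) ∷ (f₃ + - f₄ * m₃) ∷ []) s ≈ 0#
    vanishes = begin
      _ ≈⟨ +-congˡ (*-congˡ (+-congˡ (*-congˡ (+-congˡ (*-congˡ (+-congˡ (*-congˡ (sym leading)))))))) ⟩
      eval (addP f (scale (- f₄) m)) s ≈⟨ eval-addP f (scale (- f₄) m) s ⟩
      eval f s + eval (scale (- f₄) m) s ≈⟨ +-cong e (trans (eval-scale (- f₄) m s) (trans (*-congˡ r) (zeroʳ _))) ⟩
      0# + 0# ≈⟨ +-identityʳ 0# ⟩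
      0# ∎
    go : All (_≈ 0#) ((f₀ + - f₄ * m₀) ∷ (f₁ + - f₄ * m₁) ∷ (f₂ + - f₄ * m₂) ∷ (f₃ + - f₄ * m₃) ∷ []) →
         f ≋ scale f₄ m
    go (z₀ ∷ z₁ ∷ z₂ ∷ z₃ ∷ []) = cleared z₀ ∷ cleared z₁ ∷ cleared z₂ ∷ cleared z₃ ∷
      sym (trans (*-congˡ m₄≈1) (*-identityʳ f₄)) ∷ []

  proportional-to-minPoly : ∀ {s f₀ f₁ f₂ f₃ f₄} → Degree4 s → CoeffsIn q (f₀ ∷ f₁ ∷ f₂ ∷ f₃ ∷ f₄ ∷ []) →
    eval (f₀ ∷ f₁ ∷ f₂ ∷ f₃ ∷ f₄ ∷ []) s ≈ 0# → (f₀ ∷ f₁ ∷ f₂ ∷ f₃ ∷ f₄ ∷ []) ≋ scale f₄ (minPoly s)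
  proportional-to-minPoly {s} d is e = proportional d is e (minPoly-In s) (minPoly-root s) refl

  scale-one : ∀ {a} f → a ≈ 1# → scale a f ≋ f
  scale-one [] e = []
  scale-one (b ∷ f) e = trans (*-congʳ e) (*-identityˡ b) ∷ scale-one f e

  monic-quartic≋minPoly : ∀ {s} f → Degree4 s → CoeffsIn q f → length f ≡ 5 → Monic f → eval f s ≈ 0# → f ≋ minPoly s
  monic-quartic≋minPoly (f₀ ∷ f₁ ∷ f₂ ∷ f₃ ∷ f₄ ∷ []) d is ≡.refl m e =
    ≋-trans (proportional-to-minPoly d is e) (scale-one _ m)

  minPoly-unique : ∀ {s h} → Degree4 s → IsMinPoly q s h → h ≋ minPoly s
  minPoly-unique {s} {h} d (is , m , e , minimal) = monic-quartic≋minPoly h d is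
    (ℕₚ.≤-antisym (minimal _ (minPoly-In s) refl (minPoly-root s))
                  (proj₂ (proj₂ (proj₂ (minPoly-isMinPoly d))) h is m e)) m e

  minPoly-at-0 : ∀ {s} → Degree4 s → ¬ eval (minPoly s) 0# ≈ 0#
  minPoly-at-0 d e =
    [ degree4-nonzero d ∘ sym
    , [ degree4-nonzero (degree4-φ d) ∘ sym
      , [ degree4-nonzero (degree4-φ (degree4-φ d)) ∘ sym
        , degree4-nonzero (degree4-φ (degree4-φ (degree4-φ d))) ∘ sym ]′ ]′ ]′ (conjugate-factors e)

  -- In a factorisation one factor kills `s`; having at most four coefficients, it is identically
  -- zero. The product then vanishes at 0, although all conjugates of `s` are nonzero.
  minPoly-irreducible : ∀ {s f} → Degree4 s → f ≋ minPoly s → IrreducibleHom q f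
  minPoly-irreducible {s} {f} d f≋ g h g-In h-In 2≤g 2≤h len gh≋f =
    [ (λ z → vanish (trans (*-congʳ (eval-zero 0# (zero-poly₄ g d g-In z (bound 2≤h len′)))) (zeroˡ _)))
    , (λ z → vanish (trans (*-congˡ (eval-zero 0# (zero-poly₄ h d h-In z (bound 2≤g (≡.trans (ℕₚ.+-comm (length h) _) len′))))) (zeroʳ _)))
    ]′ (*-zero-product (trans (product s) (minPoly-root s)))
    where
    product : ∀ x → eval g x * eval h x ≈ eval (minPoly s) x
    product x = trans (sym (eval-mulP g h x)) (eval-cong x (≋-trans gh≋f f≋))
    vanish : eval g 0# * eval h 0# ≈ 0# → _
    vanish z = minPoly-at-0 d (trans (sym (product 0#)) z)
    len′ : length g ℕ.+ length h ≡ 6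
    len′ = ≡.trans len (≡.cong suc (Pointwise.Pointwise-length f≋))
    bound : ∀ {m n} → 2 ≤ n → m ℕ.+ n ≡ 6 → m ≤ 4
    bound {m} {n} 2≤n e = ℕₚ.+-cancelʳ-≤ 2 m 4 (ℕₚ.≤-trans (ℕₚ.+-monoʳ-≤ m 2≤n) (ℕₚ.≤-reflexive e))

  minPoly-quartic : ∀ {s f} → Degree4 s → f ≋ minPoly s → MonicIrredQuartic q f
  minPoly-quartic {s} d e = CoeffsIn-resp (≋-sym e) (minPoly-In s) , Pointwise.Pointwise-length e ,
    Monic-resp-≋ (≋-sym e) refl , minPoly-irreducible d e

  -- The quartic extension needs F_q as a ring of coefficients, not as a predicate. Equality ignores
  -- the membership proofs, so all ring laws can be pulled back along the inclusion.
  F-raw : RawRing (c ⊔ ℓ) ℓ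
  F-raw = record
    { Carrier = Σ Carrier In ; _≈_ = λ x y → proj₁ x ≈ proj₁ y
    ; _+_ = λ (x , i) (y , j) → x + y , In-+ i j
    ; _*_ = λ (x , i) (y , j) → x * y , In-* i j
    ; -_ = λ (x , i) → - x , In-neg i
    ; 0# = 0# , In-0 ; 1# = 1# , In-1 }

  F-embeds : IsRingMonomorphism F-raw rawRing proj₁
  F-embeds = record
    { isRingHomomorphism = record
      { isSemiringHomomorphism = record
        { isNearSemiringHomomorphism = record
          { +-isMonoidHomomorphism = record
            { isMagmaHomomorphism = record
              { isRelHomomorphism = record { cong = λ e → e } ; homo = λ _ _ → refl }
            ; ε-homo = refl }
          ; *-homo = λ _ _ → refl }
        ; 1#-homo = refl }
      ; -‿homo = λ _ → refl }
    ; injective = λ e → e }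

  F : CommutativeRing (c ⊔ ℓ) ℓ
  F = record { isCommutativeRing = Algebra.Morphism.RingMonomorphism.isCommutativeRing F-embeds isCommutativeRing }

  F-isField : FieldDefs.IsField F
  F-isField = 1≉0 , λ (x , i) x≉0 → let (y , xy≈1) = inverse x x≉0 in (y , In-inverse i xy≈1) , xy≈1

-- Powers of γ: the elements of F_q and the solutions of φ²(β) = -β.

module Generator {c ℓ : Level} (R : CommutativeRing c ℓ) (q : ℕ) (q-odd : OddPrimePower q)
  (isField : FieldDefs.IsField R) (card : FieldDefs.HasCard R (q ℕ.^ 4))
  (γ : CommutativeRing.Carrier R) (order : FieldDefs.HasOrder R γ (2 ℕ.* (q ℕ.^ 2 ∸ 1))) where
  open CommutativeRing R
  open FieldDefs R
  open IntegerSolver R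
  open RingLemmas R
  open FieldLemmas R isField
  open FiniteField R isField card using (_≟_; square-equal)
  open Frobenius R q q-odd isField card
  open RootsOfUnity R isField _≟_ γ (2 ℕ.* (q ℕ.^ 2 ∸ 1)) order
  open Relation.Binary.Reasoning.Setoid setoid

  h : ℕ
  h = proj₁ OddNat-q

  -- Written through `h`, where q = 2h + 1: this keeps truncated subtraction out of the exponents
  -- and turns their identities into polynomial ones in `h`.
  q-1 q+1 : ℕ
  q-1 = 2 ℕ.* h
  q+1 = 2 ℕ.* h ℕ.+ 2

  q≡2h+1 : q ≡ 2 ℕ.* h ℕ.+ 1
  q≡2h+1 = proj₂ OddNat-q

  q≡suc[q-1] : q ≡ suc q-1
  q≡suc[q-1] = ≡.trans q≡2h+1 (ℕₚ.+-comm q-1 1)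

  q²-1≡ : q ℕ.^ 2 ∸ 1 ≡ q-1 ℕ.* q+1
  q²-1≡ = ≡.trans (≡.cong (_∸ 1) (≡.trans (≡.cong (ℕ._^ 2) q≡2h+1)
    (Nat.solve 1 (λ h →
      (Nat.con 2 Nat.:* h Nat.:+ Nat.con 1) Nat.:* ((Nat.con 2 Nat.:* h Nat.:+ Nat.con 1) Nat.:* Nat.con 1)
        Nat.:= (Nat.con 2 Nat.:* h) Nat.:* (Nat.con 2 Nat.:* h Nat.:+ Nat.con 2) Nat.:+ Nat.con 1) ≡.refl h))) (ℕₚ.m+n∸n≡m (q-1 ℕ.* q+1) 1)

  n : ℕ
  n = 2 ℕ.* (q ℕ.^ 2 ∸ 1)

  n≡ : n ≡ 2 ℕ.* (q-1 ℕ.* q+1)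
  n≡ = ≡.cong (2 ℕ.*_) q²-1≡

  γ^n≈1 : pow γ n ≈ 1#
  γ^n≈1 = proj₁ (proj₂ order)

  0<q-1 : 0 < q-1
  0<q-1 with q-1 in e
  ... | suc _ = s≤s z≤n
  ... | zero = contradiction (≡.subst (0 <_) (≡.trans n≡ (≡.cong (λ m → 2 ℕ.* (m ℕ.* q+1)) e)) (proj₁ order)) λ ()

  0<q+1 : 0 < q+1
  0<q+1 = ℕₚ.≤-trans (s≤s z≤n) (ℕₚ.m≤n+m 2 q-1)

  -- Its square is γ^n = 1, while it differs from 1 because the exponent is positive and below the
  -- order of γ.
  γ^[q²-1]≈-1 : pow γ (q-1 ℕ.* q+1) ≈ - 1#
  γ^[q²-1]≈-1 = [ (λ e → contradiction e not-one) , (λ e → e) ]′ (square-equal (begin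
      pow γ (q-1 ℕ.* q+1) * pow γ (q-1 ℕ.* q+1) ≈⟨ pow-+ γ (q-1 ℕ.* q+1) (q-1 ℕ.* q+1) ⟨
      pow γ (q-1 ℕ.* q+1 ℕ.+ q-1 ℕ.* q+1) ≡⟨ ≡.cong (pow γ) (≡.trans n≡ (≡.cong (q-1 ℕ.* q+1 ℕ.+_) (ℕₚ.+-identityʳ _))) ⟨
      pow γ n ≈⟨ γ^n≈1 ⟩
      1# ≈⟨ *-identityˡ 1# ⟨
      1# * 1# ∎))
    where
    0<m : 0 < q-1 ℕ.* q+1
    0<m = ℕₚ.*-mono-≤ 0<q-1 0<q+1
    not-one : ¬ pow γ (q-1 ℕ.* q+1) ≈ 1#
    not-one = proj₂ (proj₂ order) _ 0<m
      (≡.subst (q-1 ℕ.* q+1 <_) (≡.sym n≡) (ℕₚ.m<m+n _ (≡.subst (0 <_) (≡.sym (ℕₚ.+-identityʳ _)) 0<m)))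

  pow-neg-one-even : ∀ k → pow (- 1#) (2 ℕ.* k) ≈ 1#
  pow-neg-one-even k = trans (sym (pow-pow (- 1#) 2 k))
    (trans (pow-cong k (solve 0 (:- :1 :* (:- :1 :* :1) := :1) refl)) (pow-one k))

  pow-neg-one-odd : ∀ {i} → OddNat i → pow (- 1#) i ≈ - 1#
  pow-neg-one-odd (k , ≡.refl) = trans (pow-+ (- 1#) (2 ℕ.* k) 1)
    (trans (*-congʳ (pow-neg-one-even k)) (solve 0 (:1 :* (:- :1 :* :1) := :- :1) refl))

  pow-q² : ∀ x → φ (φ x) ≈ x * pow x (q-1 ℕ.* q+1)
  pow-q² x = trans (φ² x) (reflexive (≡.cong (pow x) (≡.trans (≡.cong₂ ℕ._*_ q≡2h+1 q≡2h+1)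
    (Nat.solve 1 (λ h →
      (Nat.con 2 Nat.:* h Nat.:+ Nat.con 1) Nat.:* (Nat.con 2 Nat.:* h Nat.:+ Nat.con 1)
        Nat.:= Nat.con 1 Nat.:+ (Nat.con 2 Nat.:* h) Nat.:* (Nat.con 2 Nat.:* h Nat.:+ Nat.con 2)) ≡.refl h))))

  γ^odd-antifixed : ∀ {i} → OddNat i → φ (φ (pow γ i)) ≈ - pow γ i
  γ^odd-antifixed {i} odd = trans (pow-q² (pow γ i)) (trans (*-congˡ (trans (pow-comm γ i (q-1 ℕ.* q+1))
    (trans (pow-cong i γ^[q²-1]≈-1) (pow-neg-one-odd odd)))) (solve 1 (λ x → x :* :- :1 := :- x) refl (pow γ i)))

  -- Here β^(q²-1) equals (-1)^i, so an even exponent would give 1 = -1.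
  odd-exponent : ∀ {β i} → pow β (q-1 ℕ.* q+1) ≈ - 1# → β ≈ pow γ i → OddNat i
  odd-exponent {β} {i} β^[q²-1]≈-1 β≈γ^i with even-or-odd i
  ... | inj₂ o = o
  ... | inj₁ (k , i≡2k) = contradiction (begin
      1# + 1# ≈⟨ +-congʳ (pow-neg-one-even k) ⟨
      pow (- 1#) (2 ℕ.* k) + 1# ≡⟨ ≡.cong (λ j → pow (- 1#) j + 1#) i≡2k ⟨
      pow (- 1#) i + 1# ≈⟨ +-congʳ (pow-cong i γ^[q²-1]≈-1) ⟨
      pow (pow γ (q-1 ℕ.* q+1)) i + 1# ≈⟨ +-congʳ (pow-comm γ (q-1 ℕ.* q+1) i) ⟩
      pow (pow γ i) (q-1 ℕ.* q+1) + 1# ≈⟨ +-congʳ (pow-cong (q-1 ℕ.* q+1) β≈γ^i) ⟨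
      pow β (q-1 ℕ.* q+1) + 1# ≈⟨ +-congʳ β^[q²-1]≈-1 ⟩
      - 1# + 1# ≈⟨ -‿inverseˡ 1# ⟩
      0# ∎) 2≉0

  antifixed-pow : ∀ {β} → ¬ β ≈ 0# → φ (φ β) ≈ - β → pow β (q-1 ℕ.* q+1) ≈ - 1#
  antifixed-pow {β} β≉0 e = *-cancelˡ β≉0 (trans (sym (pow-q² β)) (trans e (solve 1 (λ β → :- β := β :* :- :1) refl β)))

  -- Dividing φ²(β) = -β by β gives β^(q²-1) = -1. Hence β is a root of unity whose order divides
  -- 2(q²-1), which is where the order of γ comes from.
  antifixed⇒γ^odd : ∀ {β} → ¬ β ≈ 0# → φ (φ β) ≈ - β → ∃[ i ] (OddNat i × β ≈ pow γ i)
  antifixed⇒γ^odd {β} β≉0 e = Product.map₂ (λ (_ , β≈γ^i) → odd-exponent β^[q²-1]≈-1 β≈γ^i , β≈γ^i)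
    (root-of-unity β (begin
      pow β n ≡⟨ ≡.cong (pow β) (≡.trans n≡ (ℕₚ.*-comm 2 (q-1 ℕ.* q+1))) ⟩
      pow β (q-1 ℕ.* q+1 ℕ.* 2) ≈⟨ pow-pow β (q-1 ℕ.* q+1) 2 ⟨
      pow (pow β (q-1 ℕ.* q+1)) 2 ≈⟨ pow-cong 2 β^[q²-1]≈-1 ⟩
      - 1# * (- 1# * 1#) ≈⟨ (solve 0 (:- :1 :* (:- :1 :* :1) := :1) refl) ⟩
      1# ∎))
    where
    β^[q²-1]≈-1 = antifixed-pow β≉0 e

  n≡q-1*2q+1 : n ≡ q-1 ℕ.* (2 ℕ.* q+1)
  n≡q-1*2q+1 = ≡.trans n≡ (≡.trans (≡.sym (ℕₚ.*-assoc 2 q-1 q+1))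
    (≡.trans (≡.cong (ℕ._* q+1) (ℕₚ.*-comm 2 q-1)) (ℕₚ.*-assoc q-1 2 q+1)))

  φ-suc : ∀ x → φ x ≈ x * pow x q-1
  φ-suc x = reflexive (≡.cong (pow x) q≡suc[q-1])

  γ^2[q+1]-In : ∀ k → In (pow γ (k ℕ.* (2 ℕ.* q+1)))
  γ^2[q+1]-In k = trans (φ-suc _) (trans (*-congˡ (begin
    pow (pow γ (k ℕ.* (2 ℕ.* q+1))) q-1 ≈⟨ pow-pow γ (k ℕ.* (2 ℕ.* q+1)) q-1 ⟩
    pow γ (k ℕ.* (2 ℕ.* q+1) ℕ.* q-1) ≡⟨ ≡.cong (pow γ) exponent ⟩
    pow γ (k ℕ.* n ℕ.+ 0) ≈⟨ pow-γ-reduce k 0 ⟩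
    1# ∎)) (*-identityʳ _))
    where
    exponent : k ℕ.* (2 ℕ.* q+1) ℕ.* q-1 ≡ k ℕ.* n ℕ.+ 0
    exponent = ≡.trans (ℕₚ.*-assoc k _ q-1) (≡.trans (≡.cong (k ℕ.*_)
      (≡.trans (ℕₚ.*-comm _ q-1) (≡.sym n≡q-1*2q+1))) (≡.sym (ℕₚ.+-identityʳ _)))

  γ^2[q+1]-exponent : ∀ j → j < n → pow (pow γ j) q-1 ≈ 1# → ∃[ k ] (k < q-1 × j ≡ k ℕ.* (2 ℕ.* q+1))
  γ^2[q+1]-exponent j j<n e = k , k<q-1 , j≡
    where
    2[q+1]∣j : 2 ℕ.* q+1 ∣ j
    2[q+1]∣j = *-cancelˡ-∣ q-1 {{ℕ.>-nonZero 0<q-1}} (≡.subst₂ _∣_ n≡q-1*2q+1 (ℕₚ.*-comm j q-1)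
      (order-divides (j ℕ.* q-1) (trans (sym (pow-pow γ j q-1)) e)))
    k = _∣_.quotient 2[q+1]∣j
    j≡ : j ≡ k ℕ.* (2 ℕ.* q+1)
    j≡ = _∣_.equality 2[q+1]∣j
    k<q-1 : k < q-1
    k<q-1 = ℕₚ.*-cancelʳ-< (2 ℕ.* q+1) k q-1 (≡.subst₂ _<_ j≡ n≡q-1*2q+1 j<n)

  -- x^(q-1) = 1 and q - 1 divides n, so x = γ^j for some j; then n = 2(q+1)(q-1) divides j(q-1).
  In⇒γ^2[q+1] : ∀ {x} → In x → ¬ x ≈ 0# → ∃[ k ] (k < q-1 × x ≈ pow γ (k ℕ.* (2 ℕ.* q+1)))
  In⇒γ^2[q+1] {x} x-In x≉0 = from-root (root-of-unity x (trans (reflexive (≡.cong (pow x) n≡q-1*2q+1))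
      (trans (sym (pow-pow x q-1 _)) (trans (pow-cong (2 ℕ.* q+1) x^[q-1]≈1) (pow-one (2 ℕ.* q+1))))))
    where
    x^[q-1]≈1 : pow x q-1 ≈ 1#
    x^[q-1]≈1 = *-cancelˡ x≉0 (trans (sym (φ-suc x)) (trans x-In (sym (*-identityʳ x))))
    from-root : ∃[ j ] (j < n × x ≈ pow γ j) → _
    from-root (j , j<n , x≈γ^j) = Product.map₂ (λ (k< , j≡) → k< , trans x≈γ^j (reflexive (≡.cong (pow γ) j≡)))
      (γ^2[q+1]-exponent j j<n (trans (pow-cong q-1 (sym x≈γ^j)) x^[q-1]≈1))

  -- Zero and the q - 1 powers of γ^(2(q+1)) exhaust F_q, and the order of γ keeps these powers
  -- distinct.
  F-card : FieldDefs.HasCard F q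
  F-card = ≡.subst (FieldDefs.HasCard F) (≡.sym q≡suc[q-1]) (enum , injective , surjective)
    where
    enum : Fin (suc q-1) → Σ Carrier In
    enum Fin.zero = 0# , In-0
    enum (Fin.suc i) = pow γ (Fin.toℕ i ℕ.* (2 ℕ.* q+1)) , γ^2[q+1]-In (Fin.toℕ i)
    0<2q+1 : 0 < 2 ℕ.* q+1
    0<2q+1 = ℕₚ.≤-trans 0<q+1 (ℕₚ.m≤m+n q+1 _)
    bound : ∀ (i : Fin q-1) → Fin.toℕ i ℕ.* (2 ℕ.* q+1) < n
    bound i = ≡.subst (Fin.toℕ i ℕ.* (2 ℕ.* q+1) <_) (≡.sym n≡q-1*2q+1) (ℕₚ.*-monoˡ-< (2 ℕ.* q+1) {{ℕ.>-nonZero 0<2q+1}} (Finₚ.toℕ<n i))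
    injective : ∀ i j → proj₁ (enum i) ≈ proj₁ (enum j) → i ≡ j
    injective Fin.zero Fin.zero e = ≡.refl
    injective Fin.zero (Fin.suc j) e = contradiction (sym e) (pow-nonzero (Fin.toℕ j ℕ.* (2 ℕ.* q+1)) γ-nonzero)
    injective (Fin.suc i) Fin.zero e = contradiction e (pow-nonzero (Fin.toℕ i ℕ.* (2 ℕ.* q+1)) γ-nonzero)
    injective (Fin.suc i) (Fin.suc j) e = ≡.cong Fin.suc (Finₚ.toℕ-injective
      (ℕₚ.*-cancelʳ-≡ _ _ (2 ℕ.* q+1) {{ℕ.>-nonZero 0<2q+1}} (pow-γ-injective (bound i) (bound j) e)))
    surjective : ∀ x → ∃[ i ] proj₁ (enum i) ≈ proj₁ x
    surjective (x , x-In) = decide (x ≟ 0#)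
      where
      nonzero-case : ∃[ k ] (k < q-1 × x ≈ pow γ (k ℕ.* (2 ℕ.* q+1))) → ∃[ i ] proj₁ (enum i) ≈ x
      nonzero-case (k , k<q-1 , e) = Fin.suc (Fin.fromℕ< k<q-1) ,
        trans (reflexive (≡.cong (λ i → pow γ (i ℕ.* (2 ℕ.* q+1))) (Finₚ.toℕ-fromℕ< k<q-1))) (sym e)
      decide : Dec (x ≈ 0#) → ∃[ i ] proj₁ (enum i) ≈ x
      decide (yes x≈0) = Fin.zero , sym x≈0
      decide (no x≉0) = nonzero-case (In⇒γ^2[q+1] x-In x≉0)

-- Existence of roots of irreducible quartics, and their degree.

module RootExistence {c ℓ : Level} (R : CommutativeRing c ℓ) (q : ℕ) (q-odd : OddPrimePower q)
  (isField : FieldDefs.IsField R) (card : FieldDefs.HasCard R (q ℕ.^ 4))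
  (F-card : FieldDefs.HasCard (Frobenius.F R q q-odd isField card) q) where
  open CommutativeRing R
  open FieldDefs R
  open IntegerSolver R
  open RingLemmas R
  open FieldLemmas R isField
  open FiniteField R isField card using (_≟_; element; element-injective; fermat)
  open Frobenius R q q-odd isField card
  open Relation.Binary.Reasoning.Setoid setoid

  module Quartic (a₀ a₁ a₂ a₃ : Σ Carrier In) where
    module Q = QuarticExtension F a₀ a₁ a₂ a₃
    module K = CommutativeRing Q.K
    open FieldDefs Q.K using () renaming (pow to powK)

    f : Poly
    f = proj₁ a₀ ∷ proj₁ a₁ ∷ proj₁ a₂ ∷ proj₁ a₃ ∷ 1# ∷ []

    value : K.Carrier → Carrier → Carrier
    value ((v₀ , _) , (v₁ , _) , (v₂ , _) , (v₃ , _)) x = v₀ + x * (v₁ + x * (v₂ + x * v₃))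

    top : K.Carrier → Carrier
    top (_ , _ , _ , (v₃ , _)) = v₃

    value-cong : ∀ {v w} x → v K.≈ w → value v x ≈ value w x
    value-cong x (e₀ , e₁ , e₂ , e₃) = +-cong e₀ (*-congˡ (+-cong e₁ (*-congˡ (+-cong e₂ (*-congˡ e₃)))))

    -- Evaluation at x respects reduction modulo f only if f(x) = 0. The defect, f(x) times the
    -- overflowing coefficient, is what accumulates in the quotient.
    value-shift : ∀ v x → value (Q.shift v) x ≈ x * value v x + - (eval f x * top v)
    value-shift ((v₀ , _) , (v₁ , _) , (v₂ , _) , (v₃ , _)) x =
      identity (proj₁ a₀) (proj₁ a₁) (proj₁ a₂) (proj₁ a₃)
      where
      identity : ∀ a b c d →
        - (a * v₃) + x * ((v₀ + - (b * v₃)) + x * ((v₁ + - (c * v₃)) + x * (v₂ + - (d * v₃)))) ≈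
        x * (v₀ + x * (v₁ + x * (v₂ + x * v₃))) + - ((a + x * (b + x * (c + x * (d + x * (1# + x * 0#))))) * v₃)
      identity a b c d = solve 9 (λ v₀ v₁ v₂ v₃ a b c d x →
        :- (a :* v₃) :+ x :* ((v₀ :- b :* v₃) :+ x :* ((v₁ :- c :* v₃) :+ x :* (v₂ :- d :* v₃)))
          := x :* (v₀ :+ x :* (v₁ :+ x :* (v₂ :+ x :* v₃))) :- ((a :+ x :* (b :+ x :* (c :+ x :* (d :+ x :* (:1 :+ x
          :* :0))))) :* v₃)) refl v₀ v₁ v₂ v₃ a b c d x

    -- quotients n is the quotient of x^(n+3) by f, whose remainder is residue n.
    residue : ℕ → K.Carrier
    residue zero = (0# , In-0) , (0# , In-0) , (0# , In-0) , (1# , In-1)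
    residue (suc n) = Q.shift (residue n)

    quotients : ℕ → Poly
    quotients zero = []
    quotients (suc n) = top (residue n) ∷ quotients n

    length-quotients : ∀ n → length (quotients n) ≡ n
    length-quotients zero = ≡.refl
    length-quotients (suc n) = ≡.cong suc (length-quotients n)

    quotients-monic : ∀ n → Monic (quotients (suc n))
    quotients-monic zero = refl
    quotients-monic (suc n) = quotients-monic n

    division : ∀ n x → value (residue n) x + eval f x * eval (quotients n) x ≈ pow x (n ℕ.+ 3)
    division zero x = solve 2 (λ x e →
      (:0 :+ x :* (:0 :+ x :* (:0 :+ x :* :1))) :+ e :* :0
        := x :* (x :* (x :* :1))) refl x (eval f x)
    division (suc n) x = begin
      value (Q.shift (residue n)) x + f′ * (t + x * g) ≈⟨ +-congʳ (value-shift (residue n) x) ⟩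
      (x * v + - (f′ * t)) + f′ * (t + x * g) ≈⟨ identity v f′ t g ⟩
      x * (v + f′ * g) ≈⟨ *-congˡ (division n x) ⟩
      x * pow x (n ℕ.+ 3) ∎
      where
      f′ = eval f x
      t = top (residue n)
      g = eval (quotients n) x
      v = value (residue n) x
      identity : ∀ v f t g → (x * v + - (f * t)) + f * (t + x * g) ≈ x * (v + f * g)
      identity v f t g = solve 5 (λ x v f t g →
        (x :* v :- f :* t) :+ f :* (t :+ x :* g)
          := x :* (v :+ f :* g)) refl x v f t g

    powers : ∀ n → powK Q.X (n ℕ.+ 3) K.≈ residue n
    powers zero = Q.X³
    powers (suc n) = K.trans {Q.X Q.⊛ Xⁿ} {Q.shift Xⁿ} {residue (suc n)} (Q.X⊛ Xⁿ) (Q.shift-cong {Xⁿ} {residue n} (powers n))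
      where Xⁿ = powK Q.X (n ℕ.+ 3)

    module _ (¬factors₁₃ : ¬ Q.Factors₁₃) (¬factors₂₂ : ¬ Q.Factors₂₂) where
      open Q.Irreducible F-isField (λ x y → proj₁ x ≟ proj₁ y) ¬factors₁₃ ¬factors₂₂ using (K-isField)

      X-fermat : powK Q.X (q ℕ.^ 4) K.≈ Q.X
      X-fermat = FiniteField.fermat Q.K K-isField (Q.K-card F-card) Q.X

      -- In F_q[x]/(f) Fermat's theorem gives X^(q⁴) = X, so x^(q⁴) leaves the remainder x on
      -- division by f. As x^(q⁴) = x also holds for every element of the ambient field, f times the
      -- quotient vanishes everywhere.
      f*quotients-vanishes : ∀ n → n ℕ.+ 3 ≡ q ℕ.^ 4 → ∀ x → eval f x * eval (quotients n) x ≈ 0#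
      f*quotients-vanishes n n+3≡q⁴ x = combine₁ 1# (begin
        x + eval f x * eval (quotients n) x ≈⟨ +-congʳ (value-X x) ⟨
        value Q.X x + eval f x * eval (quotients n) x ≈⟨ +-congʳ (value-cong {Q.X} {residue n} x X≈residue) ⟩
        value (residue n) x + eval f x * eval (quotients n) x ≈⟨ division n x ⟩
        pow x (n ℕ.+ 3) ≡⟨ ≡.cong (pow x) n+3≡q⁴ ⟩
        pow x (q ℕ.^ 4) ≈⟨ fermat x ⟩
        x ∎) (cancel (eval f x * eval (quotients n) x))
        where
        X≈residue : Q.X K.≈ residue n
        X≈residue = K.trans {Q.X} {powK Q.X (n ℕ.+ 3)} {residue n}
          (K.sym {powK Q.X (n ℕ.+ 3)} {Q.X} (≡.subst (λ m → powK Q.X m K.≈ Q.X) (≡.sym n+3≡q⁴) X-fermat)) (powers n)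
        value-X : ∀ x → value Q.X x ≈ x
        value-X x = solve 1 (λ x → :0 :+ x :* (:1 :+ x :* (:0 :+ x :* :0)) := x) refl x
        cancel : ∀ e → e + - 0# ≈ 1# * ((x + e) + - x)
        cancel e = solve 2 (λ x e → e :- :0 := :1 :* ((x :+ e) :- x)) refl x e

      -- The quotient is monic with q⁴ - 3 coefficients, too few for it to vanish at all q⁴
      -- elements, so f must vanish somewhere.
      root : ∀ n → suc n ℕ.+ 3 ≡ q ℕ.^ 4 → ∃[ α ] eval f α ≈ 0#
      root n len = decide (Finₚ.any? (λ i → eval f (element i) ≟ 0#))
        where
        decide : Dec (∃[ i ] eval f (element i) ≈ 0#) → ∃[ α ] eval f α ≈ 0#
        decide (yes (i , e)) = element i , e
        decide (no none) = contradiction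
          (zero-poly (quotients (suc n)) (tabulate element)
            (AllPairsₚ.tabulate⁺ (λ i≢j e → i≢j (element-injective _ _ e)))
            (Allₚ.tabulate⁺ (λ i → zero-factor (λ e → none (i , e)) (f*quotients-vanishes (suc n) len (element i))))
            (≡.subst₂ _≤_ (≡.sym (length-quotients (suc n))) (≡.sym (Listₚ.length-tabulate element))
              (≡.subst (suc n ≤_) len (ℕₚ.m≤m+n (suc n) 3))))
          (monic-nonzero (quotients (suc n)) (quotients-monic n))

  module _ {f₀ f₁ f₂ f₃ f₄ : Carrier} (i₀ : In f₀) (i₁ : In f₁) (i₂ : In f₂) (i₃ : In f₃) (f₄≈1 : f₄ ≈ 1#)
    (irreducible : IrreducibleHom q (f₀ ∷ f₁ ∷ f₂ ∷ f₃ ∷ f₄ ∷ [])) where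
    open Quartic (f₀ , i₀) (f₁ , i₁) (f₂ , i₂) (f₃ , i₃) hiding (f)

    private
      leading : 1# * 1# ≈ f₄
      leading = trans (*-identityˡ 1#) (sym f₄≈1)

    no-linear-factor : ¬ Q.Factors₁₃
    no-linear-factor ((b , ib) , (g₀ , j₀) , (g₁ , j₁) , (g₂ , j₂) , e₀ , e₁ , e₂ , e₃) =
      irreducible (b ∷ 1# ∷ []) (g₀ ∷ g₁ ∷ g₂ ∷ 1# ∷ []) (ib ∷ In-1 ∷ []) (j₀ ∷ j₁ ∷ j₂ ∷ In-1 ∷ [])
        (s≤s (s≤s z≤n)) (s≤s (s≤s z≤n)) ≡.refl
        ( trans (solve 2 (λ b g₀ → b :* g₀ :+ :0 := b :* g₀) refl b g₀) e₀
        ∷ trans (solve 3 (λ b g₀ g₁ → b :* g₁ :+ (:1 :* g₀ :+ :0) := b :* g₁ :+ g₀) refl b g₀ g₁) e₁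
        ∷ trans (solve 3 (λ b g₁ g₂ → b :* g₂ :+ :1 :* g₁ := b :* g₂ :+ g₁) refl b g₁ g₂) e₂
        ∷ trans (solve 2 (λ b g₂ → b :* :1 :+ :1 :* g₂ := b :+ g₂) refl b g₂) e₃
        ∷ leading ∷ [])

    no-quadratic-factor : ¬ Q.Factors₂₂
    no-quadratic-factor ((b₀ , ib₀) , (b₁ , ib₁) , (g₀ , j₀) , (g₁ , j₁) , e₀ , e₁ , e₂ , e₃) =
      irreducible (b₀ ∷ b₁ ∷ 1# ∷ []) (g₀ ∷ g₁ ∷ 1# ∷ []) (ib₀ ∷ ib₁ ∷ In-1 ∷ []) (j₀ ∷ j₁ ∷ In-1 ∷ [])
        (s≤s (s≤s z≤n)) (s≤s (s≤s z≤n)) ≡.refl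
        ( trans (solve 2 (λ b₀ g₀ → b₀ :* g₀ :+ :0 := b₀ :* g₀) refl b₀ g₀) e₀
        ∷ trans (solve 4 (λ b₀ b₁ g₀ g₁ → b₀ :* g₁ :+ (b₁ :* g₀ :+ :0) := b₀ :* g₁ :+ b₁ :* g₀) refl b₀ b₁ g₀ g₁) e₁
        ∷ trans (solve 4 (λ b₀ b₁ g₀ g₁ →
          b₀ :* :1 :+ (b₁ :* g₁ :+ (:1 :* g₀ :+ :0))
            := (b₀ :+ b₁ :* g₁) :+ g₀) refl b₀ b₁ g₀ g₁) e₂
        ∷ trans (solve 2 (λ b₁ g₁ → b₁ :* :1 :+ :1 :* g₁ := b₁ :+ g₁) refl b₁ g₁) e₃
        ∷ leading ∷ [])

    quartic-root : ∀ n → suc n ℕ.+ 3 ≡ q ℕ.^ 4 → ∃[ α ] eval (f₀ ∷ f₁ ∷ f₂ ∷ f₃ ∷ f₄ ∷ []) α ≈ 0#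
    quartic-root n len = Product.map₂ (λ {α} → trans (eval-cong α (refl ∷ refl ∷ refl ∷ refl ∷ f₄≈1 ∷ [])))
      (root no-linear-factor no-quadratic-factor n len)

    -- If φ² fixed α, then x - α or (x - α)(x - φ(α)) would have coefficients in F_q and divide f.
    irreducible-root-degree4 : ∀ {α} → eval (f₀ ∷ f₁ ∷ f₂ ∷ f₃ ∷ f₄ ∷ []) α ≈ 0# → Degree4 α
    irreducible-root-degree4 {α} root φ²α≈α = decide (φ α ≟ α)
      where
      linear : In α → Q.Factors₁₃
      linear α-In = (- α , In-neg α-In) , (g₀ , In-+ i₁ (In-* α-In j₁)) , (g₁ , j₁) , (g₂ , j₂) ,
        combine₂ (- 1#) (α * α * α * α) root f₄≈1
          (solve 6 (λ f₀ f₁ f₂ f₃ f₄ α →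
            :- α :* (f₁ :+ α :* (f₂ :+ α :* (f₃ :+ α))) :- f₀
              := :- :1 :* ((f₀ :+ α :* (f₁ :+ α :* (f₂ :+ α :* (f₃ :+ α :* (f₄ :+ α :* :0))))) :- :0) :+ α :* α :* α
              :* α :* (f₄ :- :1)) refl f₀ f₁ f₂ f₃ f₄ α) ,
        (solve 3 (λ α g₁ f₁ → :- α :* g₁ :+ (f₁ :+ α :* g₁) := f₁) refl α g₁ f₁) , (solve 3 (λ α g₂ f₂ →
          :- α :* g₂ :+ (f₂ :+ α :* g₂)
            := f₂) refl α g₂ f₂) , (solve 2 (λ α f₃ → :- α :+ (f₃ :+ α) := f₃) refl α f₃)
        where
        g₂ = f₃ + α
        g₁ = f₂ + α * g₂
        g₀ = f₁ + α * g₁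
        j₂ : In g₂
        j₂ = In-+ i₃ α-In
        j₁ : In g₁
        j₁ = In-+ i₂ (In-* α-In j₂)

      quadratic : ¬ φ α ≈ α → Q.Factors₂₂
      quadratic φα≉α = (b₀ , b₀-In) , (b₁ , b₁-In) , (g₀ , In-+ i₂ (In-neg (In-+ b₀-In (In-* b₁-In g₁-In)))) , (g₁ , g₁-In) ,
        sym (x-y≈0⇒x≈y (All.head remainder)) , sym (x-y≈0⇒x≈y (All.head (All.tail remainder))) ,
        (solve 4 (λ b₀ b₁ g₁ f₂ → (b₀ :+ b₁ :* g₁) :+ (f₂ :- (b₀ :+ b₁ :* g₁)) := f₂) refl b₀ b₁ g₁ f₂) , (solve 2 (λ b₁ f₃ →
          b₁ :+ (f₃ :- b₁)
            := f₃) refl b₁ f₃)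
        where
        α′ = φ α
        b₀ = α * α′
        b₁ = - (α + α′)
        g₁ = f₃ + - b₁
        g₀ = f₂ + - (b₀ + b₁ * g₁)
        b₀-In : In b₀
        b₀-In = trans (φ-* α α′) (trans (*-congˡ φ²α≈α) (*-comm α′ α))
        b₁-In : In b₁
        b₁-In = trans (φ-neg _) (-‿cong (trans (φ-+ α α′) (trans (+-congˡ φ²α≈α) (+-comm α′ α))))
        g₁-In : In g₁
        g₁-In = In-+ i₃ (In-neg b₁-In)
        -- The remainder of f on division by x² + b₁ x + b₀ = (x - α)(x - φ(α)): two coefficients
        -- with two distinct roots.
        r : Poly
        r = (f₀ + - (b₀ * g₀)) ∷ (f₁ + - (b₀ * g₁ + b₁ * g₀)) ∷ []
        division-by-quadratic : ∀ b₀ b₁ x → (x * x + b₁ * x) + b₀ ≈ 0# → eval (f₀ ∷ f₁ ∷ f₂ ∷ f₃ ∷ f₄ ∷ []) x ≈ 0# →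
          let g₁ = f₃ + - b₁
              g₀ = f₂ + - (b₀ + b₁ * g₁)
          in (f₀ + - (b₀ * g₀)) + x * ((f₁ + - (b₀ * g₁ + b₁ * g₀)) + x * 0#) ≈ 0#
        division-by-quadratic b₀ b₁ x e e′ = combine₃ 1# (- ((x * x + (f₃ + - b₁) * x) + (f₂ + - (b₀ + b₁ * (f₃ + - b₁))))) (- (x * x * x * x)) e′ e f₄≈1
          (solve 8 (λ f₀ f₁ f₂ f₃ f₄ b₀ b₁ x →
            ((f₀ :- (b₀ :* (f₂ :- (b₀ :+ b₁ :* (f₃ :- b₁))))) :+ x :* ((f₁ :- (b₀ :* (f₃ :- b₁) :+ b₁ :* (f₂ :-
              (b₀ :+ b₁ :* (f₃ :- b₁))))) :+ x :* :0)) :- :0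
              := :1 :* ((f₀ :+ x :* (f₁ :+ x :* (f₂ :+ x :* (f₃ :+ x :* (f₄ :+ x :* :0))))) :- :0) :+ (:- ((x :* x :+
              (f₃ :- b₁) :* x) :+ (f₂ :- (b₀ :+ b₁ :* (f₃ :- b₁)))) :* (((x :* x :+ b₁ :* x) :+ b₀) :- :0) :+ :-
              (x :* x :* x :* x) :* (f₄ :- :1))) refl f₀ f₁ f₂ f₃ f₄ b₀ b₁ x)
        vieta : ∀ a b → (a * a + - (a + b) * a) + a * b ≈ 0#
        vieta a b = solve 2 (λ a b → (a :* a :+ :- (a :+ b) :* a) :+ a :* b := :0) refl a b
        vieta′ : ∀ a b → (b * b + - (a + b) * b) + a * b ≈ 0#
        vieta′ a b = solve 2 (λ a b → (b :* b :+ :- (a :+ b) :* b) :+ a :* b := :0) refl a b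
        root′ : eval (f₀ ∷ f₁ ∷ f₂ ∷ f₃ ∷ f₄ ∷ []) α′ ≈ 0#
        root′ = φ-root (i₀ ∷ i₁ ∷ i₂ ∷ i₃ ∷ In-resp (sym f₄≈1) In-1 ∷ []) root
        remainder : All (_≈ 0#) r
        remainder = zero-poly r (α ∷ α′ ∷ []) (((λ e → φα≉α (sym e)) ∷ []) ∷ [] ∷ [])
          (division-by-quadratic b₀ b₁ α (vieta α α′) root ∷ division-by-quadratic b₀ b₁ α′ (vieta′ α α′) root′ ∷ [])
          ℕₚ.≤-refl

      decide : Dec (φ α ≈ α) → _
      decide (yes φα≈α) = no-linear-factor (linear φα≈α)
      decide (no φα≉α) = no-quadratic-factor (quadratic φα≉α)

-- Möbius transformations and orbits of quartics.

module Orbits {κ ℓ : Level} (R : CommutativeRing κ ℓ) (q : ℕ) (q-odd : OddPrimePower q)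
  (isField : FieldDefs.IsField R) (card : FieldDefs.HasCard R (q ℕ.^ 4)) where
  open CommutativeRing R
  open FieldDefs R
  open IntegerSolver R
  open RingLemmas R
  open FieldLemmas R isField
  open FiniteField R isField card using (_≟_; *-zero-product; square-equal)
  open Frobenius R q q-odd isField card
  open Relation.Binary.Reasoning.Setoid setoid

  -- The equation y = (aα + b)/(cα + d) with its denominator cleared, so that composition needs no
  -- division. The denominator is nonzero whenever α lies outside F_q.
  record _⟶_ (α y : Carrier) : Set (κ ⊔ ℓ) where
    constructor möbius
    field
      {a b c d} : Carrier
      a-In : In a
      b-In : In b
      c-In : In c
      d-In : In d
      det≉0 : ¬ a * d + - (b * c) ≈ 0#
      image : y * (c * α + d) ≈ a * α + b

  ⟶-resp : ∀ {α β y z} → α ≈ β → y ≈ z → α ⟶ y → β ⟶ z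
  ⟶-resp {α} {β} {y} {z} α≈β y≈z (möbius {a} {b} {c} {d} ia ib ic id det e) = möbius ia ib ic id det
    (trans (*-cong (sym y≈z) (+-congʳ (*-congˡ (sym α≈β)))) (trans e (+-congʳ (*-congˡ α≈β))))

  ⟶-trans : ∀ {x y z} → x ⟶ y → y ⟶ z → x ⟶ z
  ⟶-trans {x} {y} {z} (möbius {a} {b} {c} {d} ia ib ic id det e) (möbius {a′} {b′} {c′} {d′} ia′ ib′ ic′ id′ det′ e′) =
    möbius {a = a′ * a + b′ * c} {a′ * b + b′ * d} {c′ * a + d′ * c} {c′ * b + d′ * d}
      (In-+ (In-* ia′ ia) (In-* ib′ ic)) (In-+ (In-* ia′ ib) (In-* ib′ id))
      (In-+ (In-* ic′ ia) (In-* id′ ic)) (In-+ (In-* ic′ ib) (In-* id′ id))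
      (λ z → *-nonzero det′ det (trans
        (solve 8 (λ a b c d a′ b′ c′ d′ →
          (a′ :* d′ :- b′ :* c′) :* (a :* d :- b :* c)
            := (a′ :* a :+ b′ :* c) :* (c′ :* b :+ d′ :* d) :- (a′ :* b :+ b′ :* d) :* (c′ :* a :+ d′ :* c)) refl a b c d a′ b′ c′ d′) z))
      (begin
        z * ((c′ * a + d′ * c) * x + (c′ * b + d′ * d)) ≈⟨ regroup z c′ d′ ⟩
        z * (c′ * (a * x + b) + d′ * (c * x + d)) ≈⟨ *-congˡ (+-congʳ (*-congˡ e)) ⟨
        z * (c′ * (y * w) + d′ * w) ≈⟨ collect w ⟩
        z * (c′ * y + d′) * w ≈⟨ *-congʳ e′ ⟩
        (a′ * y + b′) * w ≈⟨ expand w ⟩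
        a′ * (y * w) + b′ * w ≈⟨ +-congʳ (*-congˡ e) ⟩
        a′ * (a * x + b) + b′ * w ≈⟨ (solve 7 (λ a b c d x a′ b′ →
          a′ :* (a :* x :+ b) :+ b′ :* (c :* x :+ d)
            := (a′ :* a :+ b′ :* c) :* x :+ (a′ :* b :+ b′ :* d)) refl a b c d x a′ b′) ⟩
        (a′ * a + b′ * c) * x + (a′ * b + b′ * d) ∎)
    where
    w = c * x + d
    regroup : ∀ z c′ d′ → z * ((c′ * a + d′ * c) * x + (c′ * b + d′ * d)) ≈ z * (c′ * (a * x + b) + d′ * (c * x + d))
    regroup z c′ d′ = solve 8 (λ a b c d x z c′ d′ →
      z :* ((c′ :* a :+ d′ :* c) :* x :+ (c′ :* b :+ d′ :* d))
        := z :* (c′ :* (a :* x :+ b) :+ d′ :* (c :* x :+ d))) refl a b c d x z c′ d′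
    collect : ∀ w → z * (c′ * (y * w) + d′ * w) ≈ z * (c′ * y + d′) * w
    collect w = solve 5 (λ y z w c′ d′ →
      z :* (c′ :* (y :* w) :+ d′ :* w)
        := z :* (c′ :* y :+ d′) :* w) refl y z w c′ d′
    expand : ∀ w → (a′ * y + b′) * w ≈ a′ * (y * w) + b′ * w
    expand w = solve 4 (λ y w a′ b′ → (a′ :* y :+ b′) :* w := a′ :* (y :* w) :+ b′ :* w) refl y w a′ b′

  φ-linear : ∀ {a b} x → In a → In b → φ (a * x + b) ≈ a * φ x + b
  φ-linear x ia ib = trans (φ-+ _ _) (+-cong (trans (φ-* _ _) (*-congʳ ia)) ib)

  ⟶-φ : ∀ {x y} → x ⟶ y → φ x ⟶ φ y
  ⟶-φ {x} {y} (möbius ia ib ic id det e) = möbius ia ib ic id det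
    (trans (*-congˡ (sym (φ-linear x ic id))) (trans (sym (φ-* _ _)) (trans (φ-cong e) (φ-linear x ia ib))))

  linear-nonzero : ∀ {x c d} → ¬ In x → In c → In d → c * x + d ≈ 0# → c ≈ 0# × d ≈ 0#
  linear-nonzero {x} {c} {d} x∉F ic id e = decide (c ≟ 0#)
    where
    decide : Dec (c ≈ 0#) → c ≈ 0# × d ≈ 0#
    decide (yes c≈0) = c≈0 , combine₂ 1# (- x) e c≈0 (solve 3 (λ c d x →
      d :- :0
        := :1 :* ((c :* x :+ d) :- :0) :+ :- x :* (c :- :0)) refl c d x)
    decide (no c≉0) = contradiction (In-resp (x≈ (proj₂ (inverse c c≉0))) (In-* (In-neg id) (In-inverse ic (proj₂ (inverse c c≉0))))) x∉F
      where
      x≈ : ∀ {u} → c * u ≈ 1# → - d * u ≈ x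
      x≈ {u} cu≈1 = combine₂ (- u) x e cu≈1 (solve 4 (λ c d u x →
        :- d :* u :- x
          := :- u :* ((c :* x :+ d) :- :0) :+ x :* (c :* u :- :1)) refl c d u x)

  denominator-nonzero : ∀ {x a b c d} → ¬ In x → In c → In d → ¬ a * d + - (b * c) ≈ 0# → ¬ c * x + d ≈ 0#
  denominator-nonzero {x} {a} {b} {c} {d} x∉F ic id det e = go (linear-nonzero x∉F ic id e)
    where
    go : ¬ (c ≈ 0# × d ≈ 0#)
    go (c≈0 , d≈0) = det (combine₂ a (- b) d≈0 c≈0 (solve 4 (λ a b c d →
      (a :* d :- b :* c) :- :0
        := a :* (d :- :0) :+ :- b :* (c :- :0)) refl a b c d))

  möbius-image : ∀ {x a b c d} → Degree4 x → In a → In b → In c → In d → ¬ a * d + - (b * c) ≈ 0# →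
                 ∃[ y ] y * (c * x + d) ≈ a * x + b
  möbius-image {x} {a} {b} {c} {d} d4 ia ib ic id det =
    (a * x + b) * proj₁ D⁻¹ , divide (a * x + b) (c * x + d) (proj₁ D⁻¹) (proj₂ D⁻¹)
    where
    D⁻¹ = inverse (c * x + d) (denominator-nonzero (degree4⇒∉F d4) ic id det)
    divide : ∀ n d u → d * u ≈ 1# → n * u * d ≈ n
    divide n d u e = combine₁ n e (solve 3 (λ n d u → n :* u :* d :- n := n :* (d :* u :- :1)) refl n d u)

  -- If φ² fixed y, the distinct elements x and φ²(x) would have the same image. Subtracting the two
  -- equations gives yc = a, hence yd = b, and the determinant vanishes.
  degree4-⟶ : ∀ {x y} → x ⟶ y → Degree4 x → Degree4 y
  degree4-⟶ {x} {y} M@(möbius {a} {b} {c} {d} ia ib ic id det e) d4 φ²y≈y =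
    det (combine₂ (- d) c yc≈a yd≈b (solve 5 (λ a b c d y →
      (a :* d :- b :* c) :- :0
        := :- d :* (y :* c :- a) :+ c :* (y :* d :- b)) refl a b c d y))
    where
    e″ : y * (c * φ (φ x) + d) ≈ a * φ (φ x) + b
    e″ = trans (*-congʳ (sym φ²y≈y)) (_⟶_.image (⟶-φ (⟶-φ M)))
    difference : ∀ u → y * (c * u + d) ≈ a * u + b → (u + - x) * (y * c + - a) ≈ 0#
    difference u e′ = combine₂ 1# (- 1#) e′ e
      (solve 7 (λ a b c d x y u →
        (u :- x) :* (y :* c :- a) :- :0
          := :1 :* (y :* (c :* u :+ d) :- (a :* u :+ b)) :+ :- :1 :* (y :* (c :* x :+ d) :- (a :* x :+ b))) refl a b c d x y u)
    yc≈a : y * c ≈ a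
    yc≈a = x-y≈0⇒x≈y (zero-factor (λ z → d4 (x-y≈0⇒x≈y z)) (difference (φ (φ x)) e″))
    yd≈b : y * d ≈ b
    yd≈b = combine₂ 1# (- x) e yc≈a (solve 6 (λ a b c d x y →
      y :* d :- b
        := :1 :* (y :* (c :* x :+ d) :- (a :* x :+ b)) :+ :- x :* (y :* c :- a)) refl a b c d x y)

  module Substitution (a b c d f₀ f₁ f₂ f₃ f₄ : Carrier) where
    f : Poly
    f = f₀ ∷ f₁ ∷ f₂ ∷ f₃ ∷ f₄ ∷ []

    L₁ L₂ : Poly
    L₁ = (- b) ∷ d ∷ []
    L₂ = a ∷ (- c) ∷ []

    term : ℕ → ℕ → Carrier → Poly
    term i j r = scale r (mulP (powP L₁ i) (powP L₂ j))

    eval-term : ∀ i j r x {l₁ l₂} → eval L₁ x ≈ l₁ → eval L₂ x ≈ l₂ → eval (term i j r) x ≈ r * (pow l₁ i * pow l₂ j)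
    eval-term i j r x e₁ e₂ = trans (eval-scale r (mulP (powP L₁ i) (powP L₂ j)) x) (*-congˡ
      (trans (eval-mulP (powP L₁ i) (powP L₂ j) x) (*-cong
        (trans (eval-powP L₁ i x) (pow-cong i e₁)) (trans (eval-powP L₂ j x) (pow-cong j e₂)))))

    eval-addP′ : ∀ f g x {u v} → eval f x ≈ u → eval g x ≈ v → eval (addP f g) x ≈ u + v
    eval-addP′ f g x e₁ e₂ = trans (eval-addP f g x) (+-cong e₁ e₂)

    -- Homogeneity: the i-th term becomes fᵢ (z l)^i l^(4-i), so l⁴ can be taken out.
    eval-substP : ∀ x z l → eval L₁ x ≈ z * l → eval L₂ x ≈ l → eval (substP a b c d f) x ≈ pow l 4 * eval f z
    eval-substP x z l e₁ e₂ = trans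
      (eval-addP′ (term 0 4 f₀) tail₁ x (eval-term 0 4 f₀ x e₁ e₂)
      (eval-addP′ (term 1 3 f₁) tail₂ x (eval-term 1 3 f₁ x e₁ e₂)
      (eval-addP′ (term 2 2 f₂) tail₃ x (eval-term 2 2 f₂ x e₁ e₂)
      (eval-addP′ (term 3 1 f₃) tail₄ x (eval-term 3 1 f₃ x e₁ e₂)
      (eval-addP′ (term 4 0 f₄) [] x (eval-term 4 0 f₄ x e₁ e₂) refl)))))
      (solve 7 (λ f₀ f₁ f₂ f₃ f₄ z l →
        f₀ :* (:1 :* (l :* (l :* (l :* (l :* :1))))) :+ (f₁ :* (((z :* l) :* :1) :* (l :* (l :* (l :* :1)))) :+
          (f₂ :* (((z :* l) :* ((z :* l) :* :1)) :* (l :* (l :* :1))) :+ (f₃ :* (((z :* l) :* ((z :* l) :* ((z :*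
          l) :* :1))) :* (l :* :1)) :+ (f₄ :* (((z :* l) :* ((z :* l) :* ((z :* l) :* ((z :* l) :* :1)))) :* :1)
          :+ :0))))
          := (l :* (l :* (l :* (l :* :1)))) :* (f₀ :+ z :* (f₁ :+ z :* (f₂ :+ z :* (f₃ :+ z :* (f₄ :+ z :* :0)))))) refl f₀ f₁ f₂ f₃ f₄ z l)

      where
      tail₄ = addP (term 4 0 f₄) []
      tail₃ = addP (term 3 1 f₃) tail₄
      tail₂ = addP (term 2 2 f₂) tail₃
      tail₁ = addP (term 1 3 f₁) tail₂

    substP-In : In a → In b → In c → In d → CoeffsIn q f → CoeffsIn q (substP a b c d f)
    substP-In ia ib ic id (i₀ ∷ i₁ ∷ i₂ ∷ i₃ ∷ i₄ ∷ []) =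
      In-addP (term-In 0 4 i₀) (In-addP (term-In 1 3 i₁) (In-addP (term-In 2 2 i₂)
        (In-addP (term-In 3 1 i₃) (In-addP (term-In 4 0 i₄) []))))
      where
      term-In : ∀ i j {r} → In r → CoeffsIn q (term i j r)
      term-In i j ir = In-scale ir (In-mulP (In-powP i (In-neg ib ∷ id ∷ [])) (In-powP j (ia ∷ In-neg ic ∷ [])))

    eval-L₁ : ∀ {x z} → x * (c * z + d) ≈ a * z + b → eval L₁ x ≈ z * eval L₂ x
    eval-L₁ {x} {z} e = combine₁ 1# e
      (solve 6 (λ a b c d x z →
        (:- b :+ x :* (d :+ x :* :0)) :- z :* (a :+ x :* (:- c :+ x :* :0))
          := :1 :* (x :* (c :* z :+ d) :- (a :* z :+ b))) refl a b c d x z)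

    substP-root : ∀ {x z} → x * (c * z + d) ≈ a * z + b → eval f z ≈ 0# → eval (substP a b c d f) x ≈ 0#
    substP-root {x} {z} e root = trans (eval-substP x z (eval L₂ x) (eval-L₁ e) refl) (trans (*-congˡ root) (zeroʳ _))

    -- The form L₂ takes the value a at 0, and if a = 0 the value -c at 1, nonzero by the
    -- determinant. At such a point the substituted polynomial is L₂⁴ f(z) with z in F_q.
    substP-nonvanishing : In a → In b → In c → In d → ¬ a * d + - (b * c) ≈ 0# →
      (∀ z → In z → ¬ eval f z ≈ 0#) → ¬ (∀ x → eval (substP a b c d f) x ≈ 0#)
    substP-nonvanishing ia ib ic id det no-root vanishes = decide (a ≟ 0#)
      where
      at : ∀ x → In x → ¬ eval L₂ x ≈ 0# → _
      at x ix l≉0 = no-root (eval L₁ x * proj₁ l⁻¹) z-In (zero-factor (pow-nonzero 4 l≉0)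
        (trans (sym (eval-substP x (eval L₁ x * proj₁ l⁻¹) (eval L₂ x) (lemma (proj₂ l⁻¹)) refl)) (vanishes x)))
        where
        l⁻¹ = inverse (eval L₂ x) l≉0
        lemma : ∀ {m l u} → l * u ≈ 1# → m ≈ m * u * l
        lemma {m} {l} {u} e = combine₁ (- m) e (solve 3 (λ m l u →
          m :- m :* u :* l
            := :- m :* (l :* u :- :1)) refl m l u)
        In-eval : ∀ {r s} → In r → In s → In (r + x * (s + x * 0#))
        In-eval ir is = In-+ ir (In-* ix (In-+ is (In-* ix In-0)))
        z-In : In (eval L₁ x * proj₁ l⁻¹)
        z-In = In-* (In-eval (In-neg ib) id) (In-inverse (In-eval ia (In-neg ic)) (proj₂ l⁻¹))
      decide : Dec (a ≈ 0#) → _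
      decide (no a≉0) = at 0# In-0 (λ e → a≉0 (trans (solve 2 (λ a c → a := a :+ :0 :* (:- c :+ :0 :* :0)) refl a c) e))
      decide (yes a≈0) = at 1# In-1 (λ e → det (combine₂ (d + - b) b a≈0 e
        (solve 4 (λ a b c d →
          (a :* d :- b :* c) :- :0
            := (d :- b) :* (a :- :0) :+ b :* ((a :+ :1 :* (:- c :+ :1 :* :0)) :- :0)) refl a b c d)))

  degree4-conjugate : ∀ {s x} → Degree4 s → eval (minPoly s) x ≈ 0# → Degree4 x
  degree4-conjugate {s} {x} d e = [ resp d , [ resp (degree4-φ d) , [ resp (degree4-φ (degree4-φ d)) ,
      resp (degree4-φ (degree4-φ (degree4-φ d))) ]′ ]′ ]′ (conjugate-factors e)
    where
    resp : ∀ {t} → Degree4 t → x ≈ t → Degree4 x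
    resp d x≈t e = d (trans (φ-cong (φ-cong (sym x≈t))) (trans e x≈t))

  -- The substituted polynomial has coefficients in F_q and the root `y` of degree four, so it is a
  -- multiple r of `minPoly y`. It does not vanish identically, since all roots of `f` have degree
  -- four and none lies in F_q; hence r is nonzero.
  ⟶⇒SameOrbit : ∀ {f α y} → CoeffsIn q f → length f ≡ 5 → Monic f → eval f α ≈ 0# → Degree4 α → α ⟶ y → SameOrbit q f (minPoly y)
  ⟶⇒SameOrbit {f@(f₀ ∷ f₁ ∷ f₂ ∷ f₃ ∷ f₄ ∷ [])} {α} {y} is ≡.refl monic root d4
    M@(möbius {a} {b} {c} {d} ia ib ic id det e) = finish multiple
    where
    open Substitution a b c d f₀ f₁ f₂ f₃ f₄ hiding (f)
    Multiple : Set _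
    Multiple = ∃[ r ] (In r × substP a b c d f ≋ scale r (minPoly y))
    multiple : Multiple
    multiple = find (substP a b c d f) ≡.refl (substP-In ia ib ic id is) (substP-root e root)
      where
      find : ∀ g → length g ≡ 5 → CoeffsIn q g → eval g y ≈ 0# → ∃[ r ] (In r × g ≋ scale r (minPoly y))
      find (g₀ ∷ g₁ ∷ g₂ ∷ g₃ ∷ g₄ ∷ []) ≡.refl js@(_ ∷ _ ∷ _ ∷ _ ∷ j₄ ∷ []) e = g₄ , j₄ ,
        proportional-to-minPoly (degree4-⟶ M d4) js e
    no-root : ∀ z → In z → ¬ eval f z ≈ 0#
    no-root z iz fz≈0 = degree4⇒∉F (degree4-conjugate d4
      (trans (eval-cong z (≋-sym (monic-quartic≋minPoly f d4 is ≡.refl monic root))) fz≈0)) iz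
    scale-inverse : ∀ {r u} g → r * u ≈ 1# → g ≋ scale u (scale r g)
    scale-inverse [] _ = []
    scale-inverse {r} {u} (x ∷ g) ru≈1 = combine₁ (- x) ru≈1 (solve 3 (λ r u x →
      x :- u :* (r :* x)
        := :- x :* (r :* u :- :1)) refl r u x) ∷ scale-inverse g ru≈1
    scale-cong : ∀ {u g g′} → g ≋ g′ → scale u g ≋ scale u g′
    scale-cong [] = []
    scale-cong (e ∷ es) = *-congˡ e ∷ scale-cong es
    finish : Multiple → SameOrbit q f (minPoly y)
    finish (r , ir , eq) = a , b , c , d , u , ia , ib , ic , id , In-inverse ir ru≈1 , det ,
      unit⇒nonzero (trans (*-comm u r) ru≈1) , refl ,
      ≋-trans (scale-inverse (minPoly y) ru≈1) (scale-cong (≋-sym eq))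
      where
      r≉0 : ¬ r ≈ 0#
      r≉0 r≈0 = substP-nonvanishing ia ib ic id det no-root (λ x →
        trans (eval-cong x eq) (trans (eval-scale r (minPoly y) x) (trans (*-congʳ r≈0) (zeroˡ _))))
      u = proj₁ (inverse r r≉0)
      ru≈1 = proj₂ (inverse r r≉0)

  -- The image `y` is only known to be a conjugate of `t`, so whatever separates orbits must also be
  -- controlled under φ.
  SameOrbit⇒⟶ : ∀ {f g s t} → Degree4 s → f ≋ minPoly s → g ≋ minPoly t → SameOrbit q f g →
                ∃[ y ] (s ⟶ y × eval (minPoly t) y ≈ 0#)
  SameOrbit⇒⟶ {f₀ ∷ f₁ ∷ f₂ ∷ f₃ ∷ f₄ ∷ []} {g} {s} {t} d4 f≋@(_ ∷ _ ∷ _ ∷ _ ∷ _ ∷ []) g≋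
    (a , b , c , d , r , ia , ib , ic , id , _ , det , _ , _ , g≋r) = y , möbius ia ib ic id det image , root
    where
    open Substitution a b c d f₀ f₁ f₂ f₃ f₄
    preimage = möbius-image d4 ia ib ic id det
    y = proj₁ preimage
    image = proj₂ preimage
    root : eval (minPoly t) y ≈ 0#
    root = trans (eval-cong y (≋-trans (≋-sym g≋) g≋r)) (trans (eval-scale r (substP a b c d f) y)
      (trans (*-congˡ (substP-root image (trans (eval-cong s f≋) (minPoly-root s)))) (zeroʳ r)))

  -- Cayley parameters and the centraliser of the involution.

  Antifixed : Carrier → Set ℓ
  Antifixed β = φ (φ β) ≈ - β

  antifixed-φ : ∀ {β} → Antifixed β → Antifixed (φ β)
  antifixed-φ anti = trans (φ-cong anti) (φ-neg _)

  antifixed-inverse : ∀ {β β′} → β * β′ ≈ 1# → Antifixed β → Antifixed β′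
  antifixed-inverse {β} {β′} e anti = *-cancelˡ (unit⇒nonzero e) (begin
    β * φ (φ β′) ≈⟨ (solve 2 (λ x y → x :* y := :- (:- x :* y)) refl β (φ (φ β′))) ⟩
    - (- β * φ (φ β′)) ≈⟨ -‿cong (trans (*-congʳ (sym anti)) (φ-inverse (φ-inverse e))) ⟩
    - 1# ≈⟨ -‿cong (sym e) ⟩
    - (β * β′) ≈⟨ (solve 2 (λ β β′ → :- (β :* β′) := β :* :- β′) refl β β′) ⟩
    β * - β′ ∎)

  -- β = ± 1 would be fixed by φ², hence β = - β.
  antifixed-β²≉1 : ∀ {β} → Antifixed β → ¬ β ≈ 0# → ¬ (β + - 1#) * (β + 1#) ≈ 0#
  antifixed-β²≉1 {β} anti β≉0 e = [ impossible In-1 , impossible (In-neg In-1) ]′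
    (Sum.map x-y≈0⇒x≈y (λ z → combine₁ 1# z (solve 1 (λ β → β :- (:- :1) := :1 :* ((β :+ :1) :- :0)) refl β)) (*-zero-product e))
    where
    impossible : ∀ {x} → In x → ¬ β ≈ x
    impossible {x} x-In β≈x = β≉0 (x+x≈0⇒x≈0 (combine₁ 1# (trans (sym (φ²-fixed)) anti)
      (solve 1 (λ β → (β :+ β) :- :0 := :1 :* (β :- (:- β))) refl β)))
      where
      φ²-fixed : φ (φ β) ≈ β
      φ²-fixed = trans (φ-cong (In-resp (sym β≈x) x-In)) (In-resp (sym β≈x) x-In)

  record Rep (η y β : Carrier) : Set ℓ where
    constructor rep
    field
      cayley : y * (β + 1#) ≈ η * (β + - 1#)
      antifixed : Antifixed β
      nonzero : ¬ β ≈ 0#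

  module _ {η : Carrier} (η≉0 : ¬ η ≈ 0#) (η²-In : In (η * η)) (φ²η : φ (φ η) ≈ η) where

    -- φ² negates β and fixes η, so φ²(y) = η (β + 1)/(β - 1), which is η²/y.
    rep-conjugate : ∀ {y β} → Rep η y β → φ (φ y) * (β + - 1#) ≈ η * (β + 1#)
    rep-conjugate {y} {β} (rep e anti _) = combine₁ (- 1#) twice
      (lemma (φ (φ y)))
      where
      lemma : ∀ z → z * (β + - 1#) + - (η * (β + 1#)) ≈ - 1# * (z * (- β + 1#) + - (η * (- β + - 1#)))
      lemma z = solve 3 (λ z η β →
        z :* (β :- :1) :- (η :* (β :+ :1))
          := :- :1 :* (z :* (:- β :+ :1) :- (η :* (:- β :- :1)))) refl z η β
      φ²-+ : ∀ x y → φ (φ (x + y)) ≈ φ (φ x) + φ (φ y)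
      φ²-+ x y = trans (φ-cong (φ-+ x y)) (φ-+ _ _)
      φ²-* : ∀ x y → φ (φ (x * y)) ≈ φ (φ x) * φ (φ y)
      φ²-* x y = trans (φ-cong (φ-* x y)) (φ-* _ _)
      φ²-fixed : ∀ {x} → In x → φ (φ x) ≈ x
      φ²-fixed i = trans (φ-cong i) i
      twice : φ (φ y) * (- β + 1#) ≈ η * (- β + - 1#)
      twice = begin
        φ (φ y) * (- β + 1#) ≈⟨ *-congˡ (trans (φ²-+ β 1#) (+-cong anti (φ²-fixed In-1))) ⟨
        φ (φ y) * φ (φ (β + 1#)) ≈⟨ φ²-* y (β + 1#) ⟨
        φ (φ (y * (β + 1#))) ≈⟨ φ-cong (φ-cong e) ⟩
        φ (φ (η * (β + - 1#))) ≈⟨ φ²-* η (β + - 1#) ⟩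
        φ (φ η) * φ (φ (β + - 1#)) ≈⟨ *-cong φ²η (trans (φ²-+ β (- 1#)) (+-cong anti (φ²-fixed (In-neg In-1)))) ⟩
        η * (- β + - 1#) ∎

    rep-norm : ∀ {y β} → Rep η y β → y * φ (φ y) ≈ η * η
    rep-norm {y} {β} r@(rep e anti β≉0) = *-cancelˡ (antifixed-β²≉1 anti β≉0) (lemma (φ (φ y)) (rep-conjugate r))
      where
      lemma : ∀ z → z * (β + - 1#) ≈ η * (β + 1#) → (β + - 1#) * (β + 1#) * (y * z) ≈ (β + - 1#) * (β + 1#) * (η * η)
      lemma z e′ = combine₂ (z * (β + - 1#)) (η * (β + - 1#)) e e′
        (solve 4 (λ y z η β →
          (β :- :1) :* (β :+ :1) :* (y :* z) :- (β :- :1) :* (β :+ :1) :* (η :* η)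
            := z :* (β :- :1) :* (y :* (β :+ :1) :- η :* (β :- :1)) :+ η :* (β :- :1) :* (z :* (β :- :1) :- η :* (β
            :+ :1))) refl y z η β)

    -- φ²(y) = y would force y² = η², but η and -η are the values of the Cayley transform at
    -- infinity and at 0.
    rep-degree4 : ∀ {y β} → Rep η y β → Degree4 y
    rep-degree4 {y} {β} r@(rep e anti β≉0) φ²y≈y =
      [ (λ y≈η → η≉0 (x+x≈0⇒x≈0 (combine₂ 1# (- (β + 1#)) e y≈η
          (solve 3 (λ y η β →
            (η :+ η) :- :0
              := :1 :* (y :* (β :+ :1) :- η :* (β :- :1)) :+ :- (β :+ :1) :* (y :- η)) refl y η β))))
      , (λ y≈-η → *-nonzero η≉0 β≉0 (x+x≈0⇒x≈0 (combine₂ (- 1#) (β + 1#) e y≈-η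
          (solve 3 (λ y η β →
            (η :* β :+ η :* β) :- :0
              := :- :1 :* (y :* (β :+ :1) :- η :* (β :- :1)) :+ (β :+ :1) :* (y :- (:- η))) refl y η β))))
      ]′ (square-equal (trans (*-congˡ (sym φ²y≈y)) (rep-norm r)))

    -- The inverse Cayley transform β = (η + y)/(η - y), defined because `y`, unlike η and -η, is
    -- not fixed by φ². Substituting φ²(y) = η²/y negates it.
    norm⇒rep : ∀ {y} → Degree4 y → y * φ (φ y) ≈ η * η → ∃[ β ] Rep η y β
    norm⇒rep {y} d4 norm = β , rep
      (combine₁ (- (η + y)) ue≈1 (identity u)) anti
      (*-nonzero η+y≉0 (unit⇒nonzero (trans (*-comm u (η + - y)) ue≈1)))
      where
      y≉ : ∀ {z} → φ (φ z) ≈ z → ¬ y ≈ z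
      y≉ fixed y≈z = d4 (trans (φ-cong (φ-cong y≈z)) (trans fixed (sym y≈z)))
      η-y≉0 : ¬ η + - y ≈ 0#
      η-y≉0 z = y≉ φ²η (sym (x-y≈0⇒x≈y z))
      η+y≉0 : ¬ η + y ≈ 0#
      η+y≉0 z = y≉ { - η } (trans (φ-cong (φ-neg η)) (trans (φ-neg _) (-‿cong φ²η)))
        (combine₁ 1# z (solve 2 (λ y η → y :- (:- η) := :1 :* ((η :+ y) :- :0)) refl y η))
      u = proj₁ (inverse (η + - y) η-y≉0)
      ue≈1 : (η + - y) * u ≈ 1#
      ue≈1 = proj₂ (inverse (η + - y) η-y≉0)
      β = (η + y) * u
      identity : ∀ u → y * ((η + y) * u + 1#) + - (η * ((η + y) * u + - 1#)) ≈ - (η + y) * ((η + - y) * u + - 1#)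
      identity u = solve 3 (λ y η u →
        y :* ((η :+ y) :* u :+ :1) :- (η :* ((η :+ y) :* u :- :1))
          := :- (η :+ y) :* ((η :- y) :* u :- :1)) refl y η u
      anti : Antifixed β
      anti = conclude (φ (φ u)) (φ (φ y)) norm ue≈1 φ²u
        (trans (φ-cong (φ-* (η + y) u)) (trans (φ-* _ _) (*-congʳ (trans (φ-cong (φ-+ η y)) (trans (φ-+ _ _) (+-congʳ φ²η))))))
        where
        φ²u : (η + - φ (φ y)) * φ (φ u) ≈ 1#
        φ²u = trans (*-congʳ (sym (trans (φ-cong (trans (φ-+ η (- y)) (+-congˡ (φ-neg y))))
          (trans (φ-+ _ _) (+-cong φ²η (φ-neg _)))))) (φ-inverse (φ-inverse ue≈1))
        conclude : ∀ {w} u″ z → y * z ≈ η * η → (η + - y) * u ≈ 1# → (η + - z) * u″ ≈ 1# → w ≈ (η + z) * u″ → w ≈ - ((η + y) * u)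
        conclude u″ z yz uy uz w≈ = trans w≈ (*-cancelˡ (degree4-nonzero d4) (final u u″ z yz (step u u″ z yz uy uz)))
          where
          -- For z = η²/y this is 1/(η - z) = -y/(η (η - y)).
          step : ∀ u u″ z → y * z ≈ η * η → (η + - y) * u ≈ 1# → (η + - z) * u″ ≈ 1# → - η * u″ ≈ y * u
          step u u″ z yz uy uz = combine₃ (u * u″) (η * u″) (y * u) yz uy uz
            (solve 5 (λ y η u u″ z →
              :- η :* u″ :- y :* u
                := u :* u″ :* (y :* z :- η :* η) :+ (η :* u″ :* ((η :- y) :* u :- :1) :+ y :* u :* ((η :- z) :* u″ :-
                :1))) refl y η u u″ z)
          final : ∀ u u″ z → y * z ≈ η * η → - η * u″ ≈ y * u → y * ((η + z) * u″) ≈ y * - ((η + y) * u)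
          final u u″ z yz k = combine₂ u″ (- (η + y)) yz k
            (solve 5 (λ y η u u″ z →
              y :* ((η :+ z) :* u″) :- y :* :- ((η :+ y) :* u)
                := u″ :* (y :* z :- η :* η) :+ :- (η :+ y) :* (:- η :* u″ :- y :* u)) refl y η u u″ z)

    -- Under the Cayley transform, inverting β is negating y, a Möbius map over F_q.
    rep-inverse : ∀ {y β β′} → Rep η y β → β * β′ ≈ 1# → Rep η (- y) β′ × y ⟶ (- y)
    rep-inverse {y} {β} {β′} (rep e anti β≉0) ββ′≈1 =
      rep (combine₂ (- β′) (y + - η) e ββ′≈1
            (solve 4 (λ y η β β′ →
              :- y :* (β′ :+ :1) :- η :* (β′ :- :1)
                := :- β′ :* (y :* (β :+ :1) :- η :* (β :- :1)) :+ (y :- η) :* (β :* β′ :- :1)) refl y η β β′))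
        (antifixed-inverse ββ′≈1 anti) (unit⇒nonzero (trans (*-comm β′ β) ββ′≈1)) ,
      möbius (In-neg In-1) In-0 In-0 In-1 (λ z → 1≉0 (combine₁ (- 1#) z (solve 0 (
        :1 :- :0
          := :- :1 :* ((:- :1 :* :1 :- :0 :* :0) :- :0)) refl)))
        (solve 1 (λ y → :- y :* (:0 :* y :+ :1) := :- :1 :* y :+ :0) refl y)

    -- On the Cayley parameter, the centraliser of x ↦ η²/x acts by β ↦ (v/w) β.
    rep-multiply : ∀ {y β β′ v w} → Rep η y β → Antifixed β′ → ¬ v ≈ 0# → ¬ w ≈ 0# → In (v + w) → In (η * (v + - w)) →
                   w * β′ ≈ v * β → ∃[ y′ ] (y ⟶ y′ × Rep η y′ β′)
    rep-multiply {y} {β} {β′} {v} {w} r@(rep e anti β≉0) anti′ v≉0 w≉0 v+w-In η[v-w]-In wβ′≈vβ =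
      y′ , möbius v+w-In η[v-w]-In c-In v+w-In det image , rep cayley′ anti′ β′≉0
      where
      k = proj₁ (inverse (η * η) (*-nonzero η≉0 η≉0))
      ηηk≈1 : η * η * k ≈ 1#
      ηηk≈1 = proj₂ (inverse (η * η) (*-nonzero η≉0 η≉0))
      -- The matrix has v + w on the diagonal and η(v - w), (v - w)/η off it; its determinant is
      -- 4vw. Writing 1/η as η k makes `c` visibly an element of F_q.
      c = η * (v + - w) * k
      c-In : In c
      c-In = In-* η[v-w]-In (In-inverse η²-In ηηk≈1)
      det : ¬ (v + w) * (v + w) + - (η * (v + - w) * c) ≈ 0#
      det z = *-nonzero v≉0 w≉0 (x+x≈0⇒x≈0 (x+x≈0⇒x≈0 (four k ηηk≈1 z)))
        where
        four : ∀ k → η * η * k ≈ 1# → (v + w) * (v + w) + - (η * (v + - w) * (η * (v + - w) * k)) ≈ 0# →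
               (v * w + v * w) + (v * w + v * w) ≈ 0#
        four k ηηk z = combine₂ 1# ((v + - w) * (v + - w)) z ηηk
          (solve 4 (λ v w η k →
            ((v :* w :+ v :* w) :+ (v :* w :+ v :* w)) :- :0
              := :1 :* (((v :+ w) :* (v :+ w) :- (η :* (v :- w) :* (η :* (v :- w) :* k))) :- :0) :+ (v :- w) :* (v :-
              w) :* (η :* η :* k :- :1)) refl v w η k)
      moved = möbius-image (rep-degree4 r) v+w-In η[v-w]-In c-In v+w-In det
      y′ = proj₁ moved
      image = proj₂ moved
      β′≉0 : ¬ β′ ≈ 0#
      β′≉0 β′≈0 = *-nonzero v≉0 β≉0 (trans (sym wβ′≈vβ) (trans (*-congˡ β′≈0) (zeroʳ w)))
      cayley′ : y′ * (β′ + 1#) ≈ η * (β′ + - 1#)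
      cayley′ = *-cancelˡ w≉0 (x-y≈0⇒x≈y (x+x≈0⇒x≈0 (doubled y′ c image
        (combine₁ (v + - w) ηηk≈1 (scaled k)))))
        where
        scaled : ∀ k → η * (η * (v + - w) * k) + - (v + - w) ≈ (v + - w) * (η * η * k + - 1#)
        scaled k = solve 4 (λ η v w k →
          η :* (η :* (v :- w) :* k) :- (v :- w)
            := (v :- w) :* (η :* η :* k :- :1)) refl η v w k
        -- (β + 1)((v + w) y + η (v - w)) = 2 η (v β - w)  and  (β + 1)(c y + v + w) = 2 (v β + w)
        doubled : ∀ y′ c → y′ * (c * y + (v + w)) ≈ (v + w) * y + η * (v + - w) → η * c ≈ v + - w →
          (w * (y′ * (β′ + 1#)) + - (w * (η * (β′ + - 1#)))) + (w * (y′ * (β′ + 1#)) + - (w * (η * (β′ + - 1#)))) ≈ 0#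
        doubled y′ c image ηc = begin
          (w * (y′ * (β′ + 1#)) + - (w * (η * (β′ + - 1#)))) + (w * (y′ * (β′ + 1#)) + - (w * (η * (β′ + - 1#))))
            ≈⟨ (solve 4 (λ w y′ β′ η →
              (w :* (y′ :* (β′ :+ :1)) :- (w :* (η :* (β′ :- :1)))) :+ (w :* (y′ :* (β′ :+ :1)) :- (w :* (η :*
                (β′ :- :1))))
                := y′ :* ((w :* β′ :+ w) :+ (w :* β′ :+ w)) :- η :* ((w :* β′ :- w) :+ (w :* β′ :- w))) refl w y′ β′ η) ⟩
          y′ * ((w * β′ + w) + (w * β′ + w)) + - (η * ((w * β′ + - w) + (w * β′ + - w)))
            ≈⟨ +-cong (*-congˡ (+-cong (+-congʳ wβ′≈vβ) (+-congʳ wβ′≈vβ)))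
                      (-‿cong (*-congˡ (+-cong (+-congʳ wβ′≈vβ) (+-congʳ wβ′≈vβ)))) ⟩
          y′ * ((v * β + w) + (v * β + w)) + - (η * ((v * β + - w) + (v * β + - w)))
            ≈⟨ +-cong (*-congˡ (sym (bottom c ηc))) (-‿cong (sym top)) ⟩
          y′ * ((β + 1#) * (c * y + (v + w))) + - ((β + 1#) * ((v + w) * y + η * (v + - w)))
            ≈⟨ factor y′ (c * y + (v + w)) ((v + w) * y + η * (v + - w)) image ⟩
          0# ∎
          where
          top : (β + 1#) * ((v + w) * y + η * (v + - w)) ≈ η * ((v * β + - w) + (v * β + - w))
          top = combine₁ (v + w) e (solve 5 (λ v w y η β →
            (β :+ :1) :* ((v :+ w) :* y :+ η :* (v :- w)) :- η :* ((v :* β :- w) :+ (v :* β :- w))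
              := (v :+ w) :* (y :* (β :+ :1) :- η :* (β :- :1))) refl v w y η β)
          bottom : ∀ c → η * c ≈ v + - w → (β + 1#) * (c * y + (v + w)) ≈ (v * β + w) + (v * β + w)
          bottom c ηc = combine₂ c (β + - 1#) e ηc
            (solve 6 (λ v w y η β c →
              (β :+ :1) :* (c :* y :+ (v :+ w)) :- ((v :* β :+ w) :+ (v :* β :+ w))
                := c :* (y :* (β :+ :1) :- η :* (β :- :1)) :+ (β :- :1) :* (η :* c :- (v :- w))) refl v w y η β c)
          factor : ∀ y′ d n → y′ * d ≈ n → y′ * ((β + 1#) * d) + - ((β + 1#) * n) ≈ 0#
          factor y′ d n e = combine₁ (β + 1#) e (solve 4 (λ y′ d n β →
            (y′ :* ((β :+ :1) :* d) :- ((β :+ :1) :* n)) :- :0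
              := (β :+ :1) :* (y′ :* d :- n)) refl y′ d n β)

  -- s has degree 4 over F_q, so the quadratic relation satisfied by s is trivial.
  norm-coefficients : ∀ {s t δ δ′} (M : s ⟶ t) → Degree4 s → In δ → In δ′ → s * φ (φ s) ≈ δ → t * φ (φ t) ≈ δ′ →
    let open _⟶_ M in a * b ≈ δ′ * (c * d) × a * a * δ + b * b ≈ δ′ * (c * c * δ + d * d)
  norm-coefficients {s} {t} {δ} {δ′} M@(möbius {a} {b} {c} {d} ia ib ic id det e) d4 iδ iδ′ sN tN =
    x-y≈0⇒x≈y (All.head (All.tail (All.tail zeros))) , x-y≈0⇒x≈y (All.head (All.tail zeros))
    where
    ab-In : In (a * b + - (δ′ * (c * d)))
    ab-In = In-+ (In-* ia ib) (In-neg (In-* iδ′ (In-* ic id)))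
    -- Multiplying the equation for t by its image under φ² and clearing φ²(s) = δ/s gives (as +
    -- b)(aδ + bs) = δ′ (cs + d)(cδ + ds). These are the coefficients of the difference in powers of
    -- s.
    g : Poly
    g = (a * b + - (δ′ * (c * d))) * δ ∷ (a * a * δ + b * b) + - (δ′ * (c * c * δ + d * d)) ∷ a * b + - (δ′ * (c * d)) ∷ []
    g-In : CoeffsIn q g
    g-In = In-* ab-In iδ ∷ In-+ (In-+ (In-* (In-* ia ia) iδ) (In-* ib ib))
      (In-neg (In-* iδ′ (In-+ (In-* (In-* ic ic) iδ) (In-* id id)))) ∷ ab-In ∷ []
    reduced : ∀ s″ t″ → s * s″ ≈ δ → t″ * (c * s″ + d) ≈ a * s″ + b → t″ * (c * δ + d * s) ≈ a * δ + b * s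
    reduced s″ t″ sN e″ = combine₂ s (a + - (t″ * c)) e″ sN
      (solve 8 (λ a b c d s s″ t″ δ →
        t″ :* (c :* δ :+ d :* s) :- (a :* δ :+ b :* s)
          := s :* (t″ :* (c :* s″ :+ d) :- (a :* s″ :+ b)) :+ (a :- t″ :* c) :* (s :* s″ :- δ)) refl a b c d s s″ t″ δ)
    product : ∀ t″ P Q U V → t * P ≈ U → t″ * Q ≈ V → t * t″ ≈ δ′ → U * V + - (δ′ * (P * Q)) ≈ 0#
    product t″ P Q U V e₁ e₂ e₃ = combine₃ (- V) (- (t * P)) (P * Q) e₁ e₂ e₃
      (solve 7 (λ t t″ P Q U V δ′ →
        (U :* V :- (δ′ :* (P :* Q))) :- :0
          := :- V :* (t :* P :- U) :+ (:- (t :* P) :* (t″ :* Q :- V) :+ P :* Q :* (t :* t″ :- δ′))) refl t t″ P Q U V δ′)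
    root : eval g s ≈ 0#
    root = trans
      (solve 7 (λ a b c d s δ δ′ →
        (a :* b :- (δ′ :* (c :* d))) :* δ :+ s :* (((a :* a :* δ :+ b :* b) :- (δ′ :* (c :* c :* δ :+ d :* d)))
          :+ s :* ((a :* b :- (δ′ :* (c :* d))) :+ s :* :0))
          := (a :* s :+ b) :* (a :* δ :+ b :* s) :- (δ′ :* ((c :* s :+ d) :* (c :* δ :+ d :* s)))) refl a b c d s δ δ′)
      (product (φ (φ t)) (c * s + d) (c * δ + d * s) (a * s + b) (a * δ + b * s) e
        (reduced (φ (φ s)) (φ (φ t)) sN (_⟶_.image (⟶-φ (⟶-φ M)))) tN)
    zeros : All (_≈ 0#) g
    zeros = zero-poly₄ g d4 g-In root (s≤s (s≤s (s≤s z≤n)))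

  module _ {η : Carrier} (η≉0 : ¬ η ≈ 0#) (η²-In : In (η * η)) (φ²η : φ (φ η) ≈ η) where

    -- With P = aη + b and N = aη - b the alternatives are β′ = (P/N) β and β β′ = N/P: the action
    -- of the centraliser, with its multiplier given through elements of F_q.
    Conjugated : Carrier → Carrier → Set (κ ⊔ ℓ)
    Conjugated β β′ = ∃[ a ] ∃[ b ] (In a × In b × ¬ a * η + b ≈ 0# × ¬ a * η + - b ≈ 0# ×
      (β′ * (a * η + - b) ≈ (a * η + b) * β ⊎ β * β′ * (a * η + b) ≈ a * η + - b))

    -- `M` sends η to η P/P′ and -η to η N/N′, and `norm-coefficients` makes both ratios 1 or -1:
    -- `M` preserves the fixed points of the involution x ↦ η²/x. Equal signs contradict the
    -- determinant; each choice of opposite signs gives one alternative.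
    rep-conjugated : ∀ {s t β β′} → s ⟶ t → Rep η s β → Rep η t β′ → Conjugated β β′
    rep-conjugated {s} {t} {β} {β′} M@(möbius {a} {b} {c} {d} ia ib ic id det e) r@(rep es _ _) r′@(rep et _ _) =
      a , b , ia , ib , cases (square-equal plus) (square-equal minus)
      where
      P = a * η + b
      N = a * η + - b
      P′ = c * (η * η) + d * η
      N′ = c * (η * η) + - (d * η)
      coefficients = norm-coefficients M (rep-degree4 η≉0 η²-In φ²η r) η²-In η²-In
        (rep-norm η≉0 η²-In φ²η r) (rep-norm η≉0 η²-In φ²η r′)
      plus : P * P ≈ P′ * P′
      plus = combine₂ (η + η) 1# (proj₁ coefficients) (proj₂ coefficients)
        (solve 5 (λ a b c d η →
          (a :* η :+ b) :* (a :* η :+ b) :- (c :* (η :* η) :+ d :* η) :* (c :* (η :* η) :+ d :* η)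
            := (η :+ η) :* (a :* b :- η :* η :* (c :* d)) :+ :1 :* ((a :* a :* (η :* η) :+ b :* b) :- η :* η :* (c :*
            c :* (η :* η) :+ d :* d))) refl a b c d η)
      minus : N * N ≈ N′ * N′
      minus = combine₂ (- (η + η)) 1# (proj₁ coefficients) (proj₂ coefficients)
        (solve 5 (λ a b c d η →
          (a :* η :- b) :* (a :* η :- b) :- (c :* (η :* η) :- d :* η) :* (c :* (η :* η) :- d :* η)
            := :- (η :+ η) :* (a :* b :- η :* η :* (c :* d)) :+ :1 :* ((a :* a :* (η :* η) :+ b :* b) :- η :* η :* (c
            :* c :* (η :* η) :+ d :* d))) refl a b c d η)
      relation : (β′ + - 1#) * (P′ * β + - N′) ≈ (β′ + 1#) * (P * β + - N)
      relation = combine₃ ((β + 1#) * (β′ + 1#)) (- (c * (s * (β + 1#)) + d * (β + 1#))) ((β′ + 1#) * a + - (η * (β′ + - 1#) * c)) e et es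
        (solve 9 (λ a b c d s t η β β′ →
          (β′ :- :1) :* ((c :* (η :* η) :+ d :* η) :* β :- (c :* (η :* η) :- d :* η)) :- (β′ :+ :1) :* ((a :* η
            :+ b) :* β :- (a :* η :- b))
            := (β :+ :1) :* (β′ :+ :1) :* (t :* (c :* s :+ d) :- (a :* s :+ b)) :+ (:- (c :* (s :* (β :+ :1)) :+ d :*
            (β :+ :1)) :* (t :* (β′ :+ :1) :- η :* (β′ :- :1)) :+ ((β′ :+ :1) :* a :- η :* (β′ :- :1) :* c) :* (s
            :* (β :+ :1) :- η :* (β :- :1)))) refl a b c d s t η β β′)
      determinant : N * P′ + - (P * N′) ≈ (η * η) * (a * d + - (b * c)) + (η * η) * (a * d + - (b * c))
      determinant = solve 5 (λ a b c d η →
        (a :* η :- b) :* (c :* (η :* η) :+ d :* η) :- ((a :* η :+ b) :* (c :* (η :* η) :- d :* η))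
          := (η :* η) :* (a :* d :- b :* c) :+ (η :* η) :* (a :* d :- b :* c)) refl a b c d η
      nondegenerate : ¬ N * P′ + - (P * N′) ≈ 0#
      nondegenerate z = *-nonzero (*-nonzero η≉0 η≉0) det (x+x≈0⇒x≈0 (trans (sym determinant) z))
      cases : P ≈ P′ ⊎ P ≈ - P′ → N ≈ N′ ⊎ N ≈ - N′ →
        ¬ P ≈ 0# × ¬ N ≈ 0# × (β′ * N ≈ P * β ⊎ β * β′ * P ≈ N)
      cases = solveCases P N P′ N′ nondegenerate relation
        where
        solveCases : ∀ P N P′ N′ → ¬ N * P′ + - (P * N′) ≈ 0# → (β′ + - 1#) * (P′ * β + - N′) ≈ (β′ + 1#) * (P * β + - N) →
          P ≈ P′ ⊎ P ≈ - P′ → N ≈ N′ ⊎ N ≈ - N′ → ¬ P ≈ 0# × ¬ N ≈ 0# × (β′ * N ≈ P * β ⊎ β * β′ * P ≈ N)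
        solveCases P N P′ N′ nd rel (inj₁ p) (inj₁ n) = contradiction
          (combine₂ (- N) P p n (solve 4 (λ P N P′ N′ →
            (N :* P′ :- P :* N′) :- :0
              := :- N :* (P :- P′) :+ P :* (N :- N′)) refl P N P′ N′)) nd
        solveCases P N P′ N′ nd rel (inj₂ p) (inj₂ n) = contradiction
          (combine₂ N (- P) p n (solve 4 (λ P N P′ N′ →
            (N :* P′ :- P :* N′) :- :0
              := N :* (P :- (:- P′)) :+ :- P :* (N :- (:- N′))) refl P N P′ N′)) nd
        solveCases P N P′ N′ nd rel (inj₁ p) (inj₂ n) =
          (λ z → nd (combine₃ (N + N) (- N) (- P) z p n
            (solve 4 (λ P N P′ N′ →
              (N :* P′ :- P :* N′) :- :0
                := (N :+ N) :* (P :- :0) :+ (:- N :* (P :- P′) :+ :- P :* (N :- (:- N′)))) refl P N P′ N′))) ,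
          (λ z → nd (combine₃ (P + P) (- N) (- P) z p n
            (solve 4 (λ P N P′ N′ →
              (N :* P′ :- P :* N′) :- :0
                := (P :+ P) :* (N :- :0) :+ (:- N :* (P :- P′) :+ :- P :* (N :- (:- N′)))) refl P N P′ N′))) ,
          inj₁ (x-y≈0⇒x≈y (x+x≈0⇒x≈0 (combine₃ 1# ((β′ + - 1#) * β) (β′ + - 1#) rel p n
            (solve 6 (λ P N P′ N′ β β′ →
              ((β′ :* N :- P :* β) :+ (β′ :* N :- P :* β)) :- :0
                := :1 :* ((β′ :- :1) :* (P′ :* β :- N′) :- (β′ :+ :1) :* (P :* β :- N)) :+ ((β′ :- :1) :* β :* (P :-
                P′) :+ (β′ :- :1) :* (N :- (:- N′)))) refl P N P′ N′ β β′))))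
        solveCases P N P′ N′ nd rel (inj₂ p) (inj₁ n) =
          (λ z → nd (combine₃ (- (N + N)) N P z p n
            (solve 4 (λ P N P′ N′ →
              (N :* P′ :- P :* N′) :- :0
                := :- (N :+ N) :* (P :- :0) :+ (N :* (P :- (:- P′)) :+ P :* (N :- N′))) refl P N P′ N′))) ,
          (λ z → nd (combine₃ (- (P + P)) N P z p n
            (solve 4 (λ P N P′ N′ →
              (N :* P′ :- P :* N′) :- :0
                := :- (P :+ P) :* (N :- :0) :+ (N :* (P :- (:- P′)) :+ P :* (N :- N′))) refl P N P′ N′))) ,
          inj₂ (x-y≈0⇒x≈y (x+x≈0⇒x≈0 (combine₃ (- 1#) ((β′ + - 1#) * β) (β′ + - 1#) rel p n
            (solve 6 (λ P N P′ N′ β β′ →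
              ((β :* β′ :* P :- N) :+ (β :* β′ :* P :- N)) :- :0
                := :- :1 :* ((β′ :- :1) :* (P′ :* β :- N′) :- (β′ :+ :1) :* (P :* β :- N)) :+ ((β′ :- :1) :* β :* (P
                :- (:- P′)) :+ (β′ :- :1) :* (N :- N′))) refl P N P′ N′ β β′))))

  ⟶-sym : ∀ {x y} → x ⟶ y → y ⟶ x
  ⟶-sym {x} {y} (möbius {a} {b} {c} {d} ia ib ic id det e) = möbius id (In-neg ib) (In-neg ic) ia
    (λ z → det (trans (solve 4 (λ a b c d → a :* d :- b :* c := d :* a :- (:- b :* :- c)) refl a b c d) z))
    (combine₁ (- 1#) e (solve 6 (λ a b c d x y →
      x :* (:- c :* y :+ a) :- (d :* y :- b)
        := :- :1 :* (y :* (c :* x :+ d) :- (a :* x :+ b))) refl a b c d x y))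

  -- With norms 1 and ρ², `norm-coefficients` yields (a ± b)² = ρ² (c ± d)². As ρ is not in F_q,
  -- both c + d and c - d vanish, so c = d = 0 against the determinant.
  different-norms : ∀ {s t ρ} → s ⟶ t → Degree4 s → ¬ In ρ → In (ρ * ρ) → s * φ (φ s) ≈ 1# * 1# → ¬ t * φ (φ t) ≈ ρ * ρ
  different-norms {s} {t} {ρ} M@(möbius {a} {b} {c} {d} ia ib ic id det e) d4 ρ∉F ρ²-In sN tN =
    det (combine₂ a (- b) d≈0 c≈0 (solve 4 (λ a b c d →
      (a :* d :- b :* c) :- :0
        := a :* (d :- :0) :+ :- b :* (c :- :0)) refl a b c d))
    where
    coefficients = norm-coefficients M d4 (In-* In-1 In-1) ρ²-In sN tN
    vanish : ∀ {m n} → In m → In n → m * m ≈ (n * ρ) * (n * ρ) → n ≈ 0#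
    vanish {m} {n} im in′ sq = [ (λ z → proj₁ (linear-nonzero ρ∉F in′ (In-neg im)
          (combine₁ (- 1#) z (solve 3 (λ m n ρ → (n :* ρ :- m) :- :0 := :- :1 :* (m :- n :* ρ)) refl m n ρ))))
      , (λ z → proj₁ (linear-nonzero ρ∉F in′ im (combine₁ 1# z (solve 3 (λ m n ρ →
        (n :* ρ :+ m) :- :0
          := :1 :* (m :- (:- (n :* ρ)))) refl m n ρ)))) ]′ (square-equal sq)
    c+d≈0 : c + d ≈ 0#
    c+d≈0 = vanish (In-+ ia ib) (In-+ ic id) (combine₂ (1# + 1#) 1# (proj₁ coefficients) (proj₂ coefficients)
      (solve 5 (λ a b c d ρ →
        (a :+ b) :* (a :+ b) :- (c :+ d) :* ρ :* ((c :+ d) :* ρ)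
          := (:1 :+ :1) :* (a :* b :- ρ :* ρ :* (c :* d)) :+ :1 :* ((a :* a :* (:1 :* :1) :+ b :* b) :- ρ :* ρ :* (c
          :* c :* (:1 :* :1) :+ d :* d))) refl a b c d ρ))
    c-d≈0 : c + - d ≈ 0#
    c-d≈0 = vanish (In-+ ia (In-neg ib)) (In-+ ic (In-neg id)) (combine₂ (- (1# + 1#)) 1# (proj₁ coefficients) (proj₂ coefficients)
      (solve 5 (λ a b c d ρ →
        (a :- b) :* (a :- b) :- (c :- d) :* ρ :* ((c :- d) :* ρ)
          := :- (:1 :+ :1) :* (a :* b :- ρ :* ρ :* (c :* d)) :+ :1 :* ((a :* a :* (:1 :* :1) :+ b :* b) :- ρ :* ρ :*
          (c :* c :* (:1 :* :1) :+ d :* d))) refl a b c d ρ))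
    c≈0 : c ≈ 0#
    c≈0 = x+x≈0⇒x≈0 (combine₂ 1# 1# c+d≈0 c-d≈0 (solve 2 (λ c d →
      (c :+ c) :- :0
        := :1 :* ((c :+ d) :- :0) :+ :1 :* ((c :- d) :- :0)) refl c d))
    d≈0 : d ≈ 0#
    d≈0 = combine₂ 1# (- 1#) c+d≈0 c≈0 (solve 2 (λ c d →
      d :- :0
        := :1 :* ((c :+ d) :- :0) :+ :- :1 :* (c :- :0)) refl c d)

-- Reduction of exponents and invariants of orbits.

module Classification {κ ℓ : Level} (R : CommutativeRing κ ℓ) (q : ℕ) (q-odd : OddPrimePower q)
  (isField : FieldDefs.IsField R) (card : FieldDefs.HasCard R (q ℕ.^ 4))
  (γ : CommutativeRing.Carrier R) (order : FieldDefs.HasOrder R γ (2 ℕ.* (q ℕ.^ 2 ∸ 1)))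
  (ρ : CommutativeRing.Carrier R) (ρ∉F : ¬ FieldDefs.InF R q ρ)
  (ρ²-In : FieldDefs.InF R q (CommutativeRing._*_ R ρ ρ)) where
  open CommutativeRing R
  open FieldDefs R
  open IntegerSolver R
  open RingLemmas R
  open FieldLemmas R isField
  open FiniteField R isField card using (_≟_; square-equal)
  open Frobenius R q q-odd isField card
  open RootsOfUnity R isField _≟_ γ (2 ℕ.* (q ℕ.^ 2 ∸ 1)) order
  open Generator R q q-odd isField card γ order
  open RootExistence R q q-odd isField card F-card
  open Orbits R q q-odd isField card
  open Relation.Binary.Reasoning.Setoid setoid

  infix 4 _≈±_
  _≈±_ : Carrier → Carrier → Set ℓ
  x ≈± y = x ≈ y ⊎ x * y ≈ 1#

  ≈±-step : ∀ {x y z} → x ≈± z → z * y ≈ 1# → x ≈± y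
  ≈±-step (inj₁ x≈z) e = inj₂ (trans (*-congʳ x≈z) e)
  ≈±-step {x} {y} {z} (inj₂ xz≈1) e = inj₁ (combine₂ y (- x) xz≈1 e
    (solve 3 (λ x y z → x :- y := y :* (x :* z :- :1) :+ :- x :* (z :* y :- :1)) refl x y z))

  ≈±-pow : ∀ {x y} n → x ≈± y → pow x n ≈± pow y n
  ≈±-pow n (inj₁ e) = inj₁ (pow-cong n e)
  ≈±-pow n (inj₂ e) = inj₂ (pow-inverse n e)

  -- Exponents of γ matter modulo m and up to sign, and β^(2m′) is the orbit invariant up to inversion.
  record NormalType (η : Carrier) (m m′ : ℕ) : Set (κ ⊔ ℓ) where
    field
      η≉0 : ¬ η ≈ 0#
      η²-In : In (η * η)
      φ²η : φ (φ η) ≈ η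
      half : ℕ
      m≡ : m ≡ 2 ℕ.* half
      0<m : 0 < m
      0<m′ : 0 < m′
      n≡2mm′ : n ≡ 2 ℕ.* m′ ℕ.* m
      invariant : ∀ {s t β β′} → s ⟶ t → Rep η s β → Rep η t β′ → pow β m′ ≈± pow β′ m′
      conjugate : ∀ {y β} → Rep η y β → ∃[ β̂ ] (Rep η (φ y) β̂ × pow β̂ (m′ ℕ.* 2) * pow β (m′ ℕ.* 2) ≈ 1#)
      descend : ∀ {y i} → OddNat i → Rep η y (pow γ (i ℕ.+ m)) → ∃[ y′ ] (φ y ⟶ y′ × Rep η y′ (pow γ i))

  rep-resp : ∀ {η y β β′} → β ≈ β′ → Rep η y β → Rep η y β′
  rep-resp β≈β′ (rep e anti β≉0) = rep
    (trans (*-congˡ (+-congʳ (sym β≈β′))) (trans e (*-congˡ (+-congʳ β≈β′))))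
    (trans (φ-cong (φ-cong (sym β≈β′))) (trans anti (-‿cong β≈β′))) (λ z → β≉0 (trans β≈β′ z))

  rep-unique : ∀ {η s t β} → Rep η s β → Rep η t β → s ≈ t
  rep-unique {η} {s} {t} {β} (rep e anti β≉0) (rep e′ _ _) =
    *-cancelˡ (λ z → antifixed-β²≉1 anti β≉0 (trans (*-congˡ z) (zeroʳ _)))
      (combine₂ 1# (- 1#) e e′ (solve 4 (λ s t η β →
        (β :+ :1) :* s :- (β :+ :1) :* t
          := :1 :* (s :* (β :+ :1) :- η :* (β :- :1)) :+ :- :1 :* (t :* (β :+ :1) :- η :* (β :- :1))) refl s t η β))

  γ^odd-rep : ∀ {η y i} → OddNat i → y * (pow γ i + 1#) ≈ η * (pow γ i + - 1#) → Rep η y (pow γ i)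
  γ^odd-rep {i = i} odd e = rep e (γ^odd-antifixed odd) (pow-nonzero i γ-nonzero)

  odd+even : ∀ {i} k → OddNat i → OddNat (i ℕ.+ 2 ℕ.* k)
  odd+even k (j , ≡.refl) = j ℕ.+ k , (Nat.solve 2 (λ j k →
    (Nat.con 2 Nat.:* j Nat.:+ Nat.con 1) Nat.:+ Nat.con 2 Nat.:* k
      Nat.:= Nat.con 2 Nat.:* (j Nat.:+ k) Nat.:+ Nat.con 1) ≡.refl j k)

  odd-not-even : ∀ {i} k → OddNat i → i ≢ 2 ℕ.* k
  odd-not-even k (j , e) e′ = ℕₚ.even≢odd k j (≡.trans (≡.sym e′) (≡.trans e (ℕₚ.+-comm _ 1)))

  odd-difference : ∀ {i j} k → OddNat (i ℕ.+ j) → j ≡ 2 ℕ.* k → OddNat i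
  odd-difference {i} {j} k odd j≡ with even-or-odd i
  ... | inj₂ o = o
  ... | inj₁ (l , i≡) = contradiction (≡.trans (≡.cong₂ ℕ._+_ i≡ j≡) (≡.sym (ℕₚ.*-distribˡ-+ 2 l k))) (odd-not-even (l ℕ.+ k) odd)

  odd-complement : ∀ {i j} k → OddNat i → i ℕ.+ j ≡ 2 ℕ.* k → OddNat j
  odd-complement {i} {j} k odd e with even-or-odd j
  ... | inj₂ o = o
  ... | inj₁ (l , j≡) = contradiction e (odd-not-even k (≡.subst (λ x → OddNat (i ℕ.+ x)) (≡.sym j≡) (odd+even l odd)))

  odd⇒1≤ : ∀ {i} → OddNat i → 1 ≤ i
  odd⇒1≤ (k , ≡.refl) = ℕₚ.m≤n+m 1 (2 ℕ.* k)

  module Reduction {η m m′} (T : NormalType η m m′) where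
    open NormalType T

    -- The bound is i ≤ m/2 without a division; for m = q + 1 and m = q - 1 it is the range of
    -- exponents in S₄.
    Member : Carrier → Set ℓ
    Member s = ∃[ i ] (OddNat i × 2 ℕ.* i ≤ m × Rep η s (pow γ i))

    member-degree4 : ∀ {s} → Member s → Degree4 s
    member-degree4 (_ , _ , _ , r) = rep-degree4 η≉0 η²-In φ²η r

    -- Some parameter of φ(t) has its power inverse to that of β′, so a relation valid for all
    -- parameters of φ(t) can be carried back to t. Each use undoes one application of φ.
    conjugate-back : ∀ {z t β′} → Rep η t β′ →
      (∀ {β̂} → Rep η (φ t) β̂ → z ≈± pow β̂ (m′ ℕ.* 2)) → z ≈± pow β′ (m′ ℕ.* 2)
    conjugate-back {z} {t} {β′} r h = go (conjugate r)
      where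
      go : ∃[ β̂ ] (Rep η (φ t) β̂ × pow β̂ (m′ ℕ.* 2) * pow β′ (m′ ℕ.* 2) ≈ 1#) → z ≈± pow β′ (m′ ℕ.* 2)
      go (_ , r̂ , e) = ≈±-step (h r̂) e

    invariant² : ∀ {s t β β′} → s ⟶ t → Rep η s β → Rep η t β′ → pow β (m′ ℕ.* 2) ≈± pow β′ (m′ ℕ.* 2)
    invariant² {β = β} {β′} M r r′ = Sum.map (λ e → trans (sym (pow-pow β m′ 2)) (trans e (pow-pow β′ m′ 2)))
      (λ e → trans (*-cong (sym (pow-pow β m′ 2)) (sym (pow-pow β′ m′ 2))) e) (≈±-pow 2 (invariant M r r′))

    orbit-invariant : ∀ {s t y β β′} → s ⟶ y → eval (minPoly t) y ≈ 0# → Rep η s β → Rep η t β′ →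
      pow β (m′ ℕ.* 2) ≈± pow β′ (m′ ℕ.* 2)
    orbit-invariant {s} {t} {y} {β} {β′} M root r r′ =
      [ (λ e → invariant² (⟶-resp refl e M) r r′)
      , [ (λ e → conjugate-back r′ (invariant² (⟶-resp refl e M) r))
        , [ (λ e → conjugate-back r′ (λ r₁ → conjugate-back r₁ (invariant² (⟶-resp refl e M) r)))
          , (λ e → conjugate-back r′ (λ r₁ → conjugate-back r₁ (λ r₂ → conjugate-back r₂ (invariant² (⟶-resp refl e M) r)))) ]′ ]′ ]′
      (conjugate-factors root)

    -- The exponents 2m′i and 2m′j are at most m′m = n/2, where distinct exponents give distinct
    -- powers of γ. If instead the two powers are inverse, only the border case remains.
    same-index : ∀ {i j} → OddNat i → OddNat j → 2 ℕ.* i ≤ m → 2 ℕ.* j ≤ m →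
      pow (pow γ i) (m′ ℕ.* 2) ≈± pow (pow γ j) (m′ ℕ.* 2) → i ≡ j
    same-index {i} {j} i-odd j-odd 2i≤m 2j≤m =
      [ (λ e → ℕₚ.*-cancelʳ-≡ i j (m′ ℕ.* 2) (pow-γ-injective (bound i 2i≤m) (bound j 2j≤m)
          (trans (sym (pow-pow γ i (m′ ℕ.* 2))) (trans e (pow-pow γ j (m′ ℕ.* 2))))))
      , (λ e → inverse-case (trans (pow-+ γ (i ℕ.* (m′ ℕ.* 2)) (j ℕ.* (m′ ℕ.* 2)))
          (trans (*-cong (sym (pow-pow γ i (m′ ℕ.* 2))) (sym (pow-pow γ j (m′ ℕ.* 2)))) e))) ]′
      where
      instance
        m′*2≢0 : ℕ.NonZero (m′ ℕ.* 2)
        m′*2≢0 = ℕ.>-nonZero (ℕₚ.*-mono-≤ 0<m′ (s≤s z≤n))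
      double : ∀ i → i ℕ.* (m′ ℕ.* 2) ≡ m′ ℕ.* (2 ℕ.* i)
      double i = ≡.trans (ℕₚ.*-comm i _) (ℕₚ.*-assoc m′ 2 i)
      m′m<n : m′ ℕ.* m < n
      m′m<n = ≡.subst (m′ ℕ.* m <_) (≡.sym (≡.trans n≡2mm′ (≡.trans (ℕₚ.*-assoc 2 m′ m) (≡.cong (m′ ℕ.* m ℕ.+_) (ℕₚ.+-identityʳ _)))))
        (ℕₚ.m<m+n (m′ ℕ.* m) (ℕₚ.*-mono-≤ 0<m′ 0<m))
      bound : ∀ i → 2 ℕ.* i ≤ m → i ℕ.* (m′ ℕ.* 2) < n
      bound i 2i≤m = ℕₚ.≤-<-trans (ℕₚ.≤-trans (ℕₚ.≤-reflexive (double i)) (ℕₚ.*-monoʳ-≤ m′ 2i≤m)) m′m<n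
      2[i+j]≤2m : 2 ℕ.* i ℕ.+ 2 ℕ.* j ≤ m ℕ.+ m
      2[i+j]≤2m = ℕₚ.+-mono-≤ 2i≤m 2j≤m
      total : i ℕ.* (m′ ℕ.* 2) ℕ.+ j ℕ.* (m′ ℕ.* 2) ≡ m′ ℕ.* (2 ℕ.* i ℕ.+ 2 ℕ.* j)
      total = ≡.trans (≡.cong₂ ℕ._+_ (double i) (double j)) (≡.sym (ℕₚ.*-distribˡ-+ m′ (2 ℕ.* i) (2 ℕ.* j)))
      n≡m′[m+m] : n ≡ m′ ℕ.* (m ℕ.+ m)
      n≡m′[m+m] = ≡.trans n≡2mm′ (≡.trans (≡.cong (ℕ._* m) (ℕₚ.*-comm 2 m′)) (≡.trans (ℕₚ.*-assoc m′ 2 m)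
        (≡.cong (λ x → m′ ℕ.* (m ℕ.+ x)) (ℕₚ.+-identityʳ m))))
      -- The exponent 2m′(i + j) is at most 2m′m = n, so it equals n and i = j = m/2.
      inverse-case : pow γ (i ℕ.* (m′ ℕ.* 2) ℕ.+ j ℕ.* (m′ ℕ.* 2)) ≈ 1# → i ≡ j
      inverse-case e with ℕₚ.m≤n⇒m<n∨m≡n 2[i+j]≤2m
      ... | inj₁ lt = contradiction (ℕₚ.m+n≡0⇒m≡0 _ (small-exponent _ small e))
            (λ z → ℕₚ.>⇒≢ (ℕₚ.*-mono-≤ (odd⇒1≤ i-odd) (ℕₚ.*-mono-≤ 0<m′ (s≤s z≤n))) z)
        where
        small : i ℕ.* (m′ ℕ.* 2) ℕ.+ j ℕ.* (m′ ℕ.* 2) < n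
        small = ≡.subst₂ _<_ (≡.sym total) (≡.sym n≡m′[m+m]) (ℕₚ.*-monoʳ-< m′ {{ℕ.>-nonZero 0<m′}} lt)
      ... | inj₂ eq = ℕₚ.*-cancelˡ-≡ i j 2 (≡.trans (squeeze 2i≤m 2j≤m eq) (≡.sym (squeeze 2j≤m 2i≤m (≡.trans (ℕₚ.+-comm (2 ℕ.* j) _) eq))))
        where
        squeeze : ∀ {x y} → x ≤ m → y ≤ m → x ℕ.+ y ≡ m ℕ.+ m → x ≡ m
        squeeze {x} {y} x≤m y≤m e = ℕₚ.≤-antisym x≤m (ℕₚ.+-cancelʳ-≤ m m x
          (ℕₚ.≤-trans (ℕₚ.≤-reflexive (≡.sym e)) (ℕₚ.+-monoʳ-≤ x y≤m)))

    member-unique : ∀ {s t y} → s ⟶ y → eval (minPoly t) y ≈ 0# → Member s → Member t → s ≈ t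
    member-unique M root (i , i-odd , 2i≤m , r) (j , j-odd , 2j≤m , r′) =
      rep-unique r (rep-resp (reflexive (≡.cong (pow γ) (≡.sym i≡j))) r′)
      where i≡j = same-index i-odd j-odd 2i≤m 2j≤m (orbit-invariant M root r r′)

    module _ {g} (G : Carrier → Set g) (G-⟶ : ∀ {x y} → G x → x ⟶ y → G y) (G-φ : ∀ {x} → G x → G (φ x)) where

      -- `G` stands for an orbit under Möbius maps and φ, known only through its closure properties,
      -- so the reduction of exponents does not depend on a quartic.
      Reached : Carrier → Set (κ ⊔ ℓ ⊔ g)
      Reached β = ∃[ y ] (G y × Rep η y β)

      descend* : ∀ k {i} → OddNat i → Reached (pow γ (i ℕ.+ k ℕ.* m)) → Reached (pow γ i)
      descend* zero {i} odd (y , gy , r) = y , gy , rep-resp (reflexive (≡.cong (pow γ) (ℕₚ.+-identityʳ i))) r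
      descend* (suc k) {i} odd (y , gy , r) = descend* k odd (step (descend odd′
          (rep-resp (reflexive (≡.cong (pow γ) exponent)) r)))
        where
        exponent : i ℕ.+ (m ℕ.+ k ℕ.* m) ≡ (i ℕ.+ k ℕ.* m) ℕ.+ m
        exponent = ≡.trans (≡.cong (i ℕ.+_) (ℕₚ.+-comm m _)) (≡.sym (ℕₚ.+-assoc i _ m))
        odd′ : OddNat (i ℕ.+ k ℕ.* m)
        odd′ = ≡.subst (λ x → OddNat (i ℕ.+ x)) (≡.trans (≡.sym (ℕₚ.*-assoc 2 k half))
          (≡.trans (≡.cong (ℕ._* half) (ℕₚ.*-comm 2 k)) (≡.trans (ℕₚ.*-assoc k 2 half) (≡.cong (k ℕ.*_) (≡.sym m≡))))) (odd+even (k ℕ.* half) odd)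
        step : ∃[ y′ ] (φ y ⟶ y′ × Rep η y′ (pow γ (i ℕ.+ k ℕ.* m))) → Reached (pow γ (i ℕ.+ k ℕ.* m))
        step (y′ , M , r′) = y′ , G-⟶ (G-φ gy) M , r′

      -- Since n = 2m′m and i + j = m, inverting the parameter replaces i by n - i = j + (2m′ - 1)
      -- m, and descent removes the multiple of m.
      reflect : ∀ {i j} → OddNat j → i ℕ.+ j ≡ m → Reached (pow γ i) → Reached (pow γ j)
      reflect {i} {j} j-odd i+j≡m (y , gy , r) = invert (2 ℕ.* m′) ≡.refl
        where
        invert : ∀ K → 2 ℕ.* m′ ≡ K → Reached (pow γ j)
        invert zero e = contradiction e (ℕₚ.>⇒≢ (ℕₚ.*-mono-≤ {1} {2} (s≤s z≤n) 0<m′))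
        invert (suc K) e = descend* K j-odd (go (rep-inverse η≉0 η²-In φ²η r (begin
          pow γ i * pow γ (j ℕ.+ K ℕ.* m) ≈⟨ pow-+ γ i (j ℕ.+ K ℕ.* m) ⟨
          pow γ (i ℕ.+ (j ℕ.+ K ℕ.* m)) ≡⟨ ≡.cong (pow γ) (≡.trans (≡.sym (ℕₚ.+-assoc i j _))
            (≡.trans (≡.cong (ℕ._+ K ℕ.* m) i+j≡m) (≡.trans (≡.cong (ℕ._* m) (≡.sym e)) (≡.sym n≡2mm′)))) ⟩
          pow γ n ≈⟨ γ^n≈1 ⟩
          1# ∎)))
          where
          go : Rep η (- y) (pow γ (j ℕ.+ K ℕ.* m)) × y ⟶ (- y) → Reached (pow γ (j ℕ.+ K ℕ.* m))
          go (r′ , M) = - y , G-⟶ gy M , r′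

      -- The remainder i of N modulo m stays odd because m is even. If it exceeds m/2, it is
      -- reflected to m - i, odd for the same reason.
      reach-member : ∀ {N} → OddNat N → Reached (pow γ N) → ∃[ s ] (G s × Member s)
      reach-member {N} odd (y , gy , r) = choose (2 ℕ.* i ℕ.≤? m)
        where
        instance
          m≢0 : ℕ.NonZero m
          m≢0 = ℕ.>-nonZero 0<m
        i = N % m
        k = N / m
        N≡ : N ≡ i ℕ.+ k ℕ.* m
        N≡ = m≡m%n+[m/n]*n N m
        i-odd : OddNat i
        i-odd = odd-difference (k ℕ.* half) (≡.subst OddNat N≡ odd) (≡.trans (≡.cong (k ℕ.*_) m≡)
          (≡.trans (≡.sym (ℕₚ.*-assoc k 2 half)) (≡.trans (≡.cong (ℕ._* half) (ℕₚ.*-comm k 2)) (ℕₚ.*-assoc 2 k half))))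
        reached : Reached (pow γ i)
        reached = descend* k i-odd (y , gy , rep-resp (reflexive (≡.cong (pow γ) N≡)) r)
        i+j≡m : i ℕ.+ (m ∸ i) ≡ m
        i+j≡m = ℕₚ.m+[n∸m]≡n (ℕₚ.<⇒≤ (m%n<n N m))
        finish : ∀ {i} → OddNat i → 2 ℕ.* i ≤ m → Reached (pow γ i) → ∃[ s ] (G s × Member s)
        finish {i} odd le (s , gs , r) = s , gs , i , odd , le , r
        choose : Dec (2 ℕ.* i ≤ m) → ∃[ s ] (G s × Member s)
        choose (yes le) = finish i-odd le reached
        choose (no gt) = finish j-odd small (reflect j-odd i+j≡m reached)
          where
          j-odd : OddNat (m ∸ i)
          j-odd = odd-complement half i-odd (≡.trans i+j≡m m≡)
          j<i : m ∸ i < i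
          j<i = ℕₚ.+-cancelˡ-< i _ _ (≡.subst₂ _<_ (≡.sym i+j≡m) (≡.cong (i ℕ.+_) (ℕₚ.+-identityʳ i)) (ℕₚ.≰⇒> gt))
          small : 2 ℕ.* (m ∸ i) ≤ m
          small = ℕₚ.≤-trans (ℕₚ.≤-reflexive (≡.cong (m ∸ i ℕ.+_) (ℕₚ.+-identityʳ _)))
            (ℕₚ.≤-trans (ℕₚ.+-monoˡ-≤ (m ∸ i) (ℕₚ.<⇒≤ j<i)) (ℕₚ.≤-reflexive i+j≡m))

  -- The two normal types η = 1 and η = ρ.

  φρ≈-ρ : φ ρ ≈ - ρ
  φρ≈-ρ = [ (λ e → contradiction e ρ∉F) , (λ e → e) ]′ (square-equal (trans (sym (φ-* ρ ρ)) ρ²-In))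

  ρ≉0 : ¬ ρ ≈ 0#
  ρ≉0 z = ρ∉F (In-resp (sym z) In-0)

  φ²ρ : φ (φ ρ) ≈ ρ
  φ²ρ = trans (φ-cong φρ≈-ρ) (trans (φ-neg ρ) (trans (-‿cong φρ≈-ρ) (solve 1 (λ ρ → :- (:- ρ) := ρ) refl ρ)))

  1²-In : In (1# * 1#)
  1²-In = In-* In-1 In-1

  φ²1 : φ (φ 1#) ≈ 1#
  φ²1 = trans (φ-cong φ-1) φ-1

  q+1≡suc-q : q+1 ≡ suc q
  q+1≡suc-q = ≡.trans (≡.trans (ℕₚ.+-comm q-1 2) (≡.cong suc (ℕₚ.+-comm 1 q-1))) (≡.cong suc (≡.sym q≡2h+1))

  pow-q+1 : ∀ x → pow x q+1 ≈ x * φ x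
  pow-q+1 x = reflexive (≡.cong (pow x) q+1≡suc-q)

  φ-pow-γ : ∀ i → φ (pow γ i) ≈ pow γ (i ℕ.* (2 ℕ.* h ℕ.+ 1))
  φ-pow-γ i = trans (pow-pow γ i q) (reflexive (≡.cong (λ r → pow γ (i ℕ.* r)) q≡2h+1))

  -- Squaring turns β^(q²-1) = -1 into 1. This sign is why `conjugate` is stated at the doubled
  -- exponent `m′ * 2`.
  antifixed-pow-square : ∀ {β} → ¬ β ≈ 0# → Antifixed β → ∀ a b → a ℕ.* b ≡ q-1 ℕ.* q+1 → pow (pow β a) (b ℕ.* 2) ≈ 1#
  antifixed-pow-square {β} β≉0 anti a b ab≡ = begin
    pow (pow β a) (b ℕ.* 2) ≈⟨ pow-pow (pow β a) b 2 ⟨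
    pow (pow (pow β a) b) 2 ≈⟨ pow-cong 2 (trans (pow-pow β a b) (reflexive (≡.cong (pow β) ab≡))) ⟩
    pow (pow β (q-1 ℕ.* q+1)) 2 ≈⟨ pow-cong 2 (antifixed-pow β≉0 anti) ⟩
    - 1# * (- 1# * 1#) ≈⟨ (solve 0 (:- :1 :* (:- :1 :* :1) := :1) refl) ⟩
    1# ∎

  rep-φ₁ : ∀ {y β} → Rep 1# y β → Rep 1# (φ y) (φ β)
  rep-φ₁ {y} {β} (rep e anti β≉0) = rep (begin
    φ y * (φ β + 1#) ≈⟨ *-congˡ (trans (φ-+ β 1#) (+-congˡ φ-1)) ⟨
    φ y * φ (β + 1#) ≈⟨ φ-* y (β + 1#) ⟨
    φ (y * (β + 1#)) ≈⟨ φ-cong e ⟩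
    φ (1# * (β + - 1#)) ≈⟨ φ-* 1# (β + - 1#) ⟩
    φ 1# * φ (β + - 1#) ≈⟨ *-cong φ-1 (trans (φ-+ β (- 1#)) (+-congˡ (In-neg In-1))) ⟩
    1# * (φ β + - 1#) ∎) (antifixed-φ anti) (pow-nonzero q β≉0)

  -- φ negates ρ, so φ(y) = -ρ (φ(β) - 1)/(φ(β) + 1), and inverting φ(β) absorbs the sign.
  rep-φ₂ : ∀ {y β β̂} → Rep ρ y β → φ β * β̂ ≈ 1# → Rep ρ (φ y) β̂
  rep-φ₂ {y} {β} {β̂} (rep e anti β≉0) inv = rep (step (φ y) (φ β) β̂ inv (begin
    φ y * (φ β + 1#) ≈⟨ *-congˡ (trans (φ-+ β 1#) (+-congˡ φ-1)) ⟨
    φ y * φ (β + 1#) ≈⟨ φ-* y (β + 1#) ⟨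
    φ (y * (β + 1#)) ≈⟨ φ-cong e ⟩
    φ (ρ * (β + - 1#)) ≈⟨ φ-* ρ (β + - 1#) ⟩
    φ ρ * φ (β + - 1#) ≈⟨ *-cong φρ≈-ρ (trans (φ-+ β (- 1#)) (+-congˡ (In-neg In-1))) ⟩
    - ρ * (φ β + - 1#) ∎)) (antifixed-inverse inv (antifixed-φ anti)) (unit⇒nonzero (trans (*-comm β̂ (φ β)) inv))
    where
    step : ∀ y b b′ → b * b′ ≈ 1# → y * (b + 1#) ≈ - ρ * (b + - 1#) → y * (b′ + 1#) ≈ ρ * (b′ + - 1#)
    step y b b′ inv e = combine₂ b′ (- (y + ρ)) e inv
      (solve 4 (λ y b b′ ρ →
        y :* (b′ :+ :1) :- ρ :* (b′ :- :1)
          := b′ :* (y :* (b :+ :1) :- :- ρ :* (b :- :1)) :+ :- (y :+ ρ) :* (b :* b′ :- :1)) refl y b b′ ρ)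

  type₁ : NormalType 1# q+1 q-1
  type₁ = record
    { η≉0 = 1≉0 ; η²-In = 1²-In ; φ²η = φ²1
    ; half = suc h ; m≡ = ≡.trans (ℕₚ.+-comm q-1 2) (≡.sym (ℕₚ.*-suc 2 h))
    ; 0<m = 0<q+1 ; 0<m′ = 0<q-1 ; n≡2mm′ = ≡.trans n≡ (≡.sym (ℕₚ.*-assoc 2 q-1 q+1))
    ; invariant = λ M r r′ → invariant r r′ (rep-conjugated 1≉0 1²-In φ²1 M r r′)
    ; conjugate = λ {y} {β} r → φ β , rep-φ₁ r , conjugate r
    ; descend = descend }
    where
    -- For η = 1 both P and N lie in F_q, so comparing the relation with its image under φ cancels
    -- them and leaves the (q-1)-th powers.
    invariant : ∀ {s t β β′} → Rep 1# s β → Rep 1# t β′ → Conjugated 1≉0 1²-In φ²1 β β′ → pow β q-1 ≈± pow β′ q-1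
    invariant {β = β} {β′} (rep _ _ β≉0) (rep _ _ β′≉0) (a , b , ia , ib , P≉0 , N≉0 , rel) =
      Sum.map (λ e → *-cancelˡ (*-nonzero P≉0 β≉0) (equal P N e (applyφ e)))
        (λ e → *-cancelˡ (*-nonzero (*-nonzero β≉0 β′≉0) P≉0) (inverses P N e (applyφ₂ e))) rel
      where
      P = a * 1# + b
      N = a * 1# + - b
      P-In : In P
      P-In = In-+ (In-* ia In-1) ib
      N-In : In N
      N-In = In-+ (In-* ia In-1) (In-neg ib)
      w = pow β q-1
      w′ = pow β′ q-1
      applyφ : β′ * N ≈ P * β → β′ * w′ * N ≈ P * (β * w)
      applyφ e = begin
        β′ * w′ * N ≈⟨ *-cong (φ-suc β′) N-In ⟨
        φ β′ * φ N ≈⟨ φ-* _ _ ⟨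
        φ (β′ * N) ≈⟨ φ-cong e ⟩
        φ (P * β) ≈⟨ φ-* _ _ ⟩
        φ P * φ β ≈⟨ *-cong P-In (φ-suc β) ⟩
        P * (β * w) ∎
      equal : ∀ P N {w w′} → β′ * N ≈ P * β → β′ * w′ * N ≈ P * (β * w) → P * β * w ≈ P * β * w′
      equal P N {w} {w′} e e′ = combine₂ w′ (- 1#) e e′
        (solve 6 (λ P N w w′ β β′ →
          P :* β :* w :- P :* β :* w′
            := w′ :* (β′ :* N :- P :* β) :+ :- :1 :* (β′ :* w′ :* N :- P :* (β :* w))) refl P N w w′ β β′)
      applyφ₂ : β * β′ * P ≈ N → β * w * (β′ * w′) * P ≈ N
      applyφ₂ e = begin
        β * w * (β′ * w′) * P ≈⟨ *-cong (*-cong (φ-suc β) (φ-suc β′)) P-In ⟨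
        φ β * φ β′ * φ P ≈⟨ *-congʳ (φ-* β β′) ⟨
        φ (β * β′) * φ P ≈⟨ φ-* _ _ ⟨
        φ (β * β′ * P) ≈⟨ φ-cong e ⟩
        φ N ≈⟨ N-In ⟩
        N ∎
      inverses : ∀ P N {w w′} → β * β′ * P ≈ N → β * w * (β′ * w′) * P ≈ N → β * β′ * P * (w * w′) ≈ β * β′ * P * 1#
      inverses P N {w} {w′} e e′ = combine₂ (- 1#) 1# e e′
        (solve 6 (λ P N w w′ β β′ →
          β :* β′ :* P :* (w :* w′) :- β :* β′ :* P :* :1
            := :- :1 :* (β :* β′ :* P :- N) :+ :1 :* (β :* w :* (β′ :* w′) :* P :- N)) refl P N w w′ β β′)

    conjugate : ∀ {y β} → Rep 1# y β → pow (φ β) (q-1 ℕ.* 2) * pow β (q-1 ℕ.* 2) ≈ 1#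
    conjugate {y} {β} (rep _ anti β≉0) = begin
      pow (φ β) (q-1 ℕ.* 2) * pow β (q-1 ℕ.* 2) ≈⟨ pow-distrib-* (φ β) β (q-1 ℕ.* 2) ⟨
      pow (φ β * β) (q-1 ℕ.* 2) ≈⟨ pow-cong (q-1 ℕ.* 2) (trans (*-comm (φ β) β) (sym (pow-q+1 β))) ⟩
      pow (pow β q+1) (q-1 ℕ.* 2) ≈⟨ antifixed-pow-square β≉0 anti q+1 q-1 (ℕₚ.*-comm q+1 q-1) ⟩
      1# ∎

    -- Multipliers from F_q shift exponents only by multiples of 2(q+1); the shift by q + 1 comes
    -- from φ. The inverse of γ^(q(i+q+1)), a parameter of -φ(y), differs from γ^i by the factor v =
    -- γ^((i+q)(q+1)). Since i + q = 2k is even, v lies in F_q.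
    descend : ∀ {y i} → OddNat i → Rep 1# y (pow γ (i ℕ.+ q+1)) → ∃[ y′ ] (φ y ⟶ y′ × Rep 1# y′ (pow γ i))
    descend {y} {i} odd@(j , i≡) r = go (inverse (φ β) (Rep.nonzero (rep-φ₁ r)))
      where
      β = pow γ (i ℕ.+ q+1)
      k = j ℕ.+ suc h
      v = pow γ (k ℕ.* (2 ℕ.* q+1))
      v≈ : v ≈ pow γ i * φ β
      v≈ = begin
        v ≡⟨ ≡.cong (pow γ) (≡.trans (Nat.solve 2 (λ j h →
          (j Nat.:+ (Nat.con 1 Nat.:+ h)) Nat.:* (Nat.con 2 Nat.:* (Nat.con 2 Nat.:* h Nat.:+ Nat.con 2))
            Nat.:= (Nat.con 2 Nat.:* j Nat.:+ Nat.con 1) Nat.:+ ((Nat.con 2 Nat.:* j Nat.:+ Nat.con 1) Nat.:+ (Nat.con 2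
            Nat.:* h Nat.:+ Nat.con 2)) Nat.:* (Nat.con 2 Nat.:* h Nat.:+ Nat.con 1)) ≡.refl j h) (≡.cong (λ i → i ℕ.+ (i ℕ.+ q+1) ℕ.* (2 ℕ.* h ℕ.+ 1)) (≡.sym i≡))) ⟩
        pow γ (i ℕ.+ (i ℕ.+ q+1) ℕ.* (2 ℕ.* h ℕ.+ 1)) ≈⟨ pow-+ γ i _ ⟩
        pow γ i * pow γ ((i ℕ.+ q+1) ℕ.* (2 ℕ.* h ℕ.+ 1)) ≈⟨ *-congˡ (φ-pow-γ (i ℕ.+ q+1)) ⟨
        pow γ i * φ β ∎
      go : ∃[ β̂ ] φ β * β̂ ≈ 1# → ∃[ y′ ] (φ y ⟶ y′ × Rep 1# y′ (pow γ i))
      go (β̂ , inv) = Product.map₂ (λ (M′ , r″) → ⟶-trans (proj₂ inverted) M′ , r″)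
        (rep-multiply 1≉0 1²-In φ²1 (proj₁ inverted) (γ^odd-antifixed odd) (pow-nonzero (k ℕ.* (2 ℕ.* q+1)) γ-nonzero) 1≉0
          (In-+ v-In In-1) (In-* In-1 (In-+ v-In (In-neg In-1))) (product (pow γ i) (φ β) β̂ inv v≈))
        where
        inverted = rep-inverse 1≉0 1²-In φ²1 (rep-φ₁ r) inv
        v-In : In v
        v-In = γ^2[q+1]-In k
        product : ∀ {v} x b b′ → b * b′ ≈ 1# → v ≈ x * b → 1# * x ≈ v * b′
        product {v} x b b′ inv e = combine₂ (- x) (- b′) inv e (solve 4 (λ v x b b′ →
          :1 :* x :- v :* b′
            := :- x :* (b :* b′ :- :1) :+ :- b′ :* (v :- x :* b)) refl v x b b′)

  type₂ : NormalType ρ q-1 q+1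
  type₂ = record
    { η≉0 = ρ≉0 ; η²-In = ρ²-In ; φ²η = φ²ρ
    ; half = h ; m≡ = ≡.refl
    ; 0<m = 0<q-1 ; 0<m′ = 0<q+1
    ; n≡2mm′ = ≡.trans n≡ (≡.trans (≡.cong (2 ℕ.*_) (ℕₚ.*-comm q-1 q+1)) (≡.sym (ℕₚ.*-assoc 2 q+1 q-1)))
    ; invariant = λ M r r′ → invariant r r′ (rep-conjugated ρ≉0 ρ²-In φ²ρ M r r′)
    ; conjugate = conjugate
    ; descend = descend }
    where
    -- φ sends P to -N and N to -P, so P/N has norm 1 over F_q. Multiplying the relation by its
    -- conjugate cancels P and N and leaves the norms β φ(β) = β^(q+1).
    invariant : ∀ {s t β β′} → Rep ρ s β → Rep ρ t β′ → Conjugated ρ≉0 ρ²-In φ²ρ β β′ → pow β q+1 ≈± pow β′ q+1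
    invariant {β = β} {β′} (rep _ _ β≉0) (rep _ _ β′≉0) (a , b , ia , ib , P≉0 , N≉0 , rel) =
      Sum.map
        (λ e → trans (pow-q+1 β) (trans (*-cancelˡ (*-nonzero P≉0 N≉0) (equal (φ β) (φ β′) P N e (applyφ e))) (sym (pow-q+1 β′))))
        (λ e → trans (*-cong (pow-q+1 β) (pow-q+1 β′)) (*-cancelˡ P≉0 (inverses (φ β) (φ β′) P N e (applyφ₂ e)))) rel
      where
      P = a * ρ + b
      N = a * ρ + - b
      φP : φ P ≈ - N
      φP = trans (φ-linear ρ ia ib) (trans (+-congʳ (*-congˡ φρ≈-ρ)) (solve 3 (λ a b ρ →
        a :* :- ρ :+ b
          := :- (a :* ρ :- b)) refl a b ρ))
      φN : φ N ≈ - P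
      φN = trans (φ-linear ρ ia (In-neg ib)) (trans (+-congʳ (*-congˡ φρ≈-ρ)) (solve 3 (λ a b ρ →
        a :* :- ρ :- b
          := :- (a :* ρ :+ b)) refl a b ρ))
      applyφ : β′ * N ≈ P * β → φ β′ * - P ≈ - N * φ β
      applyφ e = trans (*-congˡ (sym φN)) (trans (sym (φ-* β′ N)) (trans (φ-cong e) (trans (φ-* P β) (*-congʳ φP))))
      equal : ∀ c c′ P N → β′ * N ≈ P * β → c′ * - P ≈ - N * c → P * N * (β * c) ≈ P * N * (β′ * c′)
      equal c c′ P N e e′ = combine₂ (- (N * c)) (β′ * N) e e′
        (solve 6 (λ P N c c′ β β′ →
          P :* N :* (β :* c) :- P :* N :* (β′ :* c′)
            := :- (N :* c) :* (β′ :* N :- P :* β) :+ β′ :* N :* (c′ :* :- P :- :- N :* c)) refl P N c c′ β β′)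
      applyφ₂ : β * β′ * P ≈ N → φ β * φ β′ * - N ≈ - P
      applyφ₂ e = trans (*-cong (sym (φ-* β β′)) (sym φP)) (trans (sym (φ-* (β * β′) P)) (trans (φ-cong e) φN))
      inverses : ∀ c c′ P N → β * β′ * P ≈ N → c * c′ * - N ≈ - P → P * (β * c * (β′ * c′)) ≈ P * 1#
      inverses c c′ P N e e′ = combine₂ (c * c′) (- 1#) e e′
        (solve 6 (λ P N c c′ β β′ →
          P :* (β :* c :* (β′ :* c′)) :- P :* :1
            := c :* c′ :* (β :* β′ :* P :- N) :+ :- :1 :* (c :* c′ :* :- N :- :- P)) refl P N c c′ β β′)

    conjugate : ∀ {y β} → Rep ρ y β → ∃[ β̂ ] (Rep ρ (φ y) β̂ × pow β̂ (q+1 ℕ.* 2) * pow β (q+1 ℕ.* 2) ≈ 1#)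
    conjugate {y} {β} r@(rep _ anti β≉0) = go (inverse (φ β) (pow-nonzero q β≉0))
      where
      -- At this exponent (β^(q-1))^E = 1, so β^E may be replaced by φ(β)^E, and φ(β) is the inverse
      -- of the parameter of φ(y).
      E = q+1 ℕ.* 2
      go : ∃[ β̂ ] φ β * β̂ ≈ 1# → ∃[ β̂ ] (Rep ρ (φ y) β̂ × pow β̂ E * pow β E ≈ 1#)
      go (β̂ , inv) = β̂ , rep-φ₂ r inv , (begin
        pow β̂ E * pow β E ≈⟨ *-congˡ (*-identityʳ _) ⟨
        pow β̂ E * (pow β E * 1#) ≈⟨ *-congˡ (*-congˡ (antifixed-pow-square β≉0 anti q-1 q+1 ≡.refl)) ⟨
        pow β̂ E * (pow β E * pow (pow β q-1) E) ≈⟨ *-congˡ (pow-distrib-* β (pow β q-1) E) ⟨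
        pow β̂ E * pow (β * pow β q-1) E ≈⟨ *-congˡ (pow-cong E (φ-suc β)) ⟨
        pow β̂ E * pow (φ β) E ≈⟨ pow-inverse E (trans (*-comm β̂ (φ β)) inv) ⟩
        1# ∎)

    descend : ∀ {y i} → OddNat i → Rep ρ y (pow γ (i ℕ.+ q-1)) → ∃[ y′ ] (φ y ⟶ y′ × Rep ρ y′ (pow γ i))
    descend {y} {i} odd@(j , i≡) r = go (inverse (φ β) (pow-nonzero q (Rep.nonzero r)))
      where
      β = pow γ (i ℕ.+ q-1)
      k = j ℕ.+ suc h
      ω = pow γ (2 ℕ.* k)
      -- ω^(q-1) = γ^(2(q-1)k) is the ratio v/w needed by rep-multiply.
      relation : φ ω * pow γ i ≈ ω * φ β
      relation = begin
        φ ω * pow γ i ≈⟨ *-congʳ (φ-pow-γ (2 ℕ.* k)) ⟩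
        pow γ (2 ℕ.* k ℕ.* (2 ℕ.* h ℕ.+ 1)) * pow γ i ≈⟨ pow-+ γ (2 ℕ.* k ℕ.* (2 ℕ.* h ℕ.+ 1)) i ⟨
        pow γ (2 ℕ.* k ℕ.* (2 ℕ.* h ℕ.+ 1) ℕ.+ i) ≡⟨ ≡.cong (pow γ)
          (≡.subst (λ i → 2 ℕ.* k ℕ.* (2 ℕ.* h ℕ.+ 1) ℕ.+ i ≡ 2 ℕ.* k ℕ.+ (i ℕ.+ q-1) ℕ.* (2 ℕ.* h ℕ.+ 1)) (≡.sym i≡) (Nat.solve 2 (λ j h →
            Nat.con 2 Nat.:* (j Nat.:+ (Nat.con 1 Nat.:+ h)) Nat.:* (Nat.con 2 Nat.:* h Nat.:+ Nat.con 1) Nat.:+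
              (Nat.con 2 Nat.:* j Nat.:+ Nat.con 1)
              Nat.:= Nat.con 2 Nat.:* (j Nat.:+ (Nat.con 1 Nat.:+ h)) Nat.:+ ((Nat.con 2 Nat.:* j Nat.:+ Nat.con 1)
              Nat.:+ Nat.con 2 Nat.:* h) Nat.:* (Nat.con 2 Nat.:* h Nat.:+ Nat.con 1)) ≡.refl j h)) ⟩
        pow γ (2 ℕ.* k ℕ.+ (i ℕ.+ q-1) ℕ.* (2 ℕ.* h ℕ.+ 1)) ≈⟨ pow-+ γ (2 ℕ.* k) _ ⟩
        ω * pow γ ((i ℕ.+ q-1) ℕ.* (2 ℕ.* h ℕ.+ 1)) ≈⟨ *-congˡ (φ-pow-γ (i ℕ.+ q-1)) ⟨
        ω * φ β ∎
      φ²ω : φ (φ ω) ≈ ω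
      φ²ω = trans (pow-q² ω) (trans (*-congˡ (trans (pow-comm γ (2 ℕ.* k) (q-1 ℕ.* q+1))
        (trans (pow-cong (2 ℕ.* k) γ^[q²-1]≈-1) (pow-neg-one-even k)))) (*-identityʳ ω))
      ω+φω-In : In (ω + φ ω)
      ω+φω-In = trans (φ-+ ω (φ ω)) (trans (+-congˡ φ²ω) (+-comm _ _))
      ρ[ω-φω]-In : In (ρ * (ω + - φ ω))
      ρ[ω-φω]-In = trans (φ-* ρ _) (trans (*-cong φρ≈-ρ (trans (φ-+ ω _) (+-congˡ (trans (φ-neg _) (-‿cong φ²ω))))) (solve 3 (λ x y ρ →
        :- ρ :* (y :- x)
          := ρ :* (x :- y)) refl ω (φ ω) ρ))
      go : ∃[ β̂ ] φ β * β̂ ≈ 1# → ∃[ y′ ] (φ y ⟶ y′ × Rep ρ y′ (pow γ i))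
      go (β̂ , inv) = Product.map₂ (λ (M′ , r″) → ⟶-trans (proj₂ inverted) M′ , r″)
        (rep-multiply ρ≉0 ρ²-In φ²ρ (proj₁ inverted) (γ^odd-antifixed odd)
          (pow-nonzero (2 ℕ.* k) γ-nonzero) (pow-nonzero q (pow-nonzero (2 ℕ.* k) γ-nonzero)) ω+φω-In ρ[ω-φω]-In relation)
        where inverted = rep-inverse ρ≉0 ρ²-In φ²ρ (rep-φ₂ r inv) (trans (*-comm β̂ (φ β)) inv)

  module Type₁ = Reduction type₁
  module Type₂ = Reduction type₂

  -- Normalising the involution that takes α to φ²(α).

  Normalised : Carrier → Carrier → Set (κ ⊔ ℓ)
  Normalised α η = ∃[ y ] (α ⟶ y × y * φ (φ y) ≈ η * η)

  module _ {α : Carrier} (d4 : Degree4 α) where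
    private
      α″ = φ (φ α)
      S = α + α″
      P = α * α″

    φ²S : φ (φ S) ≈ S
    φ²S = trans (φ-cong (φ-+ α α″)) (trans (φ-+ _ _) (trans (+-congˡ (φ⁴ α)) (+-comm _ _)))

    φ²P : φ (φ P) ≈ P
    φ²P = trans (φ-cong (φ-* α α″)) (trans (φ-* _ _) (trans (*-congˡ (φ⁴ α)) (*-comm _ _)))

    -- φ² acts on α as x ↦ S - x.
    normalise-affine : In S → Normalised α 1#
    -- φ² negates δ = 2α - S, hence inverts y = (1 + δ)/(1 - δ). These are the coefficients of that
    -- map; the determinant is 4.
    normalise-affine S-In = go (möbius-image d4 2-In 1-S-In (In-neg 2-In) 1+S-In det)
      where
      2-In : In (1# + 1#)
      2-In = In-+ In-1 In-1
      1-S-In : In (1# + - S)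
      1-S-In = In-+ In-1 (In-neg S-In)
      1+S-In : In (1# + S)
      1+S-In = In-+ In-1 S-In
      det : ¬ (1# + 1#) * (1# + S) + - ((1# + - S) * - (1# + 1#)) ≈ 0#
      det z = *-nonzero 2≉0 2≉0 (trans (sym (solve 1 (λ S →
        (:1 :+ :1) :* (:1 :+ S) :- ((:1 :- S) :* :- (:1 :+ :1))
          := (:1 :+ :1) :* (:1 :+ :1)) refl S)) z)
      go : ∃[ y ] y * (- (1# + 1#) * α + (1# + S)) ≈ (1# + 1#) * α + (1# + - S) → Normalised α 1#
      go (y , image) = y , M , *-cancelˡ U≉0
        (norm (φ (φ y)) α″ image (_⟶_.image (⟶-φ (⟶-φ M))))
        where
        M : α ⟶ y
        M = möbius 2-In 1-S-In (In-neg 2-In) 1+S-In det image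
        U≉0 : ¬ (1# + 1#) * α + (1# + - S) ≈ 0#
        U≉0 z = degree4-nonzero (degree4-⟶ M d4) (zero-factor
          (denominator-nonzero (degree4⇒∉F d4) (In-neg 2-In) 1+S-In det) (trans (*-comm _ y) (trans image z)))
        norm : ∀ y″ α″ → y * (- (1# + 1#) * α + (1# + (α + α″))) ≈ (1# + 1#) * α + (1# + - (α + α″)) →
          y″ * (- (1# + 1#) * α″ + (1# + (α + α″))) ≈ (1# + 1#) * α″ + (1# + - (α + α″)) →
          ((1# + 1#) * α + (1# + - (α + α″))) * (y * y″) ≈ ((1# + 1#) * α + (1# + - (α + α″))) * (1# * 1#)
        norm y″ α″ e e″ = combine₂ 1# y e e″
          (solve 4 (λ α α″ y y″ →
            ((:1 :+ :1) :* α :+ (:1 :- (α :+ α″))) :* (y :* y″) :- ((:1 :+ :1) :* α :+ (:1 :- (α :+ α″))) :* (:1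
              :* :1)
              := :1 :* (y :* (:- (:1 :+ :1) :* α :+ (:1 :+ (α :+ α″))) :- ((:1 :+ :1) :* α :+ (:1 :- (α :+ α″)))) :+
              y :* (y″ :* (:- (:1 :+ :1) :* α″ :+ (:1 :+ (α :+ α″))) :- ((:1 :+ :1) :* α″ :+ (:1 :- (α :+ α″))))) refl α α″ y y″)

    -- φ² acts on α as an involution with centre b: (α - b)(φ² α - b) ∈ F_q.
    centre : ¬ In S → ∃[ b ] (In b × In ((α + - b) * (α″ + - b)))
    centre S∉F = b , b-In , In-resp (expand b) (In-+ (In-* b-In b-In) (In-neg c-In))
      where
      ΔS≉0 : ¬ φ S + - S ≈ 0#
      ΔS≉0 z = S∉F (x-y≈0⇒x≈y z)
      u = proj₁ (inverse (φ S + - S) ΔS≉0)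
      -- For b in F_q, the product P - bS + b² is fixed by φ exactly when b (φ(S) - S) = φ(P) - P.
      -- Both differences are negated by φ, so the quotient b does lie in F_q.
      b = (φ P + - P) * u
      b-eq : (φ S + - S) * b ≈ φ P + - P
      b-eq = cancel (φ S + - S) (φ P + - P) u (proj₂ (inverse (φ S + - S) ΔS≉0))
        where cancel : ∀ s p u → s * u ≈ 1# → s * (p * u) ≈ p
              cancel s p u e = combine₁ p e (solve 3 (λ s p u → s :* (p :* u) :- p := p :* (s :* u :- :1)) refl s p u)
      b-In : In b
      b-In = *-cancelˡ ΔS≉0 (trans (flip′ (φ S) S (φ b) (φ P) P (begin
        (S + - φ S) * φ b ≈⟨ *-congʳ (trans (φ-+ (φ S) (- S)) (+-cong φ²S (φ-neg S))) ⟨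
        φ (φ S + - S) * φ b ≈⟨ φ-* _ _ ⟨
        φ ((φ S + - S) * b) ≈⟨ φ-cong b-eq ⟩
        φ (φ P + - P) ≈⟨ trans (φ-+ (φ P) (- P)) (+-cong φ²P (φ-neg P)) ⟩
        P + - φ P ∎)) (sym b-eq))
        where flip′ : ∀ s′ s b p′ p → (s + - s′) * b ≈ p + - p′ → (s′ + - s) * b ≈ p′ + - p
              flip′ s′ s b p′ p e = combine₁ (- 1#) e (solve 5 (λ s′ s b p′ p →
                (s′ :- s) :* b :- (p′ :- p)
                  := :- :1 :* ((s :- s′) :* b :- (p :- p′))) refl s′ s b p′ p)
      c-In : In (b * S + - P)
      c-In = trans (φ-+ _ _) (trans (+-cong (trans (φ-* b S) (*-congʳ b-In)) (φ-neg P)) (invariant (φ S) S b (φ P) P b-eq))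
        where invariant : ∀ s′ s b p′ p → (s′ + - s) * b ≈ p′ + - p → b * s′ + - p′ ≈ b * s + - p
              invariant s′ s b p′ p e = combine₁ 1# e (solve 5 (λ s′ s b p′ p →
                (b :* s′ :- p′) :- (b :* s :- p)
                  := :1 :* ((s′ :- s) :* b :- (p′ :- p))) refl s′ s b p′ p)
      expand : ∀ b → b * b + - (b * S + - P) ≈ (α + - b) * (α″ + - b)
      expand b = solve 3 (λ b x y → b :* b :- (b :* (x :+ y) :- x :* y) := (x :- b) :* (y :- b)) refl b α α″

    -- The map y = (α - b)/e moves the centre to 0 and divides the product by e².
    normalise-centred : ∀ {η b e} → In b → In e → ¬ e ≈ 0# → (α + - b) * (α″ + - b) ≈ (η * e) * (η * e) → Normalised α η
    normalise-centred {η} {b} {e} b-In e-In e≉0 N = go (möbius-image d4 In-1 (In-neg b-In) In-0 e-In det)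
      where
      det : ¬ 1# * e + - (- b * 0#) ≈ 0#
      det z = e≉0 (trans (solve 2 (λ e b → e := :1 :* e :- (:- b :* :0)) refl e b) z)
      go : ∃[ y ] y * (0# * α + e) ≈ 1# * α + - b → Normalised α η
      go (y , image) = y , M , *-cancelˡ (*-nonzero e≉0 e≉0) (norm (φ (φ y)) α″ image (_⟶_.image (⟶-φ (⟶-φ M))) N)
        where
        M : α ⟶ y
        M = möbius In-1 (In-neg b-In) In-0 e-In det image
        norm : ∀ y″ α″ → y * (0# * α + e) ≈ 1# * α + - b → y″ * (0# * α″ + e) ≈ 1# * α″ + - b →
          (α + - b) * (α″ + - b) ≈ (η * e) * (η * e) → e * e * (y * y″) ≈ e * e * (η * η)
        norm y″ α″ e₁ e₂ e₃ = combine₃ (y″ * e) (α + - b) 1# e₁ e₂ e₃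
          (solve 7 (λ α α″ y y″ e b η →
            e :* e :* (y :* y″) :- e :* e :* (η :* η)
              := y″ :* e :* (y :* (:0 :* α :+ e) :- (:1 :* α :- b)) :+ ((α :- b) :* (y″ :* (:0 :* α″ :+ e) :- (:1 :*
              α″ :- b)) :+ :1 :* ((α :- b) :* (α″ :- b) :- η :* e :* (η :* e)))) refl α α″ y y″ e b η)

    -- Elements of F_q are squares in F_(q²): D = γ^(2k(q+1)) has the root e = γ^(k(q+1)). As e² is
    -- in F_q, φ fixes or negates e; in the second case e/ρ lies in F_q, and η = ρ takes up the
    -- missing factor.
    normalise-square : ∀ {b} → In b → In ((α + - b) * (α″ + - b)) → Normalised α 1# ⊎ Normalised α ρ
    normalise-square {b} b-In D-In = go (In⇒γ^2[q+1] D-In D≉0)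
      where
      D = (α + - b) * (α″ + - b)
      ≉b : ∀ {x} → Degree4 x → ¬ x + - b ≈ 0#
      ≉b d z = degree4⇒∉F d (In-resp (sym (x-y≈0⇒x≈y z)) b-In)
      D≉0 : ¬ D ≈ 0#
      D≉0 = *-nonzero (≉b d4) (≉b (degree4-φ (degree4-φ d4)))
      go : ∃[ k ] (k < q-1 × D ≈ pow γ (k ℕ.* (2 ℕ.* q+1))) → Normalised α 1# ⊎ Normalised α ρ
      go (k , _ , D≈) = Sum.map fixed antifixed (square-equal (trans (sym (φ-* e e)) (In-resp D≈e² D-In)))
        where
        e = pow γ (k ℕ.* q+1)
        e≉0 : ¬ e ≈ 0#
        e≉0 = pow-nonzero (k ℕ.* q+1) γ-nonzero
        D≈e² : D ≈ e * e
        D≈e² = trans D≈ (trans (reflexive (≡.cong (pow γ) (≡.trans (≡.cong (k ℕ.*_) (≡.cong (q+1 ℕ.+_) (ℕₚ.+-identityʳ q+1)))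
          (ℕₚ.*-distribˡ-+ k q+1 q+1)))) (pow-+ γ (k ℕ.* q+1) (k ℕ.* q+1)))
        fixed : φ e ≈ e → Normalised α 1#
        fixed e-In = normalise-centred b-In e-In e≉0 (trans D≈e² (*-cong (sym (*-identityˡ e)) (sym (*-identityˡ e))))
        antifixed : φ e ≈ - e → Normalised α ρ
        antifixed φe≈-e = split (inverse ρ ρ≉0)
          where
          split : ∃[ r ] ρ * r ≈ 1# → Normalised α ρ
          split (r , ρr≈1) = normalise-centred b-In e′-In (*-nonzero e≉0 (unit⇒nonzero (trans (*-comm r ρ) ρr≈1)))
            (trans D≈e² (sym (*-cong (back e) (back e))))
            where
            back : ∀ e → ρ * (e * r) ≈ e
            back e = combine₁ e ρr≈1 (solve 3 (λ e r ρ → ρ :* (e :* r) :- e := e :* (ρ :* r :- :1)) refl e r ρ)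
            φr≈-r : φ r ≈ - r
            φr≈-r = *-cancelˡ ρ≉0 (negated (φ r) (trans (*-congʳ (sym φρ≈-ρ)) (φ-inverse ρr≈1)))
              where negated : ∀ r′ → - ρ * r′ ≈ 1# → ρ * r′ ≈ ρ * - r
                    negated r′ e = combine₂ (- 1#) 1# e ρr≈1 (solve 3 (λ r r′ ρ →
                      ρ :* r′ :- ρ :* :- r
                        := :- :1 :* (:- ρ :* r′ :- :1) :+ :1 :* (ρ :* r :- :1)) refl r r′ ρ)
            e′-In : In (e * r)
            e′-In = trans (φ-* e r) (trans (*-cong φe≈-e φr≈-r) (solve 2 (λ e r → :- e :* :- r := e :* r) refl e r))

    normalise : Normalised α 1# ⊎ Normalised α ρ
    normalise = decide (φ S ≟ S)
      where
      decide : Dec (In S) → Normalised α 1# ⊎ Normalised α ρ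
      decide (yes S-In) = inj₁ (normalise-affine S-In)
      decide (no S∉F) = let (b , b-In , D-In) = centre S∉F in normalise-square b-In D-In

  -- The elements of S₄ as representatives of orbits.

  [q+1]/2≡ : (q ℕ.+ 1) / 2 ≡ suc h
  [q+1]/2≡ = ≡.trans (≡.cong (_/ 2) (≡.trans (≡.cong (ℕ._+ 1) q≡2h+1) (≡.trans (ℕₚ.+-assoc q-1 1 1)
    (≡.trans (ℕₚ.+-comm q-1 2) (≡.trans (≡.sym (ℕₚ.*-suc 2 h)) (ℕₚ.*-comm 2 (suc h))))))) (m*n/n≡m (suc h) 2)

  [q-1]/2≡ : (q ∸ 1) / 2 ≡ h
  [q-1]/2≡ = ≡.trans (≡.cong (_/ 2) (≡.trans (≡.cong (_∸ 1) q≡2h+1) (≡.trans (ℕₚ.m+n∸n≡m q-1 1) (ℕₚ.*-comm 2 h)))) (m*n/n≡m h 2)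

  2*[1+h]≡q+1 : 2 ℕ.* suc h ≡ q+1
  2*[1+h]≡q+1 = ≡.trans (ℕₚ.*-suc 2 h) (ℕₚ.+-comm 2 q-1)

  S4⇒member : ∀ {s} → InS4 q γ ρ s → Type₁.Member s ⊎ Type₂.Member s
  S4⇒member (inj₁ (i , odd , _ , i≤ , e)) = inj₁ (i , odd ,
    ≡.subst (2 ℕ.* i ≤_) 2*[1+h]≡q+1 (ℕₚ.*-monoʳ-≤ 2 (≡.subst (i ≤_) [q+1]/2≡ i≤)) ,
    γ^odd-rep odd (trans e (sym (*-identityˡ _))))
  S4⇒member (inj₂ (i , odd , _ , i≤ , e)) = inj₂ (i , odd ,
    ℕₚ.*-monoʳ-≤ 2 (≡.subst (i ≤_) [q-1]/2≡ i≤) , γ^odd-rep odd e)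

  member₁⇒S4 : ∀ {s} → Type₁.Member s → InS4 q γ ρ s
  member₁⇒S4 (i , odd , 2i≤ , rep e _ _) = inj₁ (i , odd , odd⇒1≤ odd ,
    ≡.subst (i ≤_) (≡.sym [q+1]/2≡) (ℕₚ.*-cancelˡ-≤ 2 (≡.subst (2 ℕ.* i ≤_) (≡.sym 2*[1+h]≡q+1) 2i≤)) ,
    trans e (*-identityˡ _))

  member₂⇒S4 : ∀ {s} → Type₂.Member s → InS4 q γ ρ s
  member₂⇒S4 (i , odd , 2i≤ , rep e _ _) = inj₂ (i , odd , odd⇒1≤ odd ,
    ≡.subst (i ≤_) (≡.sym [q-1]/2≡) (ℕₚ.*-cancelˡ-≤ 2 2i≤) , e)

  S4-degree4 : ∀ {s} → InS4 q γ ρ s → Degree4 s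
  S4-degree4 = [ Type₁.member-degree4 , Type₂.member-degree4 ]′ ∘ S4⇒member

  HomMinPoly≋minPoly : ∀ {f} → HomMinPolyOfS4 q γ ρ f → ∃[ s ] (InS4 q γ ρ s × f ≋ minPoly s)
  HomMinPoly≋minPoly (s , h , s∈S4 , isMin , f≋h) = s , s∈S4 , ≋-trans f≋h (minPoly-unique (S4-degree4 s∈S4) isMin)

  -- δ is fixed by φ, so applying φ to the norm equation merely moves along the conjugates of t.
  conjugate-norm : ∀ {t y δ} → In δ → eval (minPoly t) y ≈ 0# → t * φ (φ t) ≈ δ → y * φ (φ y) ≈ δ
  conjugate-norm {t} {y} {δ} δ-In root norm =
    [ resp norm , [ resp (next norm) , [ resp (next (next norm)) , resp (next (next (next norm))) ]′ ]′ ]′ (conjugate-factors root)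
    where
    next : ∀ {x} → x * φ (φ x) ≈ δ → φ x * φ (φ (φ x)) ≈ δ
    next e = trans (sym (φ-* _ _)) (trans (φ-cong e) δ-In)
    resp : ∀ {x} → x * φ (φ x) ≈ δ → y ≈ x → y * φ (φ y) ≈ δ
    resp e y≈x = trans (*-cong y≈x (φ-cong (φ-cong y≈x))) e

  norm₁ : ∀ {s} → Type₁.Member s → s * φ (φ s) ≈ 1# * 1#
  norm₁ (_ , _ , _ , r) = rep-norm 1≉0 1²-In φ²1 r

  norm₂ : ∀ {s} → Type₂.Member s → s * φ (φ s) ≈ ρ * ρ
  norm₂ (_ , _ , _ , r) = rep-norm ρ≉0 ρ²-In φ²ρ r

  -- Within one type the invariant decides. Different types never meet: conjugates keep their norm,
  -- and the norms 1 and ρ² differ by a nonsquare of F_q.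
  S4-unique : ∀ {s t y} → InS4 q γ ρ s → InS4 q γ ρ t → s ⟶ y → eval (minPoly t) y ≈ 0# → s ≈ t
  S4-unique {s} {t} {y} s∈ t∈ M root = cases (S4⇒member s∈) (S4⇒member t∈)
    where
    cases : Type₁.Member s ⊎ Type₂.Member s → Type₁.Member t ⊎ Type₂.Member t → s ≈ t
    cases (inj₁ m) (inj₁ m′) = Type₁.member-unique M root m m′
    cases (inj₂ m) (inj₂ m′) = Type₂.member-unique M root m m′
    cases (inj₁ m) (inj₂ m′) = contradiction (conjugate-norm ρ²-In root (norm₂ m′))
      (different-norms M (S4-degree4 s∈) ρ∉F ρ²-In (norm₁ m))
    cases (inj₂ m) (inj₁ m′) = contradiction (norm₂ m)
      (different-norms (⟶-sym M) (degree4-⟶ M (S4-degree4 s∈)) ρ∉F ρ²-In (conjugate-norm 1²-In root (norm₁ m′)))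

  unique-representatives : ∀ f g → HomMinPolyOfS4 q γ ρ f → HomMinPolyOfS4 q γ ρ g → SameOrbit q f g → f ≋ g
  unique-representatives f g Pf Pg orbit = go (HomMinPoly≋minPoly Pf) (HomMinPoly≋minPoly Pg)
    where
    go : ∃[ s ] (InS4 q γ ρ s × f ≋ minPoly s) → ∃[ t ] (InS4 q γ ρ t × g ≋ minPoly t) → f ≋ g
    go (s , s∈ , f≋) (t , t∈ , g≋) = step (SameOrbit⇒⟶ (S4-degree4 s∈) f≋ g≋ orbit)
      where
      step : ∃[ y ] (s ⟶ y × eval (minPoly t) y ≈ 0#) → f ≋ g
      step (y , M , root) = ≋-trans f≋ (≋-trans (minPoly-cong (S4-unique s∈ t∈ M root)) (≋-sym g≋))

  q⁴≡ : suc (q ℕ.^ 4 ∸ 4) ℕ.+ 3 ≡ q ℕ.^ 4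
  q⁴≡ = ≡.trans (≡.sym (ℕₚ.+-suc (q ℕ.^ 4 ∸ 4) 3)) (ℕₚ.m∸n+n≡m (ℕₚ.≤-trans (ℕₚ.m≤m+n 4 12) (ℕₚ.^-monoˡ-≤ 4 2≤q)))
    where
    2≤q : 2 ≤ q
    2≤q = ≡.subst (2 ≤_) (≡.sym q≡suc[q-1]) (s≤s 0<q-1)

  root-of-quartic : ∀ f → MonicIrredQuartic q f → ∃[ α ] (eval f α ≈ 0# × Degree4 α)
  root-of-quartic (f₀ ∷ f₁ ∷ f₂ ∷ f₃ ∷ f₄ ∷ []) ((i₀ ∷ i₁ ∷ i₂ ∷ i₃ ∷ _ ∷ []) , ≡.refl , monic , irreducible) =
    Product.map₂ (λ root → root , irreducible-root-degree4 i₀ i₁ i₂ i₃ monic irreducible root)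
      (quartic-root i₀ i₁ i₂ i₃ monic irreducible (q ℕ.^ 4 ∸ 4) q⁴≡)

  module _ {f : Poly} (quartic : MonicIrredQuartic q f) where

    -- The root α is left free because φ moves it to another root of `f`; this makes the property
    -- stable under φ as well as under Möbius maps.
    FromRoot : Carrier → Set (κ ⊔ ℓ)
    FromRoot y = ∃[ α ] (eval f α ≈ 0# × Degree4 α × α ⟶ y)

    fromRoot-⟶ : ∀ {x y} → FromRoot x → x ⟶ y → FromRoot y
    fromRoot-⟶ (α , root , d4 , M) M′ = α , root , d4 , ⟶-trans M M′

    fromRoot-φ : ∀ {x} → FromRoot x → FromRoot (φ x)
    fromRoot-φ (α , root , d4 , M) = φ α , φ-root (proj₁ quartic) root , degree4-φ d4 , ⟶-φ M

    reach : ∀ {η m m′} (T : NormalType η m m′) {α} → eval f α ≈ 0# → Degree4 α → Normalised α η →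
            ∃[ s ] (FromRoot s × Reduction.Member T s)
    reach {η} T {α} root d4 (y , M , norm) = go (norm⇒rep η≉0 η²-In φ²η (degree4-⟶ M d4) norm)
      where
      open NormalType T
      go : ∃[ β ] Rep η y β → ∃[ s ] (FromRoot s × Reduction.Member T s)
      go (β , r@(rep _ anti β≉0)) = go′ (antifixed⇒γ^odd β≉0 anti)
        where
        go′ : ∃[ i ] (OddNat i × β ≈ pow γ i) → ∃[ s ] (FromRoot s × Reduction.Member T s)
        go′ (i , odd , β≈) = Reduction.reach-member T FromRoot fromRoot-⟶ fromRoot-φ odd
          (y , (α , root , d4 , M) , rep-resp β≈ r)

    reach-S4 : ∃[ s ] (FromRoot s × InS4 q γ ρ s)
    reach-S4 = go (root-of-quartic f quartic)
      where
      go : ∃[ α ] (eval f α ≈ 0# × Degree4 α) → ∃[ s ] (FromRoot s × InS4 q γ ρ s)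
      go (α , root , d4) = [ Product.map₂ (Product.map₂ member₁⇒S4) ∘ reach type₁ root d4
                           , Product.map₂ (Product.map₂ member₂⇒S4) ∘ reach type₂ root d4 ]′ (normalise d4)

    representative : ∃[ g ] (HomMinPolyOfS4 q γ ρ g × SameOrbit q f g)
    representative = go reach-S4
      where
      go : ∃[ s ] (FromRoot s × InS4 q γ ρ s) → ∃[ g ] (HomMinPolyOfS4 q γ ρ g × SameOrbit q f g)
      go (s , (α , root , d4 , M) , s∈) = minPoly s ,
        (s , minPoly s , s∈ , minPoly-isMinPoly (S4-degree4 s∈) , ≋-refl) ,
        ⟶⇒SameOrbit (proj₁ quartic) (proj₁ (proj₂ quartic)) (proj₁ (proj₂ (proj₂ quartic))) root d4 M

  representatives-quartic : ∀ f → HomMinPolyOfS4 q γ ρ f → MonicIrredQuartic q f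
  representatives-quartic f Pf = go (HomMinPoly≋minPoly Pf)
    where
    go : ∃[ s ] (InS4 q γ ρ s × f ≋ minPoly s) → MonicIrredQuartic q f
    go (s , s∈ , f≋) = minPoly-quartic (S4-degree4 s∈) f≋

open import Data.Nat using (_^_; _*_)

theorem1p2 : {c ℓ : Level} (R : CommutativeRing c ℓ) (q : ℕ) → OddPrimePower q →
    let open FieldDefs R in IsField → HasCard (q ^ 4) →
    (γ ρ : CommutativeRing.Carrier R) → HasOrder γ (2 * (q ^ 2 ∸ 1)) →
    InF (q ^ 2) ρ → ¬ InF q ρ → InF q (CommutativeRing._*_ R ρ ρ) →
    (∀ s → InS4 q γ ρ s → ∃[ h ] IsMinPoly q s h) ×
    CompleteUniqueReps q (HomMinPolyOfS4 q γ ρ)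
theorem1p2 R q q-odd isField card γ ρ order _ ρ∉F ρ²-In =
  (λ s s∈ → minPoly s , minPoly-isMinPoly (S4-degree4 s∈)) ,
  representatives-quartic , (λ f quartic → representative quartic) , unique-representatives
  where
  open Frobenius R q q-odd isField card using (minPoly; minPoly-isMinPoly)
  open Classification R q q-odd isField card γ order ρ ρ∉F ρ²-In
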